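{- For every nonnegative integer $N$, the rooted trees $\mathbb{T}_N^{\breve{\mathcal{G}},\breve{V}}$ and $\mathbb{T}_N^{\breve{\mathcal{T}},\breve{u}}$ are isomorphic, where the correspondence between the vertices is given by the bijections $$\breve{\mathsf{ST}}_{k+1}:\breve{\mathcal{G}}_k\to\breve{\mathrm{TY}}_{k+2}=\breve{\mathcal{T}}_{k+2},\qquad k=0,1,\dots,N,$$ from the set of level $k$ vertices of the first tree to the set of level $k$ vertices of the second.
   Context: Notation. $[m]=\{1,\dots,m\}$. $\binom{i}{j}$ denotes an ordered pair (not a binomial coefficient). $[\![P]\!]$ is $1$ if $P$ is true and $0$ otherwise. Generalized Farey intervals. For integers $m,n\ge 0$ let $G_{m,n}=\{0,\infty\}$ if $mn=0$ and $G_{m,n}=\{0,\infty\}\cup\{p/q: p\in[m],q\in[n]\}$ otherwise. $G^{\mathrm{int}}_{m,n}$ is the set of open intervals $(a,b)$ with $a<b$ consecutive elements of $G_{m,n}$ (in increasing order). $\mathcal{G}_{m,n}=\{((a,b),\binom{m}{n}):(a,b)\in G^{\mathrm{int}}_{m,n}\}$ and $\breve{\mathcal{G}}_k=\bigsqcup_{m,n\ge0,\,m+n=k}\mathcal{G}_{m,n}$. The map $\breve V_k:\breve{\mathcal{G}}_k\to\breve{\mathcal{G}}_{k-1}$ ($k\ge1$) is defined on $((a,b),\binom{m}{n})\in\mathcal{G}_{m,n}$, $m+n=k$, as follows. If $m=0$: $((0,\infty),\binom{0}{n})\mapsto((0,\infty),\binom{0}{n-1})$. If $n=0$: $((0,\infty),\binom{m}{0})\mapsto((0,\infty),\binom{m-1}{0})$.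 If $mn\ge1$, exactly one of the following four cases occurs, and $$((a,b),\tbinom{m}{n})\mapsto\begin{cases}((a,b),\binom{m-1}{n})& b<\frac mn,\\ ((a,\min\{c\in G_{m-1,n}:a<c\}),\binom{m-1}{n})& b=\frac mn,\\ ((\max\{c\in G_{m,n-1}:c<b\},b),\binom{m}{n-1})& a=\frac mn,\\ ((a,b),\binom{m}{n-1})& a>\frac mn.\end{cases}$$ This map is known to be well defined and surjective. Terminal pairs of difference equation type. For $m,n\ge1$, $\mathcal{E}^{1,\mathrm{in}}_{m,n}$ is the set of injections $f:([m]\times\{1\})\cup(\{1\}\times[n])\to[mn]$ with $f(1,1)=1$ such that $f(i+1,1)-f(i,1)=\sum_{t\in[n]}[\![f(1,t)\le f(i+1,1)]\!]$ for all $i\in[m-1]$ and $f(1,j+1)-f(1,j)=\sum_{s\in[m]}[\![f(s,1)\le f(1,j+1)]\!]$ for all $j\in[n-1]$. Let $\mathcal{T}^{1,\mathrm{in}}_{m,n}=\{(f(m,1),f(1,n),\binom{m}{n}):f\in\mathcal{E}^{1,\mathrm{in}}_{m,n}\}$ and $\breve{\mathcal{T}}_k=\bigsqcup_{m,n\ge1,\,m+n=k}\mathcal{T}^{1,\mathrm{in}}_{m,n}$ for $k\ge2$. For $k\ge3$ the map $\breve u_k:\breve{\mathcal{T}}_k\to\breve{\mathcal{T}}_{k-1}$ sends $(s,t,\binom{m}{n})$ to $(s-n,t,\binom{m-1}{n})$ if $s>t$ and to $(s,t-m,\binom{m}{n-1})$ if $s<t$ (known to be well defined and surjective). Young terminal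 pairs. For $m,n\ge1$ and real $\xi>0$ let $\tau^{m,n}_{1,\xi}:[m]\times[n]\to[mn]$, $\tau^{m,n}_{1,\xi}(i,j)=\sum_{s\in[m]}\sum_{t\in[n]}[\![s+t\xi\le i+j\xi]\!]$. $\mathrm{Y}_{m,n}$ is the set of those $\tau^{m,n}_{1,\xi}$ ($\xi>0$) that are injective. $\mathrm{TY}_{m,n}=\{(\theta(m,1),\theta(1,n),\binom{m}{n}):\theta\in\mathrm{Y}_{m,n}\}$ and $\breve{\mathrm{TY}}_k=\bigsqcup_{m,n\ge1,\,m+n=k}\mathrm{TY}_{m,n}$ for $k\ge 2$. For $k\ge2$, the map $\breve{\mathsf{ST}}_{k-1}:\breve{\mathcal{G}}_{k-2}\to\breve{\mathrm{TY}}_k$ sends $((a,b),\binom{m-1}{n-1})$ (with $m,n\ge1$, $m+n=k$) to $(\tau^{m,n}_{1,\xi}(m,1),\tau^{m,n}_{1,\xi}(1,n),\binom{m}{n})$ for any $\xi\in(a,b)$ (the value does not depend on the choice of $\xi$; this map is known to be a well-defined bijection). Trees. $\mathbb{T}_N^{\breve{\mathcal{G}},\breve V}$ is the rooted tree whose set of level $k$ vertices is $\breve{\mathcal{G}}_k$ ($0\le k\le N$), with root $((0,\infty),\binom{0}{0})$, where for $k<k'$ the vertices $v\in\breve{\mathcal{G}}_k$, $v'\in\breve{\mathcal{G}}_{k'}$ are adjacent iff $k'=k+1$ and $\breve V_{k'}(v')=v$. $\mathbb{T}_N^{\breve{\mathcal{T}},\breve u}$ is the rooted tree whose set of level $k$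 vertices is $\breve{\mathcal{T}}_{k+2}$ ($0\le k\le N$), with root $(1,1,\binom{1}{1})$, where for $k<k'$ the vertices $v\in\breve{\mathcal{T}}_{k+2}$, $v'\in\breve{\mathcal{T}}_{k'+2}$ are adjacent iff $k'=k+1$ and $\breve u_{k'+2}(v')=v$. -}

module Defs where

open import Data.Empty using (⊥)
open import Data.Fin.Base using (Fin; zero; suc; toℕ; inject₁; fromℕ)
open import Data.Integer.Base using (+_)
import Data.Maybe.Base as Maybe
open import Data.Nat.Base as ℕ using (ℕ; zero; suc; z≤n)
import Data.Nat.Properties as ℕ
open import Data.Product using (Σ; ∃; Σ-syntax; ∃-syntax; _×_; _,_; proj₁; proj₂)
open import Data.Rational.Base as ℚ using (ℚ; 0ℚ; ½)
import Data.Rational.Properties as ℚ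
open import Data.Rational.Solver using (module +-*-Solver)
open import Data.Sum.Base using (_⊎_; inj₁; inj₂)
open import Function.Bundles using (Bijection; _⇔_)
open import Function.Definitions using (Injective)
open import Level using (0ℓ)
open import Relation.Binary.Bundles using (Setoid)
open import Relation.Binary.Core using (Rel)
open import Relation.Binary.PropositionalEquality
  using (_≡_; refl; sym; trans; cong; subst; setoid)
import Relation.Binary.Construct.Add.Supremum.NonStrict as NonStrict
import Relation.Binary.Construct.Add.Supremum.Strict as Strict
open import Relation.Binary.Construct.Closure.Symmetric using (SymClosure)
import Relation.Binary.Construct.On as On
open import Relation.Nullary using (¬_; Dec)
open import Relation.Nullary.Construct.Add.Supremum using (_⁺; [_]) renaming (⊤⁺ to ∞)
open import Relation.Nullary.Decidable.Core using (does)
open import Relation.Unary using (Pred; _∈_)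
open import Algebra.Properties.Monoid.Sum ℕ.+-0-monoid using (sum-syntax)
open import Data.Bool.Base using (if_then_else_)

open Strict ℚ._<_ public using (_<⁺_; [_]; [_]<⊤⁺)
open NonStrict ℚ._≤_ public using (_≤⁺_)

private
  variable
    A P : Set

⟦_⟧ : Dec P → ℕ
⟦ P? ⟧ = if does P? then 1 else 0

-- A subset as a setoid: membership proofs are ignored.
Subset : Pred A 0ℓ → Setoid 0ℓ 0ℓ
Subset {A} P = On.setoid {B = Σ A P} (setoid A) proj₁

-- Cauchy sequences of rationals.
record ℝ : Set where
  field
    seq    : ℕ → ℚ
    cauchy : ∀ ε → 0ℚ ℚ.< ε → ∃[ N ] ∀ i j → N ℕ.≤ i → N ℕ.≤ j →
             ℚ.∣ seq i ℚ.- seq j ∣ ℚ.< ε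

open ℝ public

infix 4 _<ℝ_ _≤ℝ_
infixl 6 _+ℝ_
infixl 7 _·_

_<ℝ_ : Rel ℝ 0ℓ
x <ℝ y = ∃[ ε ] 0ℚ ℚ.< ε × ∃[ N ] ∀ i → N ℕ.≤ i → seq x i ℚ.+ ε ℚ.< seq y i

_≤ℝ_ : Rel ℝ 0ℓ
x ≤ℝ y = ¬ (y <ℝ x)

fromℚ : ℚ → ℝ
fromℚ q = record
  { seq    = λ _ → q
  ; cauchy = λ ε 0<ε → 0 , λ _ _ _ _ →
      subst (λ z → ℚ.∣ z ∣ ℚ.< ε) (sym (ℚ.+-inverseʳ q)) 0<ε
  }

fromℕ-ℝ : ℕ → ℝ
fromℕ-ℝ n = fromℚ (+ n ℚ./ 1)

_+ℝ_ : ℝ → ℝ → ℝ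
seq    (x +ℝ y) i = seq x i ℚ.+ seq y i
cauchy (x +ℝ y) ε 0<ε = M ℕ.⊔ N , close
  where
  open +-*-Solver
  open ℚ.≤-Reasoning

  0<½ε : 0ℚ ℚ.< ½ ℚ.* ε
  0<½ε = subst (ℚ._< ½ ℚ.* ε) (ℚ.*-zeroʳ ½) (ℚ.*-monoʳ-<-pos ½ 0<ε)

  halves : ½ ℚ.* ε ℚ.+ ½ ℚ.* ε ≡ ε
  halves = trans (sym (ℚ.*-distribʳ-+ ε ½ ½)) (ℚ.*-identityˡ ε)

  regroup : ∀ a b c d → (a ℚ.+ c) ℚ.- (b ℚ.+ d) ≡ (a ℚ.- b) ℚ.+ (c ℚ.- d)
  regroup = solve 4 (λ a b c d → (a :+ c) :- (b :+ d) := (a :- b) :+ (c :- d)) refl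

  M = proj₁ (cauchy x (½ ℚ.* ε) 0<½ε)
  N = proj₁ (cauchy y (½ ℚ.* ε) 0<½ε)

  close : ∀ i j → M ℕ.⊔ N ℕ.≤ i → M ℕ.⊔ N ℕ.≤ j →
          ℚ.∣ (seq x i ℚ.+ seq y i) ℚ.- (seq x j ℚ.+ seq y j) ∣ ℚ.< ε
  close i j M⊔N≤i M⊔N≤j = begin-strict
    ℚ.∣ (seq x i ℚ.+ seq y i) ℚ.- (seq x j ℚ.+ seq y j) ∣
      ≡⟨ cong ℚ.∣_∣ (regroup (seq x i) (seq x j) (seq y i) (seq y j)) ⟩
    ℚ.∣ (seq x i ℚ.- seq x j) ℚ.+ (seq y i ℚ.- seq y j) ∣
      ≤⟨ ℚ.∣p+q∣≤∣p∣+∣q∣ (seq x i ℚ.- seq x j) (seq y i ℚ.- seq y j) ⟩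
    ℚ.∣ seq x i ℚ.- seq x j ∣ ℚ.+ ℚ.∣ seq y i ℚ.- seq y j ∣
      <⟨ ℚ.+-mono-<
           (proj₂ (cauchy x (½ ℚ.* ε) 0<½ε) i j
             (ℕ.m⊔n≤o⇒m≤o M N M⊔N≤i) (ℕ.m⊔n≤o⇒m≤o M N M⊔N≤j))
           (proj₂ (cauchy y (½ ℚ.* ε) 0<½ε) i j
             (ℕ.m⊔n≤o⇒n≤o M N M⊔N≤i) (ℕ.m⊔n≤o⇒n≤o M N M⊔N≤j)) ⟩
    ½ ℚ.* ε ℚ.+ ½ ℚ.* ε
      ≡⟨ halves ⟩
    ε ∎

_·_ : ℕ → ℝ → ℝ
zero  · x = fromℚ 0ℚ
suc n · x = x +ℝ n · x

-- (p + 1) / (q + 1); an element p : Fin m stands for p + 1 ∈ {1, …, m}.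
frac : ℕ → ℕ → ℚ ⁺
frac p q = [ + suc p ℚ./ suc q ]

-- The fractions are absent when m or n is 0, since Fin 0 is empty.
G : ℕ → ℕ → Pred (ℚ ⁺) 0ℓ
G m n x = x ≡ [ 0ℚ ] ⊎ x ≡ ∞ ⊎ ∃[ p ] ∃[ q ] x ≡ frac (toℕ {m} p) (toℕ {n} q)

Interval : Set
Interval = ℚ ⁺ × ℚ ⁺

Gⁱⁿᵗ : ℕ → ℕ → Pred Interval 0ℓ
Gⁱⁿᵗ m n (a , b) =
  a ∈ G m n × b ∈ G m n × a <⁺ b × (∀ c → c ∈ G m n → ¬ (a <⁺ c × c <⁺ b))

LabelledInterval : Set
LabelledInterval = Interval × ℕ × ℕ

G˘ : ℕ → Pred LabelledInterval 0ℓ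
G˘ k (I , m , n) = m ℕ.+ n ≡ k × I ∈ Gⁱⁿᵗ m n

IsMin IsMax : Pred (ℚ ⁺) 0ℓ → Pred (ℚ ⁺) 0ℓ
IsMin S c = c ∈ S × (∀ d → d ∈ S → c ≤⁺ d)
IsMax S c = c ∈ S × (∀ d → d ∈ S → d ≤⁺ c)

-- The graph of the map V˘: V˘ v′ v holds iff the map sends v′ to v.
data V˘ : Rel LabelledInterval 0ℓ where
  m≡0   : ∀ {n} → V˘ (([ 0ℚ ] , ∞) , 0 , suc n) (([ 0ℚ ] , ∞) , 0 , n)
  n≡0   : ∀ {m} → V˘ (([ 0ℚ ] , ∞) , suc m , 0) (([ 0ℚ ] , ∞) , m , 0)
  b<m/n : ∀ {a b m n} → b <⁺ frac m n →
          V˘ ((a , b) , suc m , suc n) ((a , b) , m , suc n)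
  b≡m/n : ∀ {a b c m n} → b ≡ frac m n →
          IsMin (λ d → d ∈ G m (suc n) × a <⁺ d) c →
          V˘ ((a , b) , suc m , suc n) ((a , c) , m , suc n)
  a≡m/n : ∀ {a b c m n} → a ≡ frac m n →
          IsMax (λ d → d ∈ G (suc m) n × d <⁺ b) c →
          V˘ ((a , b) , suc m , suc n) ((c , b) , suc m , n)
  a>m/n : ∀ {a b m n} → frac m n <⁺ a →
          V˘ ((a , b) , suc m , suc n) ((a , b) , suc m , n)

-- (s , t , m , n) is the pair (s , t) labelled by (m , n).
LabelledPair : Set
LabelledPair = ℕ × ℕ × ℕ × ℕ

-- ([m + 1] × {1}) ∪ ({1} × [n + 1]); the two parts share (1 , 1).
data Hook (m n : ℕ) : Set where
  corner : Hook m n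
  col⁺   : Fin m → Hook m n
  row⁺   : Fin n → Hook m n

col : ∀ {m n} → Fin (suc m) → Hook m n
col zero    = corner
col (suc i) = col⁺ i

row : ∀ {m n} → Fin (suc n) → Hook m n
row zero    = corner
row (suc j) = row⁺ j

-- As for Hook, the parameters m and n stand for the sizes m + 1 and n + 1;
-- likewise i : Fin n stands for i + 1, hence the suc in val.
record E¹ⁱⁿ (m n : ℕ) : Set where
  field
    fun       : Hook m n → Fin (suc m ℕ.* suc n)
    injective : Injective _≡_ _≡_ fun

  val : Hook m n → ℕ
  val x = suc (toℕ (fun x))

  field
    f11≡1   : val corner ≡ 1
    col-eqn : ∀ (i : Fin m) → val (col (suc i)) ≡
              val (col (inject₁ i)) ℕ.+
              ∑[ t < suc n ] ⟦ val (row t) ℕ.≤? val (col (suc i)) ⟧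
    row-eqn : ∀ (j : Fin n) → val (row (suc j)) ≡
              val (row (inject₁ j)) ℕ.+
              ∑[ s < suc m ] ⟦ val (col s) ℕ.≤? val (row (suc j)) ⟧

T¹ⁱⁿ : ℕ → ℕ → Pred LabelledPair 0ℓ
T¹ⁱⁿ (suc m) (suc n) w = Σ[ f ∈ E¹ⁱⁿ m n ]
  w ≡ (E¹ⁱⁿ.val f (col (fromℕ m)) , E¹ⁱⁿ.val f (row (fromℕ n)) , suc m , suc n)
T¹ⁱⁿ _       _       _ = ⊥

T˘ : ℕ → Pred LabelledPair 0ℓ
T˘ k w = ∃[ m ] ∃[ n ] m ℕ.+ n ≡ k × w ∈ T¹ⁱⁿ m n

-- The graph of the map u˘: u˘ v′ v holds iff the map sends v′ to v.
data u˘ : Rel LabelledPair 0ℓ where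
  s>t : ∀ {s s′ t m n} → t ℕ.< s → s ≡ s′ ℕ.+ n →
        u˘ (s , t , suc m , n) (s′ , t , m , n)
  s<t : ∀ {s t t′ m n} → s ℕ.< t → t ≡ t′ ℕ.+ m →
        u˘ (s , t , m , suc n) (s , t′ , m , n)

-- i + j ξ for 1-based i and j
lin : ∀ {m n} → ℝ → Fin m × Fin n → ℝ
lin ξ (i , j) = fromℕ-ℝ (suc (toℕ i)) +ℝ suc (toℕ j) · ξ

-- τ counts, so it needs these decisions (its values do not depend on them). Classically
-- every real number is Comparable.
Comparable : ℕ → ℕ → ℝ → Set
Comparable m n ξ = (p q : Fin m × Fin n) → Dec (lin ξ p ≤ℝ lin ξ q)

τ : ∀ {m n} (ξ : ℝ) → Comparable m n ξ → Fin m × Fin n → ℕ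
τ {m} {n} ξ _≤?_ (i , j) = ∑[ s < m ] ∑[ t < n ] ⟦ (s , t) ≤? (i , j) ⟧

Y : (m n : ℕ) → Pred (Fin m × Fin n → ℕ) 0ℓ
Y m n θ = Σ[ ξ ∈ ℝ ] fromℚ 0ℚ <ℝ ξ × Σ[ ξ? ∈ Comparable m n ξ ]
  (∀ p → θ p ≡ τ ξ ξ? p) × Injective _≡_ _≡_ θ

terminal : ∀ m n → (Fin (suc m) × Fin (suc n) → ℕ) → LabelledPair
terminal m n θ = θ (fromℕ m , zero) , θ (zero , fromℕ n) , suc m , suc n

TY : ℕ → ℕ → Pred LabelledPair 0ℓ
TY (suc m) (suc n) w = ∃[ θ ] θ ∈ Y (suc m) (suc n) × w ≡ terminal m n θ
TY _       _       _ = ⊥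

TY˘ : ℕ → Pred LabelledPair 0ℓ
TY˘ k w = ∃[ m ] ∃[ n ] m ℕ.+ n ≡ k × w ∈ TY m n

_∈⟨_⟩ : ℝ → Interval → Set
ξ ∈⟨ a , b ⟩ = Maybe.map fromℚ a <⁺ℝ [ ξ ] × [ ξ ] <⁺ℝ Maybe.map fromℚ b
  where open Strict _<ℝ_ renaming (_<⁺_ to _<⁺ℝ_)

-- The graph of the map ST˘: every ξ in the interval can be used to compute
-- the value, and all of them give the same one.
ST˘ : LabelledInterval → LabelledPair → Set
ST˘ (I , m , n) w = ∀ ξ → ξ ∈⟨ I ⟩ →
  Σ[ ξ? ∈ Comparable (suc m) (suc n) ξ ] w ≡ terminal m n (τ ξ ξ?)

record RootedGraph : Set₁ where
  field
    vertices : Setoid 0ℓ 0ℓ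

  open Setoid vertices public renaming (Carrier to Vertex)

  field
    root : Vertex
    Adj  : Rel Vertex 0ℓ

record _≅_ (S T : RootedGraph) : Set where
  private
    module S = RootedGraph S
    module T = RootedGraph T

  field
    bijection : Bijection S.vertices T.vertices

  open Bijection bijection public using (to)

  field
    to-root : to S.root T.≈ T.root
    to-Adj  : ∀ v v′ → S.Adj v v′ ⇔ T.Adj (to v) (to v′)

-- The rooted tree of height N whose level k vertices are the elements of L k,
-- and in which a level k + 1 vertex v′ is joined to the level k vertex v with
-- parent v′ v.
levelTree : (L : ℕ → Pred A 0ℓ) (parent : Rel A 0ℓ) (r : A) → r ∈ L 0 →
            ℕ → RootedGraph
levelTree {A} L parent r r∈L₀ N = record
  { vertices = On.setoid {B = Vertex} (setoid (ℕ × A)) (λ (k , _ , v , _) → k , v)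
  ; root     = 0 , z≤n , r , r∈L₀
  ; Adj      = SymClosure λ (k , _ , v , _) (k′ , _ , v′ , _) →
                 k′ ≡ suc k × parent v′ v
  }
  where
  Vertex : Set
  Vertex = Σ[ k ∈ ℕ ] k ℕ.≤ N × Σ A (L k)

rootG : LabelledInterval
rootG = ([ 0ℚ ] , ∞) , 0 , 0

rootG∈G˘ : rootG ∈ G˘ 0
rootG∈G˘ = refl , inj₁ refl , inj₂ (inj₁ refl) , [ 0ℚ ]<⊤⁺ , consecutive
  where
  consecutive : ∀ c → c ∈ G 0 0 → ¬ ([ 0ℚ ] <⁺ c × c <⁺ ∞)
  consecutive _ (inj₁ refl)        ([ 0<0 ] , _) = ℚ.<-irrefl refl 0<0
  consecutive _ (inj₂ (inj₁ refl)) (_ , ())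

rootT : LabelledPair
rootT = 1 , 1 , 1 , 1

rootT∈T˘ : rootT ∈ T˘ 2
rootT∈T˘ = 1 , 1 , refl , f , refl
  where
  inj : ∀ {x y : Hook 0 0} → zero {0} ≡ zero → x ≡ y
  inj {corner} {corner} _ = refl

  f : E¹ⁱⁿ 0 0
  f = record
    { fun       = λ _ → zero
    ; injective = inj
    ; f11≡1     = refl
    ; col-eqn   = λ ()
    ; row-eqn   = λ ()
    }

𝕋-G𝕍 : ℕ → RootedGraph
𝕋-G𝕍 = levelTree G˘ V˘ rootG rootG∈G˘

𝕋-T𝕦 : ℕ → RootedGraph
𝕋-T𝕦 = levelTree (λ k → T˘ (2 ℕ.+ k)) u˘ rootT rootT∈T˘

{-# OPTIONS --safe #-}

-- Let a = p / q < b = p′ / q′ be consecutive in G m n. For ξ in (a , b), comparing the cells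
-- i + j ξ with 0 ≤ i ≤ m, 0 ≤ j ≤ n amounts to comparing the integers i v + j u, where u / v
-- is the mediant of a and b. Hence all values of ST˘ are counts T (row end) and S (column end)
-- of lattice points. T depends on a alone and strictly increases with it, S depends on b alone,
-- and S + T = (m + 1) (n + 1) + 1.
--
-- If a < (m + 1) / n, raising m by one changes no cell counted by T, and the point reflection
-- of the array shows T < S + n + 1; if a ≥ (m + 1) / n, it shows T ≥ S + n + 1 instead. With
-- the symmetric statements for b and S this matches V˘ with u˘, and it lifts each step of u˘ on
-- solutions of the difference equations to intervals, so every solution comes from an interval.
module Submission where

open import Defs
open import Data.Fin.Base using (Fin; zero; suc; toℕ; inject₁; fromℕ; fromℕ<; opposite)
import Data.Fin.Permutation as Perm
import Data.Fin.Properties as Fin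
import Data.Integer.Base as ℤ
import Data.Integer.Properties as ℤ
open import Data.List.Base using (List; []; _∷_; cartesianProductWith; allFin)
open import Data.List.Membership.Propositional using () renaming (_∈_ to _∈ₗ_)
open import Data.List.Membership.Propositional.Properties
  using (∈-allFin; ∈-cartesianProductWith⁺; ∈-cartesianProductWith⁻)
open import Data.List.Relation.Unary.Any using (here; there)
import Data.Maybe.Base as Maybe
open import Data.Nat.Base
open import Data.Nat.Properties
open import Data.Nat.Tactic.RingSolver using (solve-∀)
open import Data.Product using (∃-syntax; Σ-syntax; _×_; _,_; proj₁; proj₂; swap)
open import Data.Rational.Base as ℚ using (ℚ; mkℚ; 0ℚ; 1ℚ; ½)
import Data.Rational.Properties as ℚ
open import Data.Rational.Solver using (module +-*-Solver)
import Data.Rational.Unnormalised.Base as ℚᵘ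
import Data.Rational.Unnormalised.Properties as ℚᵘ
open import Data.Sum.Base using (_⊎_; inj₁; inj₂; [_,_]′)
open import Function.Base using (_∘_; case_of_)
open import Function.Bundles using (Bijection; mk⇔)
open import Function.Definitions using (Injective)
open import Level using (0ℓ)
import Relation.Binary.Construct.Add.Supremum.NonStrict as NonStrict
import Relation.Binary.Construct.Add.Supremum.Strict as Strict
open import Relation.Binary.Construct.Closure.Symmetric using (fwd; bwd)
open import Relation.Binary.Definitions using (Tri; tri<; tri≈; tri>)
open import Relation.Binary.PropositionalEquality
import Relation.Binary.Reasoning.Setoid as ≈-Reasoning
open import Relation.Nullary using (¬_; Dec; yes; no; contradiction)
open import Relation.Nullary.Construct.Add.Supremum using (_⁺; [_]) renaming (⊤⁺ to ∞)
open import Relation.Nullary.Decidable using (map′)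
open import Relation.Unary using (Pred; _∈_; _≐_)
open import Algebra.Properties.CommutativeMonoid.Sum +-0-commutativeMonoid
  using (sum; sum-syntax; sum-cong-≗; sum-init-last; ∑-distrib-+; ∑-comm; ∑-permute)

-- At an end of an interval distinct cells can tie, so the identity for `S + T` fails there; at an
-- inner point there are no ties, but the effect of a new row is harder to see. The mediant is an
-- inner point with integer coordinates, and since `T` takes the same value at the mediant and at
-- `a`, each argument can use whichever of the two suits it. Transposing the array sends a slope to
-- its reciprocal and exchanges the ends, which gives the statements about `S` from those about `T`.
-- The order of Cauchy reals is undecidable, so the combinatorics is done with natural numbers; real
-- points enter late, and only through comparisons that are stable under double negation.

variable
  m n k : ℕ

-- Indicators and finite sums

⟦⟧-yes : ∀ {P : Set} (P? : Dec P) → P → ⟦ P? ⟧ ≡ 1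
⟦⟧-yes (yes _) _ = refl
⟦⟧-yes (no ¬p) p = contradiction p ¬p

⟦⟧-no : ∀ {P : Set} (P? : Dec P) → ¬ P → ⟦ P? ⟧ ≡ 0
⟦⟧-no (yes p) ¬p = contradiction p ¬p
⟦⟧-no (no _)  _  = refl

⟦⟧-cong : ∀ {P Q : Set} (P? : Dec P) (Q? : Dec Q) → (P → Q) → (Q → P) → ⟦ P? ⟧ ≡ ⟦ Q? ⟧
⟦⟧-cong (yes p) Q? f _ = sym (⟦⟧-yes Q? (f p))
⟦⟧-cong (no ¬p) Q? _ g = sym (⟦⟧-no Q? (¬p ∘ g))

opaque

  ⟦_≼_⟧ : ℕ → ℕ → ℕ
  ⟦ x ≼ y ⟧ = ⟦ x ≤? y ⟧

  ⟦≼⟧-def : ∀ x y → ⟦ x ≼ y ⟧ ≡ ⟦ x ≤? y ⟧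
  ⟦≼⟧-def x y = refl

  ⟦≼⟧-yes : ∀ {x y} → x ≤ y → ⟦ x ≼ y ⟧ ≡ 1
  ⟦≼⟧-yes {x} {y} = ⟦⟧-yes (x ≤? y)

  ⟦≼⟧-no : ∀ {x y} → y < x → ⟦ x ≼ y ⟧ ≡ 0
  ⟦≼⟧-no {x} {y} y<x = ⟦⟧-no (x ≤? y) (<⇒≱ y<x)

  ⟦≼⟧-cong : ∀ {x y x′ y′} → (x ≤ y → x′ ≤ y′) → (x′ ≤ y′ → x ≤ y) → ⟦ x ≼ y ⟧ ≡ ⟦ x′ ≼ y′ ⟧
  ⟦≼⟧-cong {x} {y} {x′} {y′} = ⟦⟧-cong (x ≤? y) (x′ ≤? y′)

  ⟦≼⟧≤1 : ∀ {x y} → ⟦ x ≼ y ⟧ ≤ 1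
  ⟦≼⟧≤1 {x} {y} with x ≤? y
  ... | yes x≤y = ≤-reflexive (⟦⟧-yes (x ≤? y) x≤y)
  ... | no  x≰y = ≤-trans (≤-reflexive (⟦⟧-no (x ≤? y) x≰y)) z≤n

⟦≼⟧-mono : ∀ {x y x′ y′} → (x ≤ y → x′ ≤ y′) → ⟦ x ≼ y ⟧ ≤ ⟦ x′ ≼ y′ ⟧
⟦≼⟧-mono {x} {y} f with x ≤? y
... | yes x≤y = ≤-trans ⟦≼⟧≤1 (≤-reflexive (sym (⟦≼⟧-yes (f x≤y))))
... | no  x≰y = ≤-trans (≤-reflexive (⟦≼⟧-no (≰⇒> x≰y))) z≤n

⟦≼⟧-exclusive : ∀ {x y x′ y′} → (x ≤ y → y′ < x′) → ⟦ x ≼ y ⟧ + ⟦ x′ ≼ y′ ⟧ ≤ 1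
⟦≼⟧-exclusive {x} {y} f with x ≤? y
... | yes x≤y = ≤-trans (+-monoʳ-≤ _ (≤-reflexive (⟦≼⟧-no (f x≤y)))) (subst (_≤ 1) (sym (+-identityʳ _)) ⟦≼⟧≤1)
... | no  x≰y = +-mono-≤ (≤-reflexive (⟦≼⟧-no (≰⇒> x≰y))) ⟦≼⟧≤1

⟦≼⟧-covering : ∀ {x y x′ y′} → (y < x → x′ ≤ y′) → 1 ≤ ⟦ x ≼ y ⟧ + ⟦ x′ ≼ y′ ⟧
⟦≼⟧-covering {x} {y} f with x ≤? y
... | yes x≤y = ≤-trans (≤-reflexive (sym (⟦≼⟧-yes x≤y))) (m≤m+n _ _)
... | no  x≰y = ≤-trans (≤-reflexive (sym (⟦≼⟧-yes (f (≰⇒> x≰y))))) (m≤n+m _ _)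

-- Linear consequences: the second argument certifies that the conclusion is
-- the hypothesis up to adding the same quantity to both sides.
≤-from : ∀ {a b x y} → a ≤ b → x + b ≡ a + y → x ≤ y
≤-from {a} {b} {x} {y} a≤b eq =
  +-cancelʳ-≤ b x y (subst (_≤ y + b) (sym eq) (subst (a + y ≤_) (+-comm b y) (+-monoˡ-≤ y a≤b)))

<-from : ∀ {a b x y} → a < b → x + b ≡ a + y → x < y
<-from a<b eq = ≤-from a<b (cong suc eq)

≡-from : ∀ {a b x y} → a ≡ b → x + b ≡ a + y → x ≡ y
≡-from {a} {_} {x} {y} refl eq = +-cancelʳ-≡ a x y (trans eq (+-comm a y))

sum-mono : {f g : Fin n → ℕ} → (∀ i → f i ≤ g i) → sum f ≤ sum g
sum-mono {zero}  f≤g = z≤n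
sum-mono {suc n} f≤g = +-mono-≤ (f≤g zero) (sum-mono (f≤g ∘ suc))

-- With `k = 1` this turns a single extra cell into a strict inequality between two counts.
sum-mono-bump : {f g : Fin n → ℕ} → (∀ i → f i ≤ g i) → ∀ i → f i + k ≤ g i → sum f + k ≤ sum g
sum-mono-bump {k = k} {f} {g} f≤g zero h =
  ≤-from (+-mono-≤ h (sum-mono (f≤g ∘ suc)))
    (lem (f zero) (sum (f ∘ suc)) k (g zero) (sum (g ∘ suc)))
  where
  lem : ∀ a b c d e → a + b + c + (d + e) ≡ a + c + b + (d + e)
  lem = solve-∀
sum-mono-bump {k = k} {f} {g} f≤g (suc i) h =
  subst (_≤ sum g) (sym (+-assoc (f zero) _ k))
    (+-mono-≤ (f≤g zero) (sum-mono-bump (f≤g ∘ suc) i h))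

sum-cong-bump : {f g : Fin n → ℕ} (i : Fin n) → (∀ j → j ≢ i → f j ≡ g j) → g i ≡ f i + k →
                sum g ≡ sum f + k
sum-cong-bump {k = k} {f} {g} zero f≡g h
  rewrite h | sum-cong-≗ (λ j → f≡g (suc j) (λ ())) = lem (f zero) (sum (g ∘ suc)) k
  where
  lem : ∀ a b c → a + c + b ≡ a + b + c
  lem = solve-∀
sum-cong-bump {k = k} {f} {g} (suc i) f≡g h
  rewrite f≡g zero (λ ()) | sum-cong-bump {k = k} {f ∘ suc} {g ∘ suc} i
            (λ j j≢i → f≡g (suc j) (j≢i ∘ Fin.suc-injective)) h = sym (+-assoc (g zero) _ k)

sum-const : ∀ n c → sum {n} (λ _ → c) ≡ n * c
sum-const zero    c = refl
sum-const (suc n) c = cong (c +_) (sum-const n c)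

sum-zero : {f : Fin n → ℕ} → (∀ i → f i ≡ 0) → sum f ≡ 0
sum-zero {n} f≡0 = trans (sum-cong-≗ f≡0) (trans (sum-const n 0) (*-zeroʳ n))

opaque

  sum² : (Fin m → Fin n → ℕ) → ℕ
  sum² f = sum (λ s → sum (f s))

  sum²-def : (f : Fin m → Fin n → ℕ) → sum² f ≡ ∑[ s < m ] ∑[ t < n ] f s t
  sum²-def f = refl

  sum²-suc : (f : Fin (suc m) → Fin n → ℕ) → sum² f ≡ sum (f zero) + sum² (f ∘ suc)
  sum²-suc f = refl

  sum²-comm : (f : Fin m → Fin n → ℕ) → sum² f ≡ sum² (λ t s → f s t)
  sum²-comm f = ∑-comm f

  sum²-cong : {f g : Fin m → Fin n → ℕ} → (∀ s t → f s t ≡ g s t) → sum² f ≡ sum² g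
  sum²-cong f≡g = sum-cong-≗ (λ s → sum-cong-≗ (f≡g s))

  sum²-mono : {f g : Fin m → Fin n → ℕ} → (∀ s t → f s t ≤ g s t) → sum² f ≤ sum² g
  sum²-mono f≤g = sum-mono (λ s → sum-mono (f≤g s))

  sum²-mono-bump : {f g : Fin m → Fin n → ℕ} → (∀ s t → f s t ≤ g s t) →
                   ∀ i j → f i j + k ≤ g i j → sum² f + k ≤ sum² g
  sum²-mono-bump f≤g i j h = sum-mono-bump (λ s → sum-mono (f≤g s)) i (sum-mono-bump (f≤g i) j h)

  sum²-cong-bump : {f g : Fin m → Fin n → ℕ} (i : Fin m) (j : Fin n) →
                   (∀ s t → (s , t) ≢ (i , j) → f s t ≡ g s t) → g i j ≡ f i j + k →
                   sum² g ≡ sum² f + k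
  sum²-cong-bump i j f≡g h = sum-cong-bump i
    (λ s s≢i → sum-cong-≗ (λ t → f≡g s t (s≢i ∘ cong proj₁)))
    (sum-cong-bump j (λ t t≢j → f≡g i t (t≢j ∘ cong proj₂)) h)

  sum²-const : ∀ m n c → sum² {m} {n} (λ _ _ → c) ≡ m * (n * c)
  sum²-const m n c = trans (sum-cong-≗ {m} (λ _ → sum-const n c)) (sum-const m (n * c))

  sum²-one : ∀ m n → sum² {m} {n} (λ _ _ → 1) ≡ m * n
  sum²-one m n = trans (sum²-const m n 1) (cong (m *_) (*-identityʳ n))

  sum²-+ : (f g : Fin m → Fin n → ℕ) → sum² (λ s t → f s t + g s t) ≡ sum² f + sum² g
  sum²-+ f g = trans (sum-cong-≗ (λ s → ∑-distrib-+ (f s) (g s)))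
                     (∑-distrib-+ (λ s → sum (f s)) (λ s → sum (g s)))

  sum²-opposite : (f : Fin m → Fin n → ℕ) → sum² (λ s t → f (opposite s) (opposite t)) ≡ sum² f
  sum²-opposite f = trans (sum-cong-≗ (λ s → sym (∑-permute (f (opposite s)) Perm.reverse)))
                          (sym (∑-permute (λ s → sum (f s)) Perm.reverse))

  sum²-last : (f : Fin (suc m) → Fin n → ℕ) → (∀ t → f (fromℕ m) t ≡ 0) →
              sum² f ≡ sum² (f ∘ inject₁)
  sum²-last f f≡0 = trans (sum-init-last (λ s → sum (f s)))
    (trans (cong (sum² (f ∘ inject₁) +_) (sum-zero f≡0)) (+-identityʳ _))

-- Point reflection, weights and ranks of the cells of an array

toℕ+opposite : (i : Fin n) → toℕ i + suc (toℕ (opposite i)) ≡ n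
toℕ+opposite {n} i rewrite Fin.opposite-prop i =
  trans (+-suc (toℕ i) _) (m+[n∸m]≡n (Fin.toℕ<n i))

opposite-complement : (i : Fin (suc n)) → toℕ i + toℕ (opposite i) ≡ n
opposite-complement i = suc-injective (trans (sym (+-suc (toℕ i) _)) (toℕ+opposite i))

-- The weight (u , v) stands for the slope u / v, which compares the cells
-- i + j ξ of an array at ξ = u / v after clearing the denominator.
Weight : Set
Weight = ℕ × ℕ

opaque

  -- Indices are zero-based here and one-based in `lin`; the shift changes every cell by the same
  -- `u + v` and so never affects a comparison.
  ℓ : Weight → Fin m × Fin n → ℕ
  ℓ (u , v) (i , j) = toℕ i * v + toℕ j * u

  ℓ-def : ∀ w (p : Fin m × Fin n) →
          ℓ w p ≡ toℕ (proj₁ p) * proj₂ w + toℕ (proj₂ p) * proj₁ w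
  ℓ-def w p = refl

  ℓ-swap : ∀ w (p : Fin m × Fin n) → ℓ w p ≡ ℓ (swap w) (swap p)
  ℓ-swap (u , v) (i , j) = +-comm (toℕ i * v) (toℕ j * u)

  -- `τ` at the slope `u / v`, with the denominator cleared so that `1 / 0` is allowed too.
  τℕ : Weight → Fin m × Fin n → ℕ
  τℕ {m} {n} w p = sum² {m} {n} (λ s t → ⟦ ℓ w (s , t) ≼ ℓ w p ⟧)

  τℕ-def : ∀ w (p : Fin m × Fin n) → τℕ w p ≡ sum² {m} {n} (λ s t → ⟦ ℓ w (s , t) ≼ ℓ w p ⟧)
  τℕ-def w p = refl

module _ (w : Weight) where

  opaque
    unfolding τℕ

    τℕ-mono : {p q : Fin m × Fin n} → ℓ w p ≤ ℓ w q → τℕ w p ≤ τℕ w q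
    τℕ-mono p≤q = sum²-mono (λ s t → ⟦≼⟧-mono (λ x≤p → ≤-trans x≤p p≤q))

    τℕ-mono-< : {p q : Fin m × Fin n} → ℓ w p < ℓ w q → τℕ w p < τℕ w q
    τℕ-mono-< {p = p} {q} p<q = subst (_≤ τℕ w q) (+-comm (τℕ w p) 1)
      (sum²-mono-bump (λ s t → ⟦≼⟧-mono (λ x≤p → ≤-trans x≤p (<⇒≤ p<q))) (proj₁ q) (proj₂ q)
        (≤-reflexive (trans (cong (_+ 1) (⟦≼⟧-no p<q)) (sym (⟦≼⟧-yes (≤-refl {ℓ w q}))))))

    1≤τℕ : (p : Fin m × Fin n) → 1 ≤ τℕ w p
    1≤τℕ p@(i , j) = ≤-trans (m≤n+m 1 _)
      (sum²-mono-bump {k = 1} {f = λ _ _ → 0} (λ _ _ → z≤n) i j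
        (≤-reflexive (sym (⟦≼⟧-yes (≤-refl {ℓ w p})))))

    τℕ≤mn : (p : Fin m × Fin n) → τℕ w p ≤ m * n
    τℕ≤mn {m} {n} p = ≤-trans (sum²-mono (λ s t → ⟦≼⟧≤1)) (≤-reflexive (sum²-one m n))

  τℕ-cancel-≤ : {p q : Fin m × Fin n} → τℕ w p ≤ τℕ w q → ℓ w p ≤ ℓ w q
  τℕ-cancel-≤ h = ≮⇒≥ (λ q<p → <⇒≱ (τℕ-mono-< q<p) h)

  τℕ-cancel-≡ : {p q : Fin m × Fin n} → τℕ w p ≡ τℕ w q → ℓ w p ≡ ℓ w q
  τℕ-cancel-≡ h = ≤-antisym (τℕ-cancel-≤ (≤-reflexive h)) (τℕ-cancel-≤ (≤-reflexive (sym h)))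

opaque
  unfolding τℕ

  -- Transposing the array turns the slope into its reciprocal, so one argument serves for rows and
  -- columns.
  τℕ-swap : ∀ w (p : Fin m × Fin n) → τℕ w p ≡ τℕ (swap w) (swap p)
  τℕ-swap w p = trans
    (sum²-cong (λ s t → cong₂ ⟦_≼_⟧ (ℓ-swap w (s , t)) (ℓ-swap w p)))
    (sum²-comm (λ s t → ⟦ ℓ (swap w) (t , s) ≼ ℓ (swap w) (swap p) ⟧))

-- The corner has the least possible value 0, and injectivity leaves no second cell with that value,
-- so the corner counts only itself.
τℕ-corner : ∀ w → Injective _≡_ _≡_ (ℓ {suc m} {suc n} w) → τℕ {suc m} {suc n} w (zero , zero) ≡ 1
τℕ-corner {m} {n} w inj = begin
  τℕ w (zero , zero)
    ≡⟨ τℕ-def w (zero , zero) ⟩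
  sum² {suc m} {suc n} (λ s t → ⟦ ℓ w (s , t) ≼ ℓ w (zero , zero) ⟧)
    ≡⟨ sum²-cong-bump {f = λ _ _ → 0} zero zero
         (λ s t ≢ → sym (⟦≼⟧-no (≰⇒> λ h → ≢ (inj (n≤0⇒n≡0′ h)))))
         (⟦≼⟧-yes ≤-refl) ⟩
  sum² {suc m} {suc n} (λ _ _ → 0) + 1
    ≡⟨ cong (_+ 1) (trans (sum²-const (suc m) (suc n) 0)
         (trans (cong (suc m *_) (*-zeroʳ (suc n))) (*-zeroʳ (suc m)))) ⟩
  1 ∎
  where
  open ≡-Reasoning
  n≤0⇒n≡0′ : ∀ {p : Fin (suc m) × Fin (suc n)} →
             ℓ w p ≤ ℓ w (zero {m} , zero {n}) → ℓ w p ≡ ℓ w (zero {m} , zero {n})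
  n≤0⇒n≡0′ h = ≤-antisym h (≤-trans (≤-reflexive (ℓ-def w (zero , zero))) z≤n)

-- Shifting the rows by one matches the cells counted at (i + 1 , 0) outside the
-- first row with those counted at (i , 0).
τℕ-col-step : ∀ w → Injective _≡_ _≡_ (ℓ {suc m} {suc n} w) → ∀ i →
  τℕ {suc m} {suc n} w (suc i , zero) ≡
  τℕ {suc m} {suc n} w (inject₁ i , zero) +
  sum {suc n} (λ t → ⟦ τℕ {suc m} {suc n} w (zero , t) ≼ τℕ {suc m} {suc n} w (suc i , zero) ⟧)
τℕ-col-step {m} {n} w@(u , v) inj i = begin
  τℕ w next
    ≡⟨ τℕ-def w next ⟩
  sum² {suc m} {suc n} (λ s t → ⟦ ℓ w (s , t) ≼ ℓ w next ⟧)
    ≡⟨ sum²-suc (λ s t → ⟦ ℓ w (s , t) ≼ ℓ w next ⟧) ⟩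
  sum {suc n} (λ t → ⟦ ℓ w (zero {m} , t) ≼ ℓ w next ⟧) + sum² (λ s t → ⟦ ℓ w (suc s , t) ≼ ℓ w next ⟧)
    ≡⟨ cong₂ _+_ first lower ⟩
  sum {suc n} (λ t → ⟦ τℕ {suc m} w (zero , t) ≼ τℕ w next ⟧) + τℕ w prev
    ≡⟨ +-comm _ (τℕ w prev) ⟩
  τℕ w prev + sum {suc n} (λ t → ⟦ τℕ {suc m} w (zero , t) ≼ τℕ w next ⟧) ∎
  where
  open ≡-Reasoning
  next prev : Fin (suc m) × Fin (suc n)
  next = suc i , zero
  prev = inject₁ i , zero

  first : sum {suc n} (λ t → ⟦ ℓ w (zero {m} , t) ≼ ℓ w next ⟧) ≡
          sum {suc n} (λ t → ⟦ τℕ {suc m} w (zero , t) ≼ τℕ w next ⟧)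
  -- `τℕ` and `ℓ` order the cells alike, so either may be used to count the cells of the first row.
  first = sum-cong-≗ {suc n} λ t → ⟦≼⟧-cong (τℕ-mono w {p = zero , t} {q = next}) (τℕ-cancel-≤ w {p = zero , t} {q = next})

  v>0 : 0 < v
  -- If `v` were 0, moving down the first column would not change the value, against injectivity.
  v>0 = n≢0⇒n>0 λ { refl → case inj {zero , zero} {next}
    (trans (ℓ-def w (zero , zero)) (trans (sym (trans (+-identityʳ _) (*-zeroʳ (toℕ (suc i)))))
      (sym (ℓ-def w next)))) of λ () }

  last : ∀ t → ⟦ ℓ w (fromℕ m , t) ≼ ℓ w prev ⟧ ≡ 0
  last t = ⟦≼⟧-no (≤R.begin-strict
    ℓ w prev                      ≤R.≡⟨ ℓ-def w prev ⟩
    toℕ (inject₁ i) * v + 0       ≤R.≡⟨ +-identityʳ _ ⟩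
    toℕ (inject₁ i) * v           ≤R.≡⟨ cong (_* v) (Fin.toℕ-inject₁ i) ⟩
    toℕ i * v                     ≤R.<⟨ *-monoˡ-< v ⦃ >-nonZero v>0 ⦄ (Fin.toℕ<n i) ⟩
    m * v                         ≤R.≡⟨ cong (_* v) (Fin.toℕ-fromℕ m) ⟨
    toℕ (fromℕ m) * v             ≤R.≤⟨ m≤m+n _ _ ⟩
    toℕ (fromℕ m) * v + toℕ t * u ≤R.≡⟨ ℓ-def w (fromℕ m , t) ⟨
    ℓ w (fromℕ m , t)             ≤R.∎)
    where module ≤R = ≤-Reasoning

  shift : ∀ (s : Fin m) (t : Fin (suc n)) → ℓ w (suc s , t) + ℓ w prev ≡ ℓ w (inject₁ s , t) + ℓ w next
  shift s t = begin
    ℓ w (suc s , t) + ℓ w prev ≡⟨ cong₂ _+_ (ℓ-def w (suc s , t)) (ℓ-def w prev) ⟩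
    (v + toℕ s * v) + toℕ t * u + (toℕ (inject₁ i) * v + 0)
      ≡⟨ cong (λ x → (v + toℕ s * v) + toℕ t * u + (x * v + 0)) (Fin.toℕ-inject₁ i) ⟩
    (v + toℕ s * v) + toℕ t * u + (toℕ i * v + 0)
      ≡⟨ regroup (toℕ s * v) (toℕ t * u) (toℕ i * v) v ⟩
    toℕ s * v + toℕ t * u + (v + toℕ i * v + 0)
      ≡⟨ cong (λ x → x * v + toℕ t * u + (v + toℕ i * v + 0)) (Fin.toℕ-inject₁ s) ⟨
    toℕ (inject₁ s) * v + toℕ t * u + (v + toℕ i * v + 0)
      ≡⟨ cong₂ _+_ (ℓ-def w (inject₁ s , t)) (ℓ-def w next) ⟨
    ℓ w (inject₁ s , t) + ℓ w next ∎
    where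
    regroup : ∀ a t b v → (v + a) + t + (b + 0) ≡ a + t + (v + b + 0)
    regroup = solve-∀

  lower : sum² (λ s t → ⟦ ℓ w (suc s , t) ≼ ℓ w next ⟧) ≡ τℕ w prev
  lower = begin
    sum² (λ s t → ⟦ ℓ w (suc s , t) ≼ ℓ w next ⟧)
      ≡⟨ sum²-cong (λ s t → ⟦≼⟧-cong (λ h → ≤-from h (sym (shift s t))) (λ h → ≤-from h (shift s t))) ⟩
    sum² (λ s t → ⟦ ℓ w (inject₁ s , t) ≼ ℓ w prev ⟧)
      ≡⟨ sum²-last (λ s t → ⟦ ℓ w (s , t) ≼ ℓ w prev ⟧) last ⟨
    sum² (λ s t → ⟦ ℓ w (s , t) ≼ ℓ w prev ⟧)
      ≡⟨ τℕ-def w prev ⟨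
    τℕ w prev ∎

-- Counts at the row end and at the column end

rowEnd : ∀ m n → Fin (suc m) × Fin (suc n)
rowEnd m n = zero , fromℕ n

colEnd : ∀ m n → Fin (suc m) × Fin (suc n)
colEnd m n = fromℕ m , zero

ℓ-rowEnd : ∀ m n p q → ℓ (p , q) (rowEnd m n) ≡ n * p
ℓ-rowEnd m n p q = trans (ℓ-def (p , q) (rowEnd m n)) (cong (_* p) (Fin.toℕ-fromℕ n))

ℓ-colEnd : ∀ m n p q → ℓ (p , q) (colEnd m n) ≡ m * q
ℓ-colEnd m n p q = trans (ℓ-def (p , q) (colEnd m n))
  (trans (+-identityʳ _) (cong (_* q) (Fin.toℕ-fromℕ m)))

-- `ℓ` is linear in the indices, so a cell and its point reflection have a constant sum; the row end
-- and the column end are such a pair.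
ℓ-opposite : ∀ m n w (s : Fin (suc m)) (t : Fin (suc n)) →
  ℓ w (s , t) + ℓ w (opposite s , opposite t) ≡ ℓ w (rowEnd m n) + ℓ w (colEnd m n)
ℓ-opposite m n w@(u , v) s t = begin
  ℓ w (s , t) + ℓ w (opposite s , opposite t)
    ≡⟨ cong₂ _+_ (ℓ-def w (s , t)) (ℓ-def w (opposite s , opposite t)) ⟩
  (toℕ s * v + toℕ t * u) + (toℕ (opposite s) * v + toℕ (opposite t) * u)
    ≡⟨ regroup (toℕ s) (toℕ (opposite s)) (toℕ t) (toℕ (opposite t)) u v ⟩
  (toℕ t + toℕ (opposite t)) * u + (toℕ s + toℕ (opposite s)) * v
    ≡⟨ cong₂ (λ a b → a * u + b * v) (opposite-complement t) (opposite-complement s) ⟩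
  n * u + m * v
    ≡⟨ cong₂ _+_ (ℓ-rowEnd m n u v) (ℓ-colEnd m n u v) ⟨
  ℓ w (rowEnd m n) + ℓ w (colEnd m n) ∎
  where
  open ≡-Reasoning
  regroup : ∀ s s′ t t′ u v → (s * v + t * u) + (s′ * v + t′ * u) ≡ (t + t′) * u + (s + s′) * v
  regroup = solve-∀

-- The parameters are the labels of an interval, so the array has `m + 1` rows and `n + 1` columns.
rowT colT : (m n : ℕ) → Weight → ℕ
rowT m n w = τℕ w (rowEnd m n)
colT m n w = τℕ w (colEnd m n)

colT≡rowT : ∀ m n w → colT m n w ≡ rowT n m (swap w)
colT≡rowT m n w = τℕ-swap w (colEnd m n)

-- Point reflection turns the cells counted at the column end into those at or above the row end.
-- Every cell is then counted once in total, except the row end itself, which is counted twice.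
rowT+colT : ∀ m n w → Injective _≡_ _≡_ (ℓ {suc m} {suc n} w) →
            rowT m n w + colT m n w ≡ suc (suc m * suc n)
rowT+colT m n w inj = begin
  rowT m n w + colT m n w
    ≡⟨ cong₂ _+_ (τℕ-def w end) reflected ⟩
  sum² below + sum² above
    ≡⟨ sum²-+ below above ⟨
  sum² (λ s t → below s t + above s t)
    ≡⟨ sum²-cong-bump {f = λ _ _ → 1} zero (fromℕ n) off
         (cong₂ _+_ (⟦≼⟧-yes (≤-refl {ℓ w end})) (⟦≼⟧-yes (≤-refl {ℓ w end}))) ⟩
  sum² {suc m} {suc n} (λ _ _ → 1) + 1
    ≡⟨ cong (_+ 1) (sum²-one (suc m) (suc n)) ⟩
  suc m * suc n + 1
    ≡⟨ +-comm _ 1 ⟩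
  suc (suc m * suc n) ∎
  where
  open ≡-Reasoning
  end : Fin (suc m) × Fin (suc n)
  end = rowEnd m n
  below above : Fin (suc m) → Fin (suc n) → ℕ
  below s t = ⟦ ℓ w (s , t) ≼ ℓ w end ⟧
  above s t = ⟦ ℓ w end ≼ ℓ w (s , t) ⟧

  reflected : colT m n w ≡ sum² above
  reflected = begin
    colT m n w
      ≡⟨ τℕ-def w (colEnd m n) ⟩
    sum² (λ s t → ⟦ ℓ w (s , t) ≼ ℓ w (colEnd m n) ⟧)
      ≡⟨ sum²-opposite (λ s t → ⟦ ℓ w (s , t) ≼ ℓ w (colEnd m n) ⟧) ⟨
    sum² (λ s t → ⟦ ℓ w (opposite s , opposite t) ≼ ℓ w (colEnd m n) ⟧)
      ≡⟨ sum²-cong (λ s t → ⟦≼⟧-cong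
           (λ h → ≤-from h (sym (trans (+-comm _ (ℓ w (s , t))) (ℓ-opposite m n w s t))))
           (λ h → ≤-from h (trans (+-comm _ (ℓ w (s , t))) (ℓ-opposite m n w s t)))) ⟩
    sum² above ∎

  off : ∀ s t → (s , t) ≢ end → 1 ≡ below s t + above s t
  off s t ≢ with <-cmp (ℓ w (s , t)) (ℓ w end)
  ... | tri< lt _ _ = sym (cong₂ _+_ (⟦≼⟧-yes (<⇒≤ lt)) (⟦≼⟧-no lt))
  ... | tri≈ _ e _  = contradiction (inj e) ≢
  ... | tri> _ _ gt = sym (cong₂ _+_ (⟦≼⟧-no gt) (⟦≼⟧-yes (<⇒≤ gt)))

-- The hypothesis puts the first cell of the new last row, hence the whole row, above the row end,
-- and the row end has the same value in both arrays.
rowT-drop : ∀ m n p q → p * n < suc m * q → rowT (suc m) n (p , q) ≡ rowT m n (p , q)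
rowT-drop m n p q h = begin
  rowT (suc m) n (p , q)
    ≡⟨ τℕ-def _ _ ⟩
  sum² (λ s t → ⟦ ℓ (p , q) (s , t) ≼ ℓ (p , q) (rowEnd (suc m) n) ⟧)
    ≡⟨ sum²-last (λ s t → ⟦ ℓ (p , q) (s , t) ≼ ℓ (p , q) (rowEnd (suc m) n) ⟧) last ⟩
  sum² (λ s t → ⟦ ℓ (p , q) (inject₁ s , t) ≼ ℓ (p , q) (rowEnd (suc m) n) ⟧)
    ≡⟨ sum²-cong (λ s t → cong₂ ⟦_≼_⟧ (inner s t)
         (trans (ℓ-rowEnd (suc m) n p q) (sym (ℓ-rowEnd m n p q)))) ⟩
  sum² (λ s t → ⟦ ℓ (p , q) (s , t) ≼ ℓ (p , q) (rowEnd m n) ⟧)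
    ≡⟨ τℕ-def _ _ ⟨
  rowT m n (p , q) ∎
  where
  open ≡-Reasoning
  inner : (s : Fin (suc m)) (t : Fin (suc n)) → ℓ (p , q) (inject₁ s , t) ≡ ℓ (p , q) (s , t)
  inner s t = trans (ℓ-def (p , q) (inject₁ s , t))
    (trans (cong (λ x → x * q + toℕ t * p) (Fin.toℕ-inject₁ s)) (sym (ℓ-def (p , q) (s , t))))

  last : ∀ t → ⟦ ℓ (p , q) (fromℕ (suc m) , t) ≼ ℓ (p , q) (rowEnd (suc m) n) ⟧ ≡ 0
  last t = ⟦≼⟧-no (≤R.begin-strict
    ℓ (p , q) (rowEnd (suc m) n)   ≤R.≡⟨ ℓ-rowEnd (suc m) n p q ⟩
    n * p                          ≤R.≡⟨ *-comm n p ⟩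
    p * n                          ≤R.<⟨ h ⟩
    suc m * q                      ≤R.≡⟨ cong (_* q) (Fin.toℕ-fromℕ (suc m)) ⟨
    toℕ (fromℕ (suc m)) * q        ≤R.≤⟨ m≤m+n _ _ ⟩
    toℕ (fromℕ (suc m)) * q + toℕ t * p ≤R.≡⟨ ℓ-def (p , q) (fromℕ (suc m) , t) ⟨
    ℓ (p , q) (fromℕ (suc m) , t)  ≤R.∎)
    where module ≤R = ≤-Reasoning

-- No cell counted by rowT has its point reflection counted as well.
rowT-half : ∀ m n p q → p * n < m * q → rowT m n (p , q) + rowT m n (p , q) ≤ suc m * suc n
rowT-half m n p q h = begin
  rowT m n w + rowT m n w
    ≡⟨ cong₂ _+_ (τℕ-def w _) (trans (τℕ-def w _) (sym (sum²-opposite f))) ⟩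
  sum² f + sum² (λ s t → f (opposite s) (opposite t))
    ≡⟨ sum²-+ f (λ s t → f (opposite s) (opposite t)) ⟨
  sum² (λ s t → f s t + f (opposite s) (opposite t))
    ≤⟨ sum²-mono (λ s t → ⟦≼⟧-exclusive (λ a → ≰⇒> λ b → <⇒≱ h (clash s t (+-mono-≤ a b)))) ⟩
  sum² {suc m} {suc n} (λ _ _ → 1)
    ≡⟨ sum²-one (suc m) (suc n) ⟩
  suc m * suc n ∎
  where
  open ≤-Reasoning
  w = p , q
  f : Fin (suc m) → Fin (suc n) → ℕ
  f s t = ⟦ ℓ w (s , t) ≼ ℓ w (rowEnd m n) ⟧

  clash : ∀ s t → ℓ w (s , t) + ℓ w (opposite s , opposite t) ≤ ℓ w (rowEnd m n) + ℓ w (rowEnd m n) →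
          m * q ≤ p * n
  clash s t ab = subst₂ _≤_ (ℓ-colEnd m n p q) (trans (ℓ-rowEnd m n p q) (*-comm n p))
    (+-cancelˡ-≤ (ℓ w (rowEnd m n)) _ _ (subst (_≤ ℓ w (rowEnd m n) + ℓ w (rowEnd m n)) (ℓ-opposite m n w s t) ab))

-- Reflecting all rows but the first, of any two opposite cells at least one is
-- counted by rowT; a fraction i / j equal to p / q provides a pair with both counted.
rowT-majority : ∀ m n p q i j → 1 ≤ i → i ≤ m → j ≤ n → i * q ≡ p * j → suc m * q ≤ p * n →
                suc (suc m) * suc n < rowT m n (p , q) + rowT m n (p , q)
rowT-majority m n p q (suc i) j _ i<m j≤n iq≡pj h = begin-strict
  suc (suc m) * suc n
    <⟨ <-from key (regroup m n (sum² f)) ⟩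
  (suc n + sum² f) + (suc n + sum² f)
    ≡⟨ cong₂ _+_ split split ⟨
  rowT m n w + rowT m n w ∎
  where
  open ≤-Reasoning
  w = p , q
  f : Fin m → Fin (suc n) → ℕ
  f s t = ⟦ ℓ w (suc s , t) ≼ ℓ w (rowEnd m n) ⟧

  g : Fin m → Fin (suc n) → ℕ
  g s t = f s t + f (opposite s) (opposite t)

  regroup : ∀ m n x → suc (suc m) * suc n + (x + x) ≡ (m * suc n) + ((suc n + x) + (suc n + x))
  regroup = solve-∀

  firstRow : ∀ t → ℓ w (zero {m} , t) ≤ ℓ w (rowEnd m n)
  firstRow t = begin
    ℓ w (zero {m} , t) ≡⟨ ℓ-def w (zero {m} , t) ⟩
    toℕ t * p          ≤⟨ *-monoˡ-≤ p (s≤s⁻¹ (Fin.toℕ<n t)) ⟩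
    n * p              ≡⟨ ℓ-rowEnd m n p q ⟨
    ℓ w (rowEnd m n)   ∎

  split : rowT m n w ≡ suc n + sum² f
  split = begin-equality
    rowT m n w
      ≡⟨ τℕ-def w (rowEnd m n) ⟩
    sum² (λ s t → ⟦ ℓ w (s , t) ≼ ℓ w (rowEnd m n) ⟧)
      ≡⟨ sum²-suc (λ s t → ⟦ ℓ w (s , t) ≼ ℓ w (rowEnd m n) ⟧) ⟩
    sum (λ t → ⟦ ℓ w (zero {m} , t) ≼ ℓ w (rowEnd m n) ⟧) + sum² f
      ≡⟨ cong (_+ sum² f) (sum-cong-≗ (λ t → ⟦≼⟧-yes (firstRow t))) ⟩
    sum {suc n} (λ _ → 1) + sum² f
      ≡⟨ cong (_+ sum² f) (trans (sum-const (suc n) 1) (*-identityʳ (suc n))) ⟩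
    suc n + sum² f ∎

  -- Rows 1 to `m` are reflected among themselves, so opposite row indices add up to `m + 1`; this
  -- is where `suc m * q ≤ p * n` enters.
  total : ∀ s t → ℓ w (suc s , t) + ℓ w (suc (opposite s) , opposite t) ≤
                  ℓ w (rowEnd m n) + ℓ w (rowEnd m n)
  total s t = begin
    ℓ w (suc s , t) + ℓ w (suc (opposite s) , opposite t)
      ≡⟨ cong₂ _+_ (ℓ-def w (suc s , t)) (ℓ-def w (suc (opposite s) , opposite t)) ⟩
    (suc (toℕ s) * q + toℕ t * p) + (suc (toℕ (opposite s)) * q + toℕ (opposite t) * p)
      ≡⟨ pair (toℕ s) (toℕ (opposite s)) (toℕ t) (toℕ (opposite t)) p q ⟩
    suc (toℕ s + suc (toℕ (opposite s))) * q + (toℕ t + toℕ (opposite t)) * p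
      ≡⟨ cong₂ (λ a b → suc a * q + b * p) (toℕ+opposite s) (opposite-complement t) ⟩
    suc m * q + n * p
      ≤⟨ +-monoˡ-≤ (n * p) (subst (suc m * q ≤_) (*-comm p n) h) ⟩
    n * p + n * p
      ≡⟨ cong₂ _+_ (ℓ-rowEnd m n p q) (ℓ-rowEnd m n p q) ⟨
    ℓ w (rowEnd m n) + ℓ w (rowEnd m n) ∎
    where
    pair : ∀ s s′ t t′ p q →
           (suc s * q + t * p) + (suc s′ * q + t′ * p) ≡ suc (s + suc s′) * q + (t + t′) * p
    pair = solve-∀

  1≤g : ∀ s t → 1 ≤ g s t
  1≤g s t = ⟦≼⟧-covering λ end<a → ≮⇒≥ λ end<b → <⇒≱ (+-mono-< end<a end<b) (total s t)

  -- The cell in row `suc i` and column `n - j` is level with the row end, so by `total` its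
  -- reflection cannot lie above the row end.
  s₀ : Fin m
  s₀ = fromℕ< i<m
  t₀ : Fin (suc n)
  t₀ = opposite (fromℕ< (s≤s j≤n))

  t₀+j : toℕ t₀ + j ≡ n
  t₀+j = trans (+-comm (toℕ t₀) j)
    (trans (cong (_+ toℕ t₀) (sym (Fin.toℕ-fromℕ< (s≤s j≤n)))) (opposite-complement (fromℕ< (s≤s j≤n))))

  a₀ : ℓ w (suc s₀ , t₀) ≡ ℓ w (rowEnd m n)
  a₀ = begin-equality
    ℓ w (suc s₀ , t₀)             ≡⟨ ℓ-def w (suc s₀ , t₀) ⟩
    suc (toℕ s₀) * q + toℕ t₀ * p ≡⟨ cong (λ x → suc x * q + toℕ t₀ * p) (Fin.toℕ-fromℕ< i<m) ⟩
    suc i * q + toℕ t₀ * p        ≡⟨ cong (_+ toℕ t₀ * p) iq≡pj ⟩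
    p * j + toℕ t₀ * p            ≡⟨ factor p j (toℕ t₀) ⟩
    (toℕ t₀ + j) * p              ≡⟨ cong (_* p) t₀+j ⟩
    n * p                         ≡⟨ ℓ-rowEnd m n p q ⟨
    ℓ w (rowEnd m n)              ∎
    where
    factor : ∀ p j t → p * j + t * p ≡ (t + j) * p
    factor = solve-∀

  both : g s₀ t₀ ≡ 2
  both = cong₂ _+_ (⟦≼⟧-yes (≤-reflexive a₀))
    (⟦≼⟧-yes (+-cancelˡ-≤ (ℓ w (rowEnd m n)) _ _
      (subst (λ x → x + ℓ w (suc (opposite s₀) , opposite t₀) ≤ ℓ w (rowEnd m n) + ℓ w (rowEnd m n))
        a₀ (total s₀ t₀))))

  key : m * suc n < sum² f + sum² f
  key = begin-strict
    m * suc n                    ≡⟨ sum²-one m (suc n) ⟨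
    sum² {m} {suc n} (λ _ _ → 1) <⟨ subst (_≤ sum² g) (+-comm _ 1)
                                      (sum²-mono-bump 1≤g s₀ t₀ (≤-reflexive (sym both))) ⟩
    sum² g                       ≡⟨ sum²-+ f (λ s t → f (opposite s) (opposite t)) ⟩
    sum² f + sum² (λ s t → f (opposite s) (opposite t)) ≡⟨ cong (sum² f +_) (sum²-opposite f) ⟩
    sum² f + sum² f              ∎

-- Mediants of consecutive slopes

infixl 6 _⊕_

_⊕_ : Weight → Weight → Weight
(u , v) ⊕ (u′ , v′) = u + u′ , v + v′

⊕-comm : ∀ a b → a ⊕ b ≡ b ⊕ a
⊕-comm (u , v) (u′ , v′) = cong₂ _,_ (+-comm u u′) (+-comm v v′)

-- A comparison at the mediant is thus the sum of the comparisons at the two ends.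
ℓ-⊕ : ∀ a b (P : Fin m × Fin n) → ℓ (a ⊕ b) P ≡ ℓ a P + ℓ b P
ℓ-⊕ (u , v) (u′ , v′) (i , j) = trans (ℓ-def _ (i , j))
  (trans (regroup (toℕ i) (toℕ j) u v u′ v′) (sym (cong₂ _+_ (ℓ-def _ (i , j)) (ℓ-def _ (i , j)))))
  where
  regroup : ∀ i j u v u′ v′ → i * (v + v′) + j * (u + u′) ≡ (i * v + j * u) + (i * v′ + j * u′)
  regroup = solve-∀

-- The weights of the ends of an interval with no p / q, p ∈ [m], q ∈ [n], inside;
-- the ends 0 and ∞ have the weights (0 , 1) and (1 , 0).
record Consecutive (m n : ℕ) (a b : Weight) : Set where
  field
    a<b : proj₁ a * proj₂ b < proj₁ b * proj₂ a
    gap : ∀ x y → 1 ≤ x → x ≤ m → 1 ≤ y → y ≤ n →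
          proj₁ a * y < x * proj₂ a → ¬ (x * proj₂ b < proj₁ b * y)

-- Taking reciprocals reverses the order, so the ends change places.
Consecutive-swap : ∀ {a b} → Consecutive m n a b → Consecutive n m (swap b) (swap a)
Consecutive-swap {a = p , q} {p′ , q′} c = record
  { a<b = subst₂ _<_ (*-comm p q′) (*-comm p′ q) (Consecutive.a<b c)
  ; gap = λ x y 1≤x x≤n 1≤y y≤m h h′ →
      Consecutive.gap c y x 1≤y y≤m 1≤x x≤n (subst₂ _<_ (*-comm x p) (*-comm q y) h′)
        (subst₂ _<_ (*-comm q′ y) (*-comm x p′) h)
  }

m≤n⇒∃ : ∀ {m n} → m ≤ n → ∃[ d ] n ≡ m + d
m≤n⇒∃ {m} {n} m≤n = n ∸ m , sym (m+[n∸m]≡n m≤n)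

module _ {m n : ℕ} {a b : Weight} (c : Consecutive m n a b) where

  private
    p = proj₁ a
    q = proj₂ a
    p′ = proj₁ b
    q′ = proj₂ b

  consecutive⇒den>0 : 0 < q
  consecutive⇒den>0 = n≢0⇒n>0 λ q≡0 → n≮0 (subst (p * q′ <_) (trans (cong (p′ *_) q≡0) (*-zeroʳ p′)) (Consecutive.a<b c))

  consecutive⇒num>0 : 0 < p′
  consecutive⇒num>0 = n≢0⇒n>0 λ p′≡0 → n≮0 (subst (λ x → p * q′ < x * q) p′≡0 (Consecutive.a<b c))

  private
    -- If both coordinates change in the same direction, the cells are ordered alike at every slope.
    -- Otherwise let `x` and `y` be the absolute differences of the coordinates: a disagreement puts
    -- `x / y` strictly between the ends, against `gap`, or left of the first end and right of the
    -- second, against `a<b`.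
    crossed : ∀ s t s′ t′ → s ≤ m → t ≤ n → s′ ≤ m → t′ ≤ n →
              s * q + t * p < s′ * q + t′ * p → ¬ (s′ * q′ + t′ * p′ < s * q′ + t * p′)
    crossed s t s′ t′ s≤m t≤n s′≤m t′≤n h h′ with ≤-total s s′ | ≤-total t t′
    ... | inj₁ s≤s′ | inj₁ t≤t′ = <⇒≱ h′ (+-mono-≤ (*-monoˡ-≤ q′ s≤s′) (*-monoˡ-≤ p′ t≤t′))
    ... | inj₂ s′≤s | inj₂ t′≤t = <⇒≱ h (+-mono-≤ (*-monoˡ-≤ q s′≤s) (*-monoˡ-≤ p t′≤t))
    ... | inj₁ s≤s′ | inj₂ t′≤t with m≤n⇒∃ s≤s′ | m≤n⇒∃ t′≤t
    ...   | x , refl | y , refl =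
      Consecutive.gap c x y (n≢0⇒n>0 x≢0) (≤-trans (m≤n+m x s) s′≤m) (n≢0⇒n>0 y≢0) (≤-trans (m≤n+m y t′) t≤n) py<xq xq′<p′y
      where
      lem₁ : ∀ s x t y p q → p * y + ((s + x) * q + t * p) ≡ (s * q + (t + y) * p) + x * q
      lem₁ = solve-∀
      lem₂ : ∀ s x t y p q → x * q + (s * q + (t + y) * p) ≡ ((s + x) * q + t * p) + p * y
      lem₂ = solve-∀
      py<xq : p * y < x * q
      py<xq = <-from h (lem₁ s x t′ y p q)
      xq′<p′y : x * q′ < p′ * y
      xq′<p′y = <-from h′ (lem₂ s x t′ y p′ q′)
      x≢0 : x ≢ 0
      x≢0 refl = n≮0 py<xq
      y≢0 : y ≢ 0
      y≢0 refl = n≮0 (subst (x * q′ <_) (*-zeroʳ p′) xq′<p′y)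
    crossed s t s′ t′ s≤m t≤n s′≤m t′≤n h h′ | inj₂ s′≤s | inj₁ t≤t′ with m≤n⇒∃ s′≤s | m≤n⇒∃ t≤t′
    ...   | x , refl | y , refl = <⇒≱ (Consecutive.a<b c) (*-cancelʳ-≤ (p′ * q) (p * q′) y ⦃ >-nonZero (n≢0⇒n>0 y≢0) ⦄ (begin
        p′ * q * y   ≡⟨ lem₃ p′ q y ⟩
        p′ * y * q   ≤⟨ *-monoˡ-≤ q (<⇒≤ p′y<xq′) ⟩
        x * q′ * q   ≡⟨ lem₃ x q′ q ⟩
        x * q * q′   ≤⟨ *-monoˡ-≤ q′ (<⇒≤ xq<py) ⟩
        p * y * q′   ≡⟨ lem₃ p y q′ ⟩
        p * q′ * y   ∎))
      where
      open ≤-Reasoning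
      lem₁ : ∀ s x t y p q → x * q + (s * q + (t + y) * p) ≡ ((s + x) * q + t * p) + p * y
      lem₁ = solve-∀
      lem₂ : ∀ s x t y p q → p * y + ((s + x) * q + t * p) ≡ (s * q + (t + y) * p) + x * q
      lem₂ = solve-∀
      lem₃ : ∀ a b c → a * b * c ≡ a * c * b
      lem₃ = solve-∀
      xq<py : x * q < p * y
      xq<py = <-from h (lem₁ s′ x t y p q)
      p′y<xq′ : p′ * y < x * q′
      p′y<xq′ = <-from h′ (lem₂ s′ x t y p′ q′)
      y≢0 : y ≢ 0
      y≢0 refl = n≮0 (subst (x * q <_) (*-zeroʳ p) xq<py)

  -- The two ends order the cells of the array compatibly: a disagreement about two
  -- cells would put the slope of their difference strictly between a and b.
  ends-comonotone : {P Q : Fin (suc m) × Fin (suc n)} → ℓ a P < ℓ a Q → ℓ b P ≤ ℓ b Q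
  ends-comonotone {P@(s , t)} {Q@(s′ , t′)} h = ≮⇒≥ λ h′ →
    crossed (toℕ s) (toℕ t) (toℕ s′) (toℕ t′)
      (s≤s⁻¹ (Fin.toℕ<n s)) (s≤s⁻¹ (Fin.toℕ<n t)) (s≤s⁻¹ (Fin.toℕ<n s′)) (s≤s⁻¹ (Fin.toℕ<n t′))
      (subst₂ _<_ (ℓ-def a P) (ℓ-def a Q) h) (subst₂ _<_ (ℓ-def b Q) (ℓ-def b P) h′)

  private
    mid = a ⊕ b

  mid-< : {P Q : Fin (suc m) × Fin (suc n)} → ℓ a P < ℓ a Q → ℓ mid P < ℓ mid Q
  mid-< {P} {Q} h = subst₂ _<_ (sym (ℓ-⊕ a b P)) (sym (ℓ-⊕ a b Q)) (+-mono-<-≤ h (ends-comonotone h))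

  mid-<⇒ends-≤ : {P Q : Fin (suc m) × Fin (suc n)} → ℓ mid P < ℓ mid Q →
                 ℓ a P ≤ ℓ a Q × ℓ b P ≤ ℓ b Q
  mid-<⇒ends-≤ {P} {Q} h with <-cmp (ℓ a P) (ℓ a Q)
  ... | tri< lt _ _ = <⇒≤ lt , ends-comonotone lt
  ... | tri> _ _ gt = contradiction (mid-< gt) (<-asym h)
  ... | tri≈ _ e _  = ≤-reflexive e , <⇒≤ (+-cancelˡ-< (ℓ a P) _ _
    (subst₂ _<_ (ℓ-⊕ a b P) (trans (ℓ-⊕ a b Q) (cong (_+ ℓ b Q) (sym e))) h))

  -- A tie at the mediant is a tie at `a` by `mid-<`, hence also at `b`. These two linear equations
  -- have the positive determinant `p′ * q - p * q′`, so the cells agree.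
  ℓ-mid-injective : Injective _≡_ _≡_ (ℓ {suc m} {suc n} mid)
  ℓ-mid-injective {P@(s , t)} {Q@(s′ , t′)} e = cong₂ _,_
    (Fin.toℕ-injective s≡s′) (Fin.toℕ-injective t≡t′)
    where
    ea : ℓ a P ≡ ℓ a Q
    ea = ≤-antisym (≮⇒≥ λ gt → <-irrefl (sym e) (mid-< gt)) (≮⇒≥ λ lt → <-irrefl e (mid-< lt))
    eb : ℓ b P ≡ ℓ b Q
    eb = +-cancelˡ-≡ (ℓ a P) _ _
      (trans (sym (ℓ-⊕ a b P)) (trans e (trans (ℓ-⊕ a b Q) (cong (_+ ℓ b Q) (sym ea)))))
    cramer : ∀ s t s′ t′ p q p′ q′ d → p′ * q ≡ p * q′ + suc d →
             s * q + t * p ≡ s′ * q + t′ * p → s * q′ + t * p′ ≡ s′ * q′ + t′ * p′ →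
             s ≡ s′ × t ≡ t′
    cramer s t s′ t′ p q p′ q′ d det e₁ e₂ =
      cancel s s′ (trans (sym (inner s t p q′ p′)) (trans (cong (_* p) e₂) (inner s′ t′ p q′ p′)))
        (trans (sym (outer s t)) (trans (cong (_* p′) e₁) (outer s′ t′))) ,
      cancel t t′ (trans (sym (inner′ s t p q q′)) (trans (cong (_* q′) e₁) (inner′ s′ t′ p q q′)))
        (trans (sym (outer′ s t)) (trans (cong (_* q) e₂) (outer′ s′ t′)))
      where
      cancel : ∀ s s′ {x x′} → x ≡ x′ → x + s * suc d ≡ x′ + s′ * suc d → s ≡ s′
      cancel s s′ {x} refl e = *-cancelʳ-≡ s s′ (suc d) (+-cancelˡ-≡ x _ _ e)
      inner : ∀ s t p q′ p′ → (s * q′ + t * p′) * p ≡ s * (p * q′) + t * (p * p′)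
      inner = solve-∀
      inner′ : ∀ s t p q q′ → (s * q + t * p) * q′ ≡ s * (q * q′) + t * (p * q′)
      inner′ = solve-∀
      expand : ∀ s t p q p′ → (s * q + t * p) * p′ ≡ s * (p′ * q) + t * (p * p′)
      expand = solve-∀
      expand′ : ∀ s t q p′ q′ → (s * q′ + t * p′) * q ≡ s * (q * q′) + t * (p′ * q)
      expand′ = solve-∀
      collect : ∀ s x y d → s * (x + d) + y ≡ s * x + y + s * d
      collect = solve-∀
      collect′ : ∀ t x y d → y + t * (x + d) ≡ y + t * x + t * d
      collect′ = solve-∀
      outer : ∀ s t → (s * q + t * p) * p′ ≡ s * (p * q′) + t * (p * p′) + s * suc d
      outer s t = trans (expand s t p q p′) (trans (cong (λ x → s * x + t * (p * p′)) det)
        (collect s (p * q′) (t * (p * p′)) (suc d)))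
      outer′ : ∀ s t → (s * q′ + t * p′) * q ≡ s * (q * q′) + t * (p * q′) + t * suc d
      outer′ s t = trans (expand′ s t q p′ q′) (trans (cong (λ x → s * (q * q′) + t * x) det)
        (collect′ t (p * q′) (s * (q * q′)) (suc d)))
    sol : toℕ s ≡ toℕ s′ × toℕ t ≡ toℕ t′
    sol with m≤n⇒∃ (Consecutive.a<b c)
    ... | d , det = cramer (toℕ s) (toℕ t) (toℕ s′) (toℕ t′) p q p′ q′ d
      (trans det (sym (+-suc (p * q′) d)))
      (subst₂ _≡_ (ℓ-def a P) (ℓ-def a Q) ea) (subst₂ _≡_ (ℓ-def b P) (ℓ-def b Q) eb)
    s≡s′ = proj₁ sol
    t≡t′ = proj₂ sol

  -- Passing from `a` to the mediant can only break ties. A cell level with the row end at `a` has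
  -- slope `a` relative to it, and as `b` is larger, the cell is no higher than the row end at the
  -- mediant.
  rowT-mid : rowT m n mid ≡ rowT m n a
  rowT-mid = trans (τℕ-def mid R) (trans
    (sum²-cong λ s t → ⟦≼⟧-cong (to s t) (from s t)) (sym (τℕ-def a R)))
    where
    R = rowEnd m n
    to : ∀ s t → ℓ mid (s , t) ≤ ℓ mid R → ℓ a (s , t) ≤ ℓ a R
    to s t h = ≮⇒≥ λ gt → <⇒≱ (mid-< gt) h

    from : ∀ s t → ℓ a (s , t) ≤ ℓ a R → ℓ mid (s , t) ≤ ℓ mid R
    from s t h = ≮⇒≥ λ gt → tie (≤-antisym h (proj₁ (mid-<⇒ends-≤ gt))) gt
      where
      open ≤-Reasoning
      y = toℕ (opposite t)
      lem₁ : ∀ t y x p → x + (t + y) * p ≡ (x + t * p) + y * p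
      lem₁ = solve-∀
      tie : ℓ a (s , t) ≡ ℓ a R → ¬ (ℓ mid R < ℓ mid (s , t))
      tie e gt = <⇒≱ (Consecutive.a<b c) (*-cancelʳ-≤ (p′ * q) (p * q′) y ⦃ >-nonZero y>0 ⦄ (begin
          p′ * q * y           ≡⟨ lem₃ p′ q y ⟩
          y * p′ * q           ≤⟨ *-monoˡ-≤ q (<⇒≤ yp′<sq′) ⟩
          toℕ s * q′ * q       ≡⟨ lem₄ (toℕ s) q′ q ⟩
          toℕ s * q * q′       ≡⟨ cong (_* q′) sq≡yp ⟩
          y * p * q′           ≡⟨ lem₃ p q′ y ⟨
          p * q′ * y           ∎))
        where
        lem₃ : ∀ a b c → a * b * c ≡ c * a * b
        lem₃ = solve-∀
        lem₄ : ∀ a b c → a * b * c ≡ a * c * b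
        lem₄ = solve-∀
        n≡ : n ≡ toℕ t + y
        n≡ = sym (opposite-complement t)
        sq≡yp : toℕ s * q ≡ y * p
        sq≡yp = ≡-from (subst₂ _≡_ (ℓ-def a (s , t))
          (trans (ℓ-rowEnd m n p q) (cong (_* p) n≡)) e) (lem₁ (toℕ t) y (toℕ s * q) p)
        gt-b : ℓ b R < ℓ b (s , t)
        gt-b = +-cancelˡ-< (ℓ a R) _ _ (subst₂ _<_ (ℓ-⊕ a b R)
          (trans (ℓ-⊕ a b (s , t)) (cong (_+ ℓ b (s , t)) e)) gt)
        lem₂ : ∀ t y x p → y * p + (x + t * p) ≡ (t + y) * p + x
        lem₂ = solve-∀
        yp′<sq′ : y * p′ < toℕ s * q′
        yp′<sq′ = <-from (subst₂ _<_ (trans (ℓ-rowEnd m n p′ q′) (cong (_* p′) n≡))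
          (ℓ-def b (s , t)) gt-b) (lem₂ (toℕ t) y (toℕ s * q′) p′)
        y>0 : 0 < y
        -- In the last column the tie forces row 0, and then `yp′<sq′` fails.
        y>0 = n≢0⇒n>0 λ y≡0 → <⇒≢ (≤-<-trans z≤n yp′<sq′) (sym (m*n≡0⇒m*q′≡0 y≡0))
          where
          m*n≡0⇒m*q′≡0 : y ≡ 0 → toℕ s * q′ ≡ 0
          m*n≡0⇒m*q′≡0 y≡0 with m*n≡0⇒m≡0∨n≡0 (toℕ s) (trans sq≡yp (cong (_* p) y≡0))
          ... | inj₁ s≡0 = cong (_* q′) s≡0
          ... | inj₂ q≡0 = contradiction q≡0 (m<n⇒n≢0 consecutive⇒den>0)

rowT-mid-swap : ∀ m n a b → rowT n m (swap b ⊕ swap a) ≡ colT m n (a ⊕ b)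
rowT-mid-swap m n a b = trans (cong (rowT n m) (⊕-comm (swap b) (swap a)))
  (sym (colT≡rowT m n (a ⊕ b)))

colT-mid-swap : ∀ m n a b → colT n m (swap b ⊕ swap a) ≡ rowT m n (a ⊕ b)
colT-mid-swap m n a b = trans (colT≡rowT n m (swap b ⊕ swap a)) (cong (rowT m n) (⊕-comm b a))

-- Order of slopes and the effect of enlarging the array

infix 4 _≺_ _≋_

_≺_ _≋_ : Weight → Weight → Set
(p , q) ≺ (p′ , q′) = p * q′ < p′ * q
(p , q) ≋ (p′ , q′) = p * q′ ≡ p′ * q

≺-respʳ-≋ : ∀ {x y z} → y ≋ z → 0 < proj₂ z → x ≺ y → x ≺ z
≺-respʳ-≋ {p , q} {i , j} {i′ , j′} y≋z 0<j′ x≺y = *-cancelʳ-< j _ _ (begin-strict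
  p * j′ * j   ≡⟨ flipʳ p j′ j ⟩
  p * j * j′   <⟨ *-monoˡ-< j′ ⦃ >-nonZero 0<j′ ⦄ x≺y ⟩
  i * q * j′   ≡⟨ flipʳ i q j′ ⟩
  i * j′ * q   ≡⟨ cong (_* q) y≋z ⟩
  i′ * j * q   ≡⟨ flipʳ i′ j q ⟩
  i′ * q * j   ∎)
  where
  open ≤-Reasoning
  flipʳ : ∀ a b c → a * b * c ≡ a * c * b
  flipʳ = solve-∀

≺-respˡ-≋ : ∀ {x y z} → y ≋ z → 0 < proj₂ z → y ≺ x → z ≺ x
≺-respˡ-≋ {p , q} {i , j} {i′ , j′} y≋z 0<j′ y≺x = *-cancelʳ-< j _ _ (begin-strict
  i′ * q * j   ≡⟨ flipʳ i′ q j ⟩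
  i′ * j * q   ≡⟨ cong (_* q) y≋z ⟨
  i * j′ * q   ≡⟨ flipʳ i j′ q ⟩
  i * q * j′   <⟨ *-monoˡ-< j′ ⦃ >-nonZero 0<j′ ⦄ y≺x ⟩
  p * j * j′   ≡⟨ flipʳ p j j′ ⟩
  p * j′ * j   ∎)
  where
  open ≤-Reasoning
  flipʳ : ∀ a b c → a * b * c ≡ a * c * b
  flipʳ = solve-∀

-- A slope i / j with i ∈ [m], j ∈ [n] adds the cell (i , n - j) to the count.
rowT-mono-< : ∀ {a c} i j → i ≤ m → 1 ≤ j → j ≤ n → c ≋ (i , j) → 0 < proj₂ c → a ≺ c →
              rowT m n a < rowT m n c
rowT-mono-< {m} {n} {a@(p , q)} {c@(p₂ , q₂)} i j i≤m 1≤j j≤n c≋ q₂>0 a≺c =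
  subst₂ _<_ (sym (τℕ-def a R)) (sym (τℕ-def c R))
    (subst (_≤ sum² {suc m} {suc n} (λ s t → ⟦ ℓ c (s , t) ≼ ℓ c R ⟧)) (+-comm _ 1)
      (sum²-mono-bump (λ s t → ⟦≼⟧-mono (sub s t)) s₀ t₀
        (≤-reflexive (cong₂ _+_ (⟦≼⟧-no out) (sym (⟦≼⟧-yes inn))))))
  where
  open ≤-Reasoning
  R = rowEnd m n
  q>0 : 0 < q
  q>0 = n≢0⇒n>0 λ { refl → n≮0 (subst (p * q₂ <_) (*-zeroʳ p₂) a≺c) }

  -- A cell with `y` columns to its right is counted exactly if `s * v ≤ y * u`, that is, if `s / y`
  -- is at most the slope.
  slope : ∀ w (s : Fin (suc m)) (t : Fin (suc n)) →
          ℓ w (s , t) + toℕ (opposite t) * proj₁ w ≡ toℕ s * proj₂ w + ℓ w R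
  slope w@(u , v) s t = begin-equality
    ℓ w (s , t) + toℕ (opposite t) * u                 ≡⟨ cong (_+ toℕ (opposite t) * u) (ℓ-def w (s , t)) ⟩
    toℕ s * v + toℕ t * u + toℕ (opposite t) * u       ≡⟨ regroup (toℕ s * v) (toℕ t) (toℕ (opposite t)) u ⟩
    toℕ s * v + (toℕ t + toℕ (opposite t)) * u         ≡⟨ cong (λ x → toℕ s * v + x * u) (opposite-complement t) ⟩
    toℕ s * v + n * u                                  ≡⟨ cong (toℕ s * v +_) (ℓ-rowEnd m n u v) ⟨
    toℕ s * v + ℓ w R                                  ∎
    where
    regroup : ∀ x t y u → x + t * u + y * u ≡ x + (t + y) * u
    regroup = solve-∀

  sub : ∀ s t → ℓ a (s , t) ≤ ℓ a R → ℓ c (s , t) ≤ ℓ c R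
  sub s t h = ≤-from s*q₂≤y*p₂ (slope c s t)
    where
    y = toℕ (opposite t)
    s*q≤y*p : toℕ s * q ≤ y * p
    s*q≤y*p = ≤-from h (sym (slope a s t))
    lem : ∀ a b c → a * b * c ≡ a * c * b
    lem = solve-∀
    s*q₂≤y*p₂ : toℕ s * q₂ ≤ y * p₂
    s*q₂≤y*p₂ = *-cancelʳ-≤ _ _ q ⦃ >-nonZero q>0 ⦄ (begin
      toℕ s * q₂ * q   ≡⟨ lem (toℕ s) q₂ q ⟩
      toℕ s * q * q₂   ≤⟨ *-monoˡ-≤ q₂ s*q≤y*p ⟩
      y * p * q₂       ≡⟨ *-assoc y p q₂ ⟩
      y * (p * q₂)     ≤⟨ *-monoʳ-≤ y (<⇒≤ a≺c) ⟩
      y * (p₂ * q)     ≡⟨ *-assoc y p₂ q ⟨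
      y * p₂ * q       ∎)

  s₀ : Fin (suc m)
  s₀ = fromℕ< (s≤s i≤m)
  t₁ t₀ : Fin (suc n)
  t₁ = fromℕ< (s≤s j≤n)
  t₀ = opposite t₁

  s₀≡ : toℕ s₀ ≡ i
  s₀≡ = Fin.toℕ-fromℕ< (s≤s i≤m)
  t₀≡ : toℕ (opposite t₀) ≡ j
  t₀≡ = trans (cong toℕ (Fin.opposite-involutive t₁)) (Fin.toℕ-fromℕ< (s≤s j≤n))

  inn : ℓ c (s₀ , t₀) ≤ ℓ c R
  inn = ≤-from {toℕ s₀ * q₂} {toℕ (opposite t₀) * p₂}
    (≤-reflexive (trans (cong (_* q₂) s₀≡)
      (trans (sym c≋) (trans (*-comm p₂ j) (cong (_* p₂) (sym t₀≡))))))
    (slope c s₀ t₀)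

  out : ℓ a R < ℓ a (s₀ , t₀)
  out = <-from {toℕ (opposite t₀) * p} {toℕ s₀ * q}
    (subst₂ _<_ (trans (*-comm p j) (cong (_* p) (sym t₀≡))) (cong (_* q) (sym s₀≡))
      (≺-respʳ-≋ {a} {c} {i , j} c≋ 1≤j a≺c))
    (trans (+-comm (ℓ a R) _) (trans (sym (slope a s₀ t₀)) (+-comm (ℓ a (s₀ , t₀)) _)))

rowT+colT-mid : ∀ {a b} → Consecutive m n a b →
                rowT m n (a ⊕ b) + colT m n (a ⊕ b) ≡ suc (suc m * suc n)
rowT+colT-mid {m} {n} {a} {b} c = rowT+colT m n (a ⊕ b) (ℓ-mid-injective c)

-- At the common left end the new row contributes nothing, so `T` stays. As `S + T` exceeds the
-- number of cells by one, `S` absorbs the `n + 1` new cells, and `T < S` because `T` is at most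
-- half of the number of cells.
left-step : ∀ {a b c} → Consecutive (suc m) n a b → Consecutive m n a c → a ≺ (suc m , n) →
  rowT (suc m) n (a ⊕ b) ≡ rowT m n (a ⊕ c) ×
  colT (suc m) n (a ⊕ b) ≡ colT m n (a ⊕ c) + suc n ×
  rowT (suc m) n (a ⊕ b) < colT (suc m) n (a ⊕ b)
left-step {m} {n} {a@(p , q)} {b} {c} C C′ h = T≡T′ , S≡ , T<S
  where
  T = rowT (suc m) n (a ⊕ b)
  S = colT (suc m) n (a ⊕ b)
  T′ = rowT m n (a ⊕ c)
  S′ = colT m n (a ⊕ c)
  T≡T′ : T ≡ T′
  T≡T′ = trans (rowT-mid C) (trans (rowT-drop m n p q h) (sym (rowT-mid C′)))
  S≡ : S ≡ S′ + suc n
  S≡ = +-cancelˡ-≡ T _ _ (trans (rowT+colT-mid C) (trans (cong suc (+-comm (suc n) _))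
    (trans (cong (_+ suc n) (sym (rowT+colT-mid C′))) (trans (+-assoc T′ S′ (suc n))
    (cong (_+ (S′ + suc n)) (sym T≡T′))))))
  T<S : T < S
  T<S = +-cancelˡ-< T _ _ (subst (T + T <_) (sym (rowT+colT-mid C))
    (s≤s (subst (λ x → x + x ≤ suc (suc m) * suc n) (sym (rowT-mid C)) (rowT-half (suc m) n p q h))))

right-step : ∀ {a b c} → Consecutive m (suc n) a b → Consecutive m n c b → (m , suc n) ≺ b →
  colT m (suc n) (a ⊕ b) ≡ colT m n (c ⊕ b) ×
  rowT m (suc n) (a ⊕ b) ≡ rowT m n (c ⊕ b) + suc m ×
  colT m (suc n) (a ⊕ b) < rowT m (suc n) (a ⊕ b)
right-step {m} {n} {a} {b@(p , q)} {c} C C′ h =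
  let S≡ , T≡ , S<T = left-step (Consecutive-swap C) (Consecutive-swap C′)
                        (subst₂ _<_ (*-comm m q) (*-comm p (suc n)) h)
  in trans (sym (rowT-mid-swap m (suc n) a b)) (trans S≡ (rowT-mid-swap m n c b)) ,
     trans (sym (colT-mid-swap m (suc n) a b)) (trans T≡ (cong (_+ suc m) (colT-mid-swap m n c b))) ,
     subst₂ _<_ (rowT-mid-swap m (suc n) a b) (colT-mid-swap m (suc n) a b) S<T

-- Converse to left-step: if adding a row makes the column end the larger one, then
-- the new slope (m + 1) / n lies to the right of a.
left-of-new-slope : ∀ {a c} i j → Consecutive m n a c → 1 ≤ i → i ≤ m → j ≤ n → a ≋ (i , j) →
  rowT m n (a ⊕ c) < colT m n (a ⊕ c) + suc n → a ≺ (suc m , n)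
left-of-new-slope {m} {n} {a@(p , q)} {c} i j C 1≤i i≤m j≤n a≋ h = ≰⇒> λ h′ →
  <⇒≱ h (+-cancelˡ-≤ T (S + suc n) T (begin
    T + (S + suc n)              ≡⟨ +-assoc T S (suc n) ⟨
    T + S + suc n                ≡⟨ cong (_+ suc n) (rowT+colT-mid C) ⟩
    suc (suc m * suc n + suc n)  ≡⟨ cong suc (+-comm _ (suc n)) ⟩
    suc (suc (suc m) * suc n)    ≤⟨ rowT-majority m n p q i j 1≤i i≤m j≤n (sym a≋) h′ ⟩
    rowT m n a + rowT m n a      ≡⟨ cong₂ _+_ (rowT-mid C) (rowT-mid C) ⟨
    T + T                        ∎))
  where
  open ≤-Reasoning
  T = rowT m n (a ⊕ c)
  S = colT m n (a ⊕ c)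

right-of-new-slope : ∀ {c b} i j → Consecutive m n c b → i ≤ m → 1 ≤ j → j ≤ n → b ≋ (i , j) →
  colT m n (c ⊕ b) < rowT m n (c ⊕ b) + suc m → (m , suc n) ≺ b
right-of-new-slope {m} {n} {c} {b@(p , q)} i j C i≤m 1≤j j≤n b≋ h =
  subst₂ _<_ (*-comm q m) (*-comm (suc n) p)
    (left-of-new-slope j i (Consecutive-swap C) 1≤j j≤n i≤m
      (trans (*-comm q i) (trans (sym b≋) (*-comm p j)))
      (subst₂ _<_ (sym (rowT-mid-swap m n c b)) (cong (_+ suc m) (sym (colT-mid-swap m n c b))) h))

-- Extended rationals as weights

-- Numerator and denominator, with ∞ = 1 / 0.
opaque

  ⟨_⟩ : ℚ ⁺ → Weight
  ⟨ [ x ] ⟩ = ℤ.∣ ℚ.↥ x ∣ , ℚ.↧ₙ x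
  ⟨ ∞ ⟩     = 1 , 0

  ⟨0⟩ : ⟨ [ 0ℚ ] ⟩ ≡ (0 , 1)
  ⟨0⟩ = refl

  ⟨∞⟩ : ⟨ ∞ ⟩ ≡ (1 , 0)
  ⟨∞⟩ = refl

  den>0 : ∀ x → 0 < proj₂ ⟨ [ x ] ⟩
  den>0 x = s≤s z≤n

0≺ : ∀ m n → ⟨ [ 0ℚ ] ⟩ ≺ (suc m , n)
0≺ m n = subst (_≺ (suc m , n)) (sym ⟨0⟩) (s≤s z≤n)

≺∞ : ∀ m n → (m , suc n) ≺ ⟨ ∞ ⟩
≺∞ m n = subst ((m , suc n) ≺_) (sym ⟨∞⟩) (subst (_< 1 * suc n) (sym (*-zeroʳ m)) (s≤s z≤n))

-- `⟨_⟩` drops the sign of the numerator, so the order is read off from weights only for these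
-- elements.
data NonNeg : Pred (ℚ ⁺) 0ℓ where
  [_] : ∀ {x} → ℚ.NonNegative x → NonNeg [ x ]
  ∞   : NonNeg ∞

opaque
  unfolding ⟨_⟩

  <⁺⇒≺ : ∀ {a b} → NonNeg a → NonNeg b → a <⁺ b → ⟨ a ⟩ ≺ ⟨ b ⟩
  <⁺⇒≺ {[ mkℚ (ℤ.+ i) d _ ]} {[ mkℚ (ℤ.+ j) e _ ]} _ _ [ ℚ.*<* lt ] =
    ℤ.drop‿+<+ (subst₂ ℤ._<_ (sym (ℤ.pos-* i (suc e))) (sym (ℤ.pos-* j (suc d))) lt)
  <⁺⇒≺ {[ mkℚ (ℤ.-[1+ _ ]) _ _ ]} [ record { nonNeg = () } ]
  <⁺⇒≺ {_} {[ mkℚ (ℤ.-[1+ _ ]) _ _ ]} _ [ record { nonNeg = () } ]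
  <⁺⇒≺ _ _ [ x ]<⊤⁺ = subst₂ _<_ (sym (*-zeroʳ ℤ.∣ ℚ.↥ x ∣)) (sym (+-identityʳ (ℚ.↧ₙ x))) (s≤s z≤n)

  ≺⇒<⁺ : ∀ {a b} → NonNeg a → NonNeg b → ⟨ a ⟩ ≺ ⟨ b ⟩ → a <⁺ b
  ≺⇒<⁺ {[ mkℚ (ℤ.+ i) d _ ]} {[ mkℚ (ℤ.+ j) e _ ]} _ _ lt =
    [ ℚ.*<* (subst₂ ℤ._<_ (ℤ.pos-* i (suc e)) (ℤ.pos-* j (suc d)) (ℤ.+<+ lt)) ]
  ≺⇒<⁺ {[ mkℚ (ℤ.-[1+ _ ]) _ _ ]} [ record { nonNeg = () } ]
  ≺⇒<⁺ {_} {[ mkℚ (ℤ.-[1+ _ ]) _ _ ]} _ [ record { nonNeg = () } ]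
  ≺⇒<⁺ {[ x ]} {∞} _ _ _ = [ x ]<⊤⁺
  ≺⇒<⁺ {∞} {[ y ]} _ _ lt = contradiction (subst (ℚ.↧ₙ y + 0 <_) (*-zeroʳ ℤ.∣ ℚ.↥ y ∣) lt) n≮0
  ≺⇒<⁺ {∞} {∞} _ _ lt = contradiction lt n≮0

  ≃⇒≋ : ∀ x i j → ℚ.toℚᵘ x ℚᵘ.≃ ℚᵘ.mkℚᵘ (ℤ.+ i) j → ⟨ [ x ] ⟩ ≋ (i , suc j)
  ≃⇒≋ x@(mkℚ _ _ _) i j (ℚᵘ.*≡* e) = trans (sym (ℤ.abs-* (ℚ.↥ x) (ℤ.+ suc j)))
    (trans (cong ℤ.∣_∣ e) (ℤ.abs-* (ℤ.+ i) (ℚ.↧ x)))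

/-≋ : ∀ i j → ⟨ [ ℤ.+ i ℚ./ suc j ] ⟩ ≋ (i , suc j)
/-≋ i j = ≃⇒≋ (ℤ.+ i ℚ./ suc j) i j (ℚ.toℚᵘ-fromℚᵘ (ℚᵘ.mkℚᵘ (ℤ.+ i) j))

-- Rationals are kept in lowest terms, so the weight of a fraction is only proportional to the pair
-- it is written with.
frac-≋ : ∀ i j → ⟨ frac i j ⟩ ≋ (suc i , suc j)
frac-≋ i j = /-≋ (suc i) j

frac-nonNeg : ∀ i j → NonNeg (frac i j)
frac-nonNeg i j = [ ℚ.normalize-nonNeg (suc i) (suc j) ]

module _ (a : ℚ ⁺) (i j : ℕ) where

  private
    j′>0 : 0 < proj₂ ⟨ frac i j ⟩
    j′>0 = den>0 _

  <⁺frac⇒ : NonNeg a → a <⁺ frac i j → ⟨ a ⟩ ≺ (suc i , suc j)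
  <⁺frac⇒ 0≤a lt = ≺-respʳ-≋ {⟨ a ⟩} {⟨ frac i j ⟩} {suc i , suc j} (frac-≋ i j) (s≤s z≤n)
    (<⁺⇒≺ 0≤a (frac-nonNeg i j) lt)

  <⁺frac⇐ : NonNeg a → ⟨ a ⟩ ≺ (suc i , suc j) → a <⁺ frac i j
  <⁺frac⇐ 0≤a lt = ≺⇒<⁺ 0≤a (frac-nonNeg i j)
    (≺-respʳ-≋ {⟨ a ⟩} {suc i , suc j} {⟨ frac i j ⟩} (sym (frac-≋ i j)) j′>0 lt)

  frac<⁺⇒ : NonNeg a → frac i j <⁺ a → (suc i , suc j) ≺ ⟨ a ⟩
  frac<⁺⇒ 0≤a lt = ≺-respˡ-≋ {⟨ a ⟩} {⟨ frac i j ⟩} {suc i , suc j} (frac-≋ i j) (s≤s z≤n)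
    (<⁺⇒≺ (frac-nonNeg i j) 0≤a lt)

  frac<⁺⇐ : NonNeg a → (suc i , suc j) ≺ ⟨ a ⟩ → frac i j <⁺ a
  frac<⁺⇐ 0≤a lt = ≺⇒<⁺ (frac-nonNeg i j) 0≤a
    (≺-respˡ-≋ {⟨ a ⟩} {suc i , suc j} {⟨ frac i j ⟩} (sym (frac-≋ i j)) j′>0 lt)

G-nonNeg : ∀ {x} → x ∈ G m n → NonNeg x
G-nonNeg (inj₁ refl) = [ _ ]
G-nonNeg (inj₂ (inj₁ refl)) = ∞
G-nonNeg (inj₂ (inj₂ (i , j , refl))) = frac-nonNeg (toℕ i) (toℕ j)

frac∈G : ∀ i j → i < m → j < n → frac i j ∈ G m n
frac∈G i j i<m j<n = inj₂ (inj₂ (fromℕ< i<m , fromℕ< j<n ,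
  sym (cong₂ frac (Fin.toℕ-fromℕ< i<m) (Fin.toℕ-fromℕ< j<n))))

G-mono : ∀ {m m′ n n′ x} → m ≤ m′ → n ≤ n′ → x ∈ G m n → x ∈ G m′ n′
G-mono _ _ (inj₁ refl) = inj₁ refl
G-mono _ _ (inj₂ (inj₁ refl)) = inj₂ (inj₁ refl)
G-mono m≤m′ n≤n′ (inj₂ (inj₂ (i , j , refl))) =
  frac∈G (toℕ i) (toℕ j) (<-≤-trans (Fin.toℕ<n i) m≤m′) (<-≤-trans (Fin.toℕ<n j) n≤n′)

-- Only fractions written with numerator `m + 1` can get lost, and with denominators up to `n` these
-- are at least `(m + 1) / n`.
G-restrictˡ : ∀ {x} → x ∈ G (suc m) n → ⟨ x ⟩ ≺ (suc m , n) → x ∈ G m n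
G-restrictˡ (inj₁ refl) _ = inj₁ refl
G-restrictˡ (inj₂ (inj₁ refl)) _ = inj₂ (inj₁ refl)
G-restrictˡ {m} {n} (inj₂ (inj₂ (i , j , refl))) h = frac∈G (toℕ i) (toℕ j) (≰⇒> λ m≤i → <⇒≱ h (begin
    suc m * q             ≤⟨ *-monoˡ-≤ q (s≤s m≤i) ⟩
    suc (toℕ i) * q       ≡⟨ frac-≋ (toℕ i) (toℕ j) ⟨
    p * suc (toℕ j)       ≤⟨ *-monoʳ-≤ p (Fin.toℕ<n j) ⟩
    p * n                 ∎)) (Fin.toℕ<n j)
  where
  open ≤-Reasoning
  p = proj₁ ⟨ frac (toℕ i) (toℕ j) ⟩
  q = proj₂ ⟨ frac (toℕ i) (toℕ j) ⟩

G-restrictʳ : ∀ {x} → x ∈ G m (suc n) → (m , suc n) ≺ ⟨ x ⟩ → x ∈ G m n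
G-restrictʳ (inj₁ refl) _ = inj₁ refl
G-restrictʳ (inj₂ (inj₁ refl)) _ = inj₂ (inj₁ refl)
G-restrictʳ {m} {n} (inj₂ (inj₂ (i , j , refl))) h = frac∈G (toℕ i) (toℕ j) (Fin.toℕ<n i) (≰⇒> λ n≤j → <⇒≱ h (begin
    p * suc n             ≤⟨ *-monoʳ-≤ p (s≤s n≤j) ⟩
    p * suc (toℕ j)       ≡⟨ frac-≋ (toℕ i) (toℕ j) ⟩
    suc (toℕ i) * q       ≤⟨ *-monoˡ-≤ q (Fin.toℕ<n i) ⟩
    m * q                 ∎))
  where
  open ≤-Reasoning
  p = proj₁ ⟨ frac (toℕ i) (toℕ j) ⟩
  q = proj₂ ⟨ frac (toℕ i) (toℕ j) ⟩

-- Consecutive elements of a finite set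

<⁺-trans : ∀ {a b c} → a <⁺ b → b <⁺ c → a <⁺ c
<⁺-trans = Strict.<⁺-trans ℚ._<_ ℚ.<-trans

<⁺-irrefl : ∀ {a} → ¬ (a <⁺ a)
<⁺-irrefl = Strict.<⁺-irrefl-≡ ℚ._<_ ℚ.<-irrefl refl

<⁺-cmp = Strict.<⁺-cmp-≡ ℚ._<_ ℚ.<-cmp

≮⁺⇒≥⁺ : ∀ {a b} → ¬ (a <⁺ b) → b ≤⁺ a
≮⁺⇒≥⁺ {[ a ]} {[ b ]} h = NonStrict.[ ℚ.≮⇒≥ (h ∘ [_]) ]
≮⁺⇒≥⁺ {[ a ]} {∞} h = contradiction [ a ]<⊤⁺ h
≮⁺⇒≥⁺ {∞} {b} h = b NonStrict.≤⊤⁺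

Gⁱⁿᵗ⇒Consecutive : ∀ {a b} → (a , b) ∈ Gⁱⁿᵗ m n → Consecutive m n ⟨ a ⟩ ⟨ b ⟩
Gⁱⁿᵗ⇒Consecutive {a = a} {b} (a∈G , b∈G , a<b , gap) = record
  { a<b = <⁺⇒≺ (G-nonNeg a∈G) (G-nonNeg b∈G) a<b
  ; gap = λ { (suc x) (suc y) _ x<m _ y<n lt lt′ → gap (frac x y) (frac∈G x y x<m y<n)
      (<⁺frac⇐ a x y (G-nonNeg a∈G) lt , frac<⁺⇐ b x y (G-nonNeg b∈G) lt′) }
  }

-- Bisection: the points are classified one by one as lying on the low or on
-- the high side, each time shrinking the interval if they fall inside it.
module Bracket {M Low High : Pred (ℚ ⁺) 0ℓ} (side : ∀ {c} → M c → Low c ⊎ High c) where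

  record State (xs : List (ℚ ⁺)) (a b : ℚ ⁺) : Set where
    constructor state
    field
      {a′ b′} : ℚ ⁺
      a′∈M : M a′
      b′∈M : M b′
      a′<b′ : a′ <⁺ b′
      low : Low a′
      high : High b′
      a′≮a : ¬ (a′ <⁺ a)
      b≮b′ : ¬ (b <⁺ b′)
      gap : ∀ {c} → c ∈ₗ xs → ¬ (a′ <⁺ c × c <⁺ b′)

  skip : ∀ {c xs a b} (s : State xs a b) → ¬ (State.a′ s <⁺ c × c <⁺ State.b′ s) → State (c ∷ xs) a b
  skip (state a∈ b∈ a<b l h a≤ ≤b gap) outside =
    state a∈ b∈ a<b l h a≤ ≤b λ { (here refl) → outside ; (there d∈) → gap d∈ }

  shrink : ∀ {c xs a b} (s : State xs a b) → State.a′ s <⁺ c → c <⁺ State.b′ s → M c →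
           Low c ⊎ High c → State (c ∷ xs) a b
  shrink (state a∈ b∈ a<b l h a≤ ≤b gap) a<c c<b c∈ (inj₁ lc) =
    state c∈ b∈ c<b lc h (λ c<a → a≤ (<⁺-trans a<c c<a)) ≤b
      λ { (here refl) (c<c , _) → <⁺-irrefl c<c
        ; (there d∈) (c<d , d<b) → gap d∈ (<⁺-trans a<c c<d , d<b) }
  shrink (state a∈ b∈ a<b l h a≤ ≤b gap) a<c c<b c∈ (inj₂ hc) =
    state a∈ c∈ a<c l hc a≤ (λ b<c → ≤b (<⁺-trans b<c c<b))
      λ { (here refl) (_ , c<c) → <⁺-irrefl c<c
        ; (there d∈) (a<d , d<c) → gap d∈ (a<d , <⁺-trans d<c c<b) }

  step : ∀ {c xs a b} → M c → State xs a b → State (c ∷ xs) a b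
  step {c} c∈ s with <⁺-cmp (State.a′ s) c | <⁺-cmp c (State.b′ s)
  ... | tri≈ a≮c _ _ | _            = skip s (a≮c ∘ proj₁)
  ... | tri> a≮c _ _ | _            = skip s (a≮c ∘ proj₁)
  ... | tri< _ _ _   | tri≈ c≮b _ _ = skip s (c≮b ∘ proj₂)
  ... | tri< _ _ _   | tri> c≮b _ _ = skip s (c≮b ∘ proj₂)
  ... | tri< a<c _ _ | tri< c<b _ _ = shrink s a<c c<b c∈ (side c∈)

  bracket : ∀ xs → (∀ {c} → c ∈ₗ xs → M c) → ∀ {a b} → M a → M b → a <⁺ b → Low a → High b →
            State xs a b
  bracket [] _ a∈ b∈ a<b la hb = state a∈ b∈ a<b la hb <⁺-irrefl <⁺-irrefl λ ()
  bracket (c ∷ xs) xs⊆M a∈ b∈ a<b la hb =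
    step (xs⊆M (here refl)) (bracket xs (xs⊆M ∘ there) a∈ b∈ a<b la hb)

-- For `M = G m n` this unfolds to `Gⁱⁿᵗ m n`.
Gap : Pred (ℚ ⁺) 0ℓ → Pred Interval 0ℓ
Gap M (a , b) = M a × M b × a <⁺ b × (∀ c → M c → ¬ (a <⁺ c × c <⁺ b))

Gap-unique : ∀ {M : Pred (ℚ ⁺) 0ℓ} {a b b′} → Gap M (a , b) → Gap M (a , b′) → b ≡ b′
Gap-unique {b = b} {b′} (_ , b∈ , a<b , gap) (_ , b′∈ , a<b′ , gap′) with <⁺-cmp b b′
... | tri< lt _ _ = contradiction (a<b , lt) (gap′ b b∈)
... | tri≈ _ eq _ = eq
... | tri> _ _ gt = contradiction (a<b′ , gt) (gap b′ b′∈)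

module _ {M : Pred (ℚ ⁺) 0ℓ} (xs : List (ℚ ⁺)) (xs⊆M : ∀ {c} → c ∈ₗ xs → M c)
         (M⊆xs : ∀ {c} → M c → c ∈ₗ xs) where

  -- The classification is left open because it serves both to find the neighbours of a point of the
  -- set and to locate a real number, where only double negated comparisons are available.
  Gap-between : ∀ {Low High : Pred (ℚ ⁺) 0ℓ} → (∀ {c} → M c → Low c ⊎ High c) →
    ∀ {a b} → M a → M b → a <⁺ b → Low a → High b →
    ∃[ a′ ] ∃[ b′ ] Gap M (a′ , b′) × Low a′ × High b′ × ¬ (a′ <⁺ a) × ¬ (b <⁺ b′)
  Gap-between side a∈ b∈ a<b la hb with Bracket.bracket side xs xs⊆M a∈ b∈ a<b la hb
  ... | Bracket.state {a′} {b′} a′∈ b′∈ a′<b′ la′ hb′ a′≮a b≮b′ gap =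
    a′ , b′ , (a′∈ , b′∈ , a′<b′ , λ c c∈ → gap (M⊆xs c∈)) , la′ , hb′ , a′≮a , b≮b′

  -- The low side consists of the points not above `a`, so the left end that is found is neither
  -- above nor below `a`.
  Gap-above : ∀ {a b} → M a → M b → a <⁺ b → ∃[ c ] Gap M (a , c)
  Gap-above {a} a∈ b∈ a<b
    with Gap-between {Low = λ c → ¬ (a <⁺ c)} {High = a <⁺_} (λ {c} _ → side c) a∈ b∈ a<b <⁺-irrefl a<b
    where
    side : ∀ c → ¬ (a <⁺ c) ⊎ a <⁺ c
    side c with <⁺-cmp a c
    ... | tri< lt _ _ = inj₂ lt
    ... | tri≈ ≮ _ _ = inj₁ ≮
    ... | tri> ≮ _ _ = inj₁ ≮
  ... | a′ , b′ , I∈ , a≮a′ , _ , a′≮a , _ with <⁺-cmp a a′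
  ...   | tri< lt _ _ = contradiction lt a≮a′
  ...   | tri≈ _ refl _ = b′ , I∈
  ...   | tri> _ _ gt = contradiction gt a′≮a

  Gap-below : ∀ {a b} → M a → M b → a <⁺ b → ∃[ c ] Gap M (c , b)
  Gap-below {b = b} a∈ b∈ a<b
    with Gap-between {Low = _<⁺ b} {High = λ c → ¬ (c <⁺ b)} (λ {c} _ → side c) a∈ b∈ a<b a<b <⁺-irrefl
    where
    side : ∀ c → c <⁺ b ⊎ ¬ (c <⁺ b)
    side c with <⁺-cmp c b
    ... | tri< lt _ _ = inj₁ lt
    ... | tri≈ ≮ _ _ = inj₂ ≮
    ... | tri> ≮ _ _ = inj₂ ≮
  ... | a′ , b′ , I∈ , _ , b′≮b , _ , b≮b′ with <⁺-cmp b b′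
  ...   | tri< lt _ _ = contradiction lt b≮b′
  ...   | tri≈ _ refl _ = a′ , I∈
  ...   | tri> _ _ gt = contradiction gt b′≮b

0∈G : [ 0ℚ ] ∈ G m n
0∈G = inj₁ refl

∞∈G : ∞ ∈ G m n
∞∈G = inj₂ (inj₁ refl)

module _ (m n : ℕ) where

  private
    pt : Fin m → Fin n → ℚ ⁺
    pt i j = frac (toℕ i) (toℕ j)

  points : List (ℚ ⁺)
  points = [ 0ℚ ] ∷ ∞ ∷ cartesianProductWith pt (allFin m) (allFin n)

  points⊆G : ∀ {c} → c ∈ₗ points → c ∈ G m n
  points⊆G (here e) = inj₁ e
  points⊆G (there (here e)) = inj₂ (inj₁ e)
  points⊆G (there (there c∈)) =
    let i , j , _ , _ , e = ∈-cartesianProductWith⁻ pt (allFin m) (allFin n) c∈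
    in inj₂ (inj₂ (i , j , e))

  G⊆points : ∀ {c} → c ∈ G m n → c ∈ₗ points
  G⊆points (inj₁ e) = here e
  G⊆points (inj₂ (inj₁ e)) = there (here e)
  G⊆points (inj₂ (inj₂ (i , j , e))) = there (there (subst
    (_∈ₗ cartesianProductWith pt (allFin m) (allFin n)) (sym e)
    (∈-cartesianProductWith⁺ pt {a = i} {b = j} (∈-allFin i) (∈-allFin j))))

next : ∀ {a} → a ∈ G m n → a <⁺ ∞ → ∃[ b ] (a , b) ∈ Gⁱⁿᵗ m n
next {m} {n} a∈ a<∞ = Gap-above (points m n) (points⊆G m n) (G⊆points m n) a∈ ∞∈G a<∞

prev : ∀ {b} → b ∈ G m n → [ 0ℚ ] <⁺ b → ∃[ a ] (a , b) ∈ Gⁱⁿᵗ m n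
prev {m} {n} b∈ 0<b = Gap-below (points m n) (points⊆G m n) (G⊆points m n) 0∈G b∈ 0<b

-- Solutions of the difference equations

module Hooks {m n : ℕ} (w : Weight) (inj : Injective _≡_ _≡_ (ℓ {suc m} {suc n} w)) where

  pos : Hook m n → Fin (suc m) × Fin (suc n)
  pos corner   = zero , zero
  pos (col⁺ i) = suc i , zero
  pos (row⁺ j) = zero , suc j

  pos-injective : Injective _≡_ _≡_ pos
  pos-injective {corner} {corner} _ = refl
  pos-injective {col⁺ _} {col⁺ _} refl = refl
  pos-injective {row⁺ _} {row⁺ _} refl = refl

  pos-col : ∀ i → pos (col i) ≡ (i , zero)
  pos-col zero    = refl
  pos-col (suc _) = refl

  pos-row : ∀ j → pos (row j) ≡ (zero , j)
  pos-row zero    = refl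
  pos-row (suc _) = refl

  private
    suc-pred-τ : ∀ x → suc (pred (τℕ w (pos x))) ≡ τℕ w (pos x)
    suc-pred-τ x = suc-pred (τℕ w (pos x)) ⦃ >-nonZero (1≤τℕ w (pos x)) ⦄

    bound : ∀ x → pred (τℕ w (pos x)) < suc m * suc n
    bound x = ≤-trans (≤-reflexive (suc-pred-τ x)) (τℕ≤mn w (pos x))

    hookFun : Hook m n → Fin (suc m * suc n)
    hookFun x = fromℕ< (bound x)

    val≡τℕ : ∀ x → suc (toℕ (hookFun x)) ≡ τℕ w (pos x)
    val≡τℕ x = trans (cong suc (Fin.toℕ-fromℕ< (bound x))) (suc-pred-τ x)

    val-col : ∀ i → suc (toℕ (hookFun (col i))) ≡ τℕ w (i , zero)
    val-col i = trans (val≡τℕ (col i)) (cong (τℕ w) (pos-col i))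

    val-row : ∀ j → suc (toℕ (hookFun (row j))) ≡ τℕ w (zero , j)
    val-row j = trans (val≡τℕ (row j)) (cong (τℕ w) (pos-row j))

  inj-swap : Injective _≡_ _≡_ (ℓ {suc n} {suc m} (swap w))
  inj-swap {i , j} {i′ , j′} e
    with inj {j , i} {j′ , i′} (trans (ℓ-swap w (j , i)) (trans e (sym (ℓ-swap w (j′ , i′)))))
  ... | refl = refl

  -- The ranks along the first column and the first row form a solution; its row equation is the
  -- column equation of the transposed array.
  hook : E¹ⁱⁿ m n
  hook = record
    { fun = hookFun
    ; injective = λ {x} {y} e → pos-injective (inj (τℕ-cancel-≡ w
        (trans (sym (val≡τℕ x)) (trans (cong (λ i → suc (toℕ i)) e) (val≡τℕ y)))))
    ; f11≡1 = trans (val≡τℕ corner) (τℕ-corner w inj)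
    ; col-eqn = λ i → trans (val-col (suc i)) (trans (τℕ-col-step w inj i)
        (cong₂ _+_ (sym (val-col (inject₁ i)))
          (sum-cong-≗ {suc n} λ t → trans (⟦≼⟧-def (τℕ w (zero , t)) (τℕ w (suc i , zero)))
            (cong₂ (λ x y → ⟦ x ≤? y ⟧) (sym (val-row t)) (sym (val-col (suc i)))))))
    ; row-eqn = λ j → trans (val-row (suc j)) (trans (τℕ-swap w (zero , suc j))
        (trans (τℕ-col-step (swap w) inj-swap j)
        (cong₂ _+_ (trans (sym (τℕ-swap w (zero , inject₁ j))) (sym (val-row (inject₁ j))))
          (sum-cong-≗ {suc m} λ s → trans (⟦≼⟧-def (τℕ (swap w) (zero , s)) (τℕ (swap w) (suc j , zero)))
            (cong₂ (λ x y → ⟦ x ≤? y ⟧)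
              (trans (sym (τℕ-swap w (s , zero))) (sym (val-col s)))
              (trans (sym (τℕ-swap w (zero , suc j))) (sym (val-row (suc j)))))))))
    }

  hook-col : E¹ⁱⁿ.val hook (col (fromℕ m)) ≡ colT m n w
  hook-col = val-col (fromℕ m)

  hook-row : E¹ⁱⁿ.val hook (row (fromℕ n)) ≡ rowT m n w
  hook-row = val-row (fromℕ n)

-- The two arms of a solution of the difference equations, without the bound on its values.
record Arms (m n : ℕ) (c : Fin (suc m) → ℕ) (r : Fin (suc n) → ℕ) : Set where
  field
    c₀ : c zero ≡ 1
    r₀ : r zero ≡ 1
    c-step : ∀ i → c (suc i) ≡ c (inject₁ i) + sum {suc n} (λ t → ⟦ r t ≼ c (suc i) ⟧)
    r-step : ∀ j → r (suc j) ≡ r (inject₁ j) + sum {suc m} (λ s → ⟦ c s ≼ r (suc j) ⟧)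
    apart : ∀ i j → c i ≡ r j → i ≡ zero × j ≡ zero

Arms-swap : ∀ {c r} → Arms m n c r → Arms n m r c
Arms-swap A = record
  { c₀ = r₀ ; r₀ = c₀ ; c-step = r-step ; r-step = c-step ; apart = λ i j e → swap (apart j i (sym e)) }
  where open Arms A

last-maximum : ∀ n (f : Fin (suc n) → ℕ) → (∀ i → f (inject₁ i) ≤ f (suc i)) → ∀ i → f i ≤ f (fromℕ n)
last-maximum zero    f mono zero    = ≤-refl
last-maximum (suc n) f mono zero    = ≤-trans (mono zero) (last-maximum n (f ∘ suc) (mono ∘ suc) zero)
last-maximum (suc n) f mono (suc i) = last-maximum n (f ∘ suc) (mono ∘ suc) i

Arms-c≤ : ∀ {c r} → Arms m n c r → ∀ i → c i ≤ c (fromℕ m)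
Arms-c≤ {m} {c = c} A = last-maximum m c λ i → ≤-trans (m≤m+n _ _) (≤-reflexive (sym (Arms.c-step A i)))

Arms-r≤ : ∀ {c r} → Arms m n c r → ∀ j → r j ≤ r (fromℕ n)
Arms-r≤ A = Arms-c≤ (Arms-swap A)

-- The dropped value exceeds every value of the other arm: no equation of that arm counts it, and
-- its own equation counts that arm completely.
Arms-drop : ∀ {c r} → Arms (suc m) n c r → r (fromℕ n) < c (fromℕ (suc m)) →
            Arms m n (c ∘ inject₁) r × c (fromℕ (suc m)) ≡ c (inject₁ (fromℕ m)) + suc n
Arms-drop {m} {n} {c} {r} A r<c = record
  { c₀ = c₀
  ; r₀ = r₀
  ; c-step = λ i → c-step (inject₁ i)
  ; r-step = λ j → trans (r-step j) (cong (r (inject₁ j) +_) (trans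
      (sum-init-last {suc m} (λ s → ⟦ c s ≼ r (suc j) ⟧))
      (trans (cong (sum {suc m} (λ s → ⟦ c (inject₁ s) ≼ r (suc j) ⟧) +_)
               (⟦≼⟧-no (≤-<-trans (Arms-r≤ A (suc j)) r<c)))
             (+-identityʳ _))))
  ; apart = λ i j e → inject₁-zero (proj₁ (apart (inject₁ i) j e)) , proj₂ (apart (inject₁ i) j e)
  } , trans (c-step (fromℕ m)) (cong (c (inject₁ (fromℕ m)) +_) (trans
    (sum-cong-≗ {suc n} λ t → ⟦≼⟧-yes (<⇒≤ (≤-<-trans (Arms-r≤ A t) r<c)))
    (trans (sum-const (suc n) 1) (*-identityʳ (suc n)))))
  where
  open Arms A
  inject₁-zero : ∀ {k} {i : Fin (suc k)} → inject₁ i ≡ zero → i ≡ zero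
  inject₁-zero {i = zero} _ = refl

-- Terminal pairs of intervals and the lifting of solutions

<⁺⇒<⁺∞ : ∀ {a b} → a <⁺ b → a <⁺ ∞
<⁺⇒<⁺∞ [ _ ] = [ _ ]<⊤⁺
<⁺⇒<⁺∞ [ _ ]<⊤⁺ = [ _ ]<⊤⁺

∞≮⁺ : ∀ {a} → ¬ (∞ <⁺ a)
∞≮⁺ ()

Gⁱⁿᵗ⇒0<b : ∀ {a b} → (a , b) ∈ Gⁱⁿᵗ m n → [ 0ℚ ] <⁺ b
Gⁱⁿᵗ⇒0<b {b = b} I@(_ , b∈ , _) = ≺⇒<⁺ [ _ ] (G-nonNeg b∈)
  (subst (_≺ ⟨ b ⟩) (sym ⟨0⟩) (subst (0 <_) (sym (*-identityʳ _)) (consecutive⇒num>0 (Gⁱⁿᵗ⇒Consecutive I))))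

mid : Interval → Weight
mid (a , b) = ⟨ a ⟩ ⊕ ⟨ b ⟩

-- The mediant replaces the real number over which `ST˘` quantifies, which gives a function on all
-- labelled intervals.
st : LabelledInterval → LabelledPair
st (I , m , n) = colT m n (mid I) , rowT m n (mid I) , suc m , suc n

Gⁱⁿᵗ-injective : ∀ {I} → I ∈ Gⁱⁿᵗ m n → Injective _≡_ _≡_ (ℓ {suc m} {suc n} (mid I))
Gⁱⁿᵗ-injective I∈ = ℓ-mid-injective (Gⁱⁿᵗ⇒Consecutive I∈)

st∈T : ∀ {I} → I ∈ Gⁱⁿᵗ m n → T¹ⁱⁿ (suc m) (suc n) (st (I , m , n))
st∈T {m} {n} {I} I∈ = hook , cong₂ (λ s t → s , t , suc m , suc n) (sym hook-col) (sym hook-row)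
  where open Hooks (mid I) (Gⁱⁿᵗ-injective I∈)

-- The left end stays in the larger set and only its right neighbour is chosen anew. The inequality
-- between the counts places the new slope `(m + 1) / n` to the right of `a`, as `left-step`
-- requires.
extend-left : ∀ {a b′} → (a , b′) ∈ Gⁱⁿᵗ m n →
  rowT m n (mid (a , b′)) < colT m n (mid (a , b′)) + suc n →
  ∃[ b ] (a , b) ∈ Gⁱⁿᵗ (suc m) n ×
    colT (suc m) n (mid (a , b)) ≡ colT m n (mid (a , b′)) + suc n ×
    rowT (suc m) n (mid (a , b)) ≡ rowT m n (mid (a , b′))
extend-left {m} {n} {a} {b′} I@(a∈ , _ , a<b′ , _) h =
  let b , J = next {m = suc m} {n} (G-mono (n≤1+n m) ≤-refl a∈) (<⁺⇒<⁺∞ a<b′)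
      row≡ , col≡ , _ = left-step (Gⁱⁿᵗ⇒Consecutive J) (Gⁱⁿᵗ⇒Consecutive I) (a≺ a∈)
  in b , J , col≡ , row≡
  where
  a≺ : G m n a → ⟨ a ⟩ ≺ (suc m , n)
  a≺ (inj₁ refl) = 0≺ m n
  a≺ (inj₂ (inj₁ refl)) = contradiction a<b′ ∞≮⁺
  a≺ (inj₂ (inj₂ (i , j , refl))) = left-of-new-slope (suc (toℕ i)) (suc (toℕ j))
    (Gⁱⁿᵗ⇒Consecutive I) (s≤s z≤n) (Fin.toℕ<n i) (Fin.toℕ<n j) (frac-≋ (toℕ i) (toℕ j)) h

extend-right : ∀ {a′ b} → (a′ , b) ∈ Gⁱⁿᵗ m n →
  colT m n (mid (a′ , b)) < rowT m n (mid (a′ , b)) + suc m →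
  ∃[ a ] (a , b) ∈ Gⁱⁿᵗ m (suc n) ×
    rowT m (suc n) (mid (a , b)) ≡ rowT m n (mid (a′ , b)) + suc m ×
    colT m (suc n) (mid (a , b)) ≡ colT m n (mid (a′ , b))
extend-right {m} {n} {a′} {b} I@(_ , b∈ , a′<b , _) h =
  let a , J = prev {m = m} {suc n} (G-mono ≤-refl (n≤1+n n) b∈) (Gⁱⁿᵗ⇒0<b I)
      col≡ , row≡ , _ = right-step (Gⁱⁿᵗ⇒Consecutive J) (Gⁱⁿᵗ⇒Consecutive I) (≺b b∈)
  in a , J , row≡ , col≡
  where
  ≺b : G m n b → (m , suc n) ≺ ⟨ b ⟩
  ≺b (inj₁ refl) = contradiction (Gⁱⁿᵗ⇒0<b I) <⁺-irrefl
  ≺b (inj₂ (inj₁ refl)) = ≺∞ m n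
  ≺b (inj₂ (inj₂ (i , j , refl))) = right-of-new-slope (suc (toℕ i)) (suc (toℕ j))
    (Gⁱⁿᵗ⇒Consecutive I) (Fin.toℕ<n i) (s≤s z≤n) (Fin.toℕ<n j) (frac-≋ (toℕ i) (toℕ j)) h

Realised : ∀ m n → ℕ → ℕ → Set
Realised m n s t = ∃[ I ] I ∈ Gⁱⁿᵗ m n × colT m n (mid I) ≡ s × rowT m n (mid I) ≡ t

-- Induction along `u˘`: the arm with the larger end loses its last value, and the interval found
-- for the rest is extended back. The comparison of the two ends is exactly the hypothesis of that
-- extension.
realise : ∀ m n c r → Arms m n c r → Realised m n (c (fromℕ m)) (r (fromℕ n))
realise m n c r A with <-cmp (c (fromℕ m)) (r (fromℕ n))
realise zero zero c r A | _ = _ , I∈ , col≡ , row≡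
  where
  I∈ = proj₂ rootG∈G˘
  col≡ = trans (τℕ-corner _ (Gⁱⁿᵗ-injective I∈)) (sym (Arms.c₀ A))
  row≡ = trans (τℕ-corner _ (Gⁱⁿᵗ-injective I∈)) (sym (Arms.r₀ A))
-- Here the row is the corner alone, and no value of the column lies below the corner.
realise m zero c r A | tri< c<r _ _ = contradiction
  (subst (c (fromℕ m) <_) (trans (Arms.r₀ A) (sym (Arms.c₀ A))) c<r) (≤⇒≯ (Arms-c≤ A zero))
realise m (suc n) c r A | tri< c<r _ _ =
  let A′ , r≡ = Arms-drop (Arms-swap A) c<r
      (a , b) , I∈ , col≡ , row≡ = realise m n c (r ∘ inject₁) (Arms-swap A′)
      a′ , J∈ , row≡′ , col≡′ = extend-right I∈
        (subst₂ _<_ (sym col≡) (trans r≡ (cong (_+ suc m) (sym row≡))) c<r)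
  in (a′ , b) , J∈ , trans col≡′ col≡ , trans row≡′ (trans (cong (_+ suc m) row≡) (sym r≡))
realise zero n c r A | tri> _ _ r<c = contradiction
  (subst (r (fromℕ n) <_) (trans (Arms.c₀ A) (sym (Arms.r₀ A))) r<c) (≤⇒≯ (Arms-r≤ A zero))
realise (suc m) n c r A | tri> _ _ r<c =
  let A′ , c≡ = Arms-drop A r<c
      (a , b) , I∈ , col≡ , row≡ = realise m n (c ∘ inject₁) r A′
      b′ , J∈ , col≡′ , row≡′ = extend-left I∈
        (subst₂ _<_ (sym row≡) (trans c≡ (cong (_+ suc n) (sym col≡))) r<c)
  in (a , b′) , J∈ , trans col≡′ (trans (cong (_+ suc n) col≡) (sym c≡)) , trans row≡′ row≡
-- The arms meet only in the corner, so a tie of their ends forces both sizes to be zero.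
realise (suc m) n c r A | tri≈ _ e _ with Arms.apart A (fromℕ (suc m)) (fromℕ n) e
... | () , _
realise zero (suc n) c r A | tri≈ _ e _ with Arms.apart A zero (fromℕ (suc n)) e
... | _ , ()

T⇒st : ∀ {w} → T¹ⁱⁿ (suc m) (suc n) w → ∃[ I ] I ∈ Gⁱⁿᵗ m n × w ≡ st (I , m , n)
T⇒st {m} {n} (f , refl) =
  let I , I∈ , col≡ , row≡ = realise m n (val ∘ col) (val ∘ row) arms
  in I , I∈ , cong₂ (λ s t → s , t , suc m , suc n) (sym col≡) (sym row≡)
  where
  open E¹ⁱⁿ f
  col≡row : ∀ (i : Fin (suc m)) (j : Fin (suc n)) → col {m} {n} i ≡ row j → i ≡ zero × j ≡ zero
  col≡row zero zero _ = refl , refl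
  col≡row zero (suc _) ()
  col≡row (suc _) zero ()
  col≡row (suc _) (suc _) ()
  arms : Arms m n (val ∘ col) (val ∘ row)
  arms = record
    { c₀ = f11≡1
    ; r₀ = f11≡1
    ; c-step = λ i → trans (col-eqn i) (cong (val (col (inject₁ i)) +_)
        (sum-cong-≗ {suc n} λ t → sym (⟦≼⟧-def (val (row t)) (val (col (suc i))))))
    ; r-step = λ j → trans (row-eqn j) (cong (val (row (inject₁ j)) +_)
        (sum-cong-≗ {suc m} λ s → sym (⟦≼⟧-def (val (col s)) (val (row (suc j))))))
    ; apart = λ i j e → col≡row i j (injective (Fin.toℕ-injective (suc-injective e)))
    }

-- Injectivity of the terminal pair

rowT-increasing : ∀ {a b a′ b′} → (a , b) ∈ Gⁱⁿᵗ m n → (a′ , b′) ∈ Gⁱⁿᵗ m n → a <⁺ a′ →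
                  rowT m n (mid (a , b)) < rowT m n (mid (a′ , b′))
rowT-increasing {m} {n} {a} {a′ = a′} {b′} I@(a∈ , _) J@(a′∈ , _ , a′<b′ , _) a<a′ =
  subst₂ _<_ (sym (rowT-mid (Gⁱⁿᵗ⇒Consecutive I))) (sym (rowT-mid (Gⁱⁿᵗ⇒Consecutive J)))
    (mono a′∈ a′<b′ (<⁺⇒≺ (G-nonNeg a∈) (G-nonNeg a′∈) a<a′))
  where
  mono : ∀ {a′ b′} → G m n a′ → a′ <⁺ b′ → ⟨ a ⟩ ≺ ⟨ a′ ⟩ → rowT m n ⟨ a ⟩ < rowT m n ⟨ a′ ⟩
  mono (inj₁ refl) _ lt = contradiction (subst (⟨ a ⟩ ≺_) ⟨0⟩ lt) n≮0
  mono (inj₂ (inj₁ refl)) ()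
  mono (inj₂ (inj₂ (i , j , refl))) _ lt = rowT-mono-< (suc (toℕ i)) (suc (toℕ j)) (Fin.toℕ<n i)
    (s≤s z≤n) (Fin.toℕ<n j) (frac-≋ (toℕ i) (toℕ j)) (den>0 _) lt

-- Distinct left ends have distinct counts, and a left end determines the right one.
rowT-mid-injective : ∀ {I J} → I ∈ Gⁱⁿᵗ m n → J ∈ Gⁱⁿᵗ m n → rowT m n (mid I) ≡ rowT m n (mid J) → I ≡ J
rowT-mid-injective {m} {n} {a , b} {a′ , b′} I J e = byCases (<⁺-cmp a a′)
  where
  aligned : ∀ {a′ b′} → Gap (G m n) (a′ , b′) → a ≡ a′ → (a , b) ≡ (a′ , b′)
  aligned J refl = cong (a ,_) (Gap-unique I J)

  byCases : Tri (a <⁺ a′) (a ≡ a′) (a′ <⁺ a) → (a , b) ≡ (a′ , b′)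
  byCases (tri< lt _ _) = contradiction e (<⇒≢ (rowT-increasing I J lt))
  byCases (tri≈ _ eq _) = aligned J eq
  byCases (tri> _ _ gt) = contradiction (sym e) (<⇒≢ (rowT-increasing J I gt))

labels : LabelledPair → ℕ × ℕ
labels (_ , _ , m , n) = m , n

st-injective : ∀ {I m n J m′ n′} → I ∈ Gⁱⁿᵗ m n → J ∈ Gⁱⁿᵗ m′ n′ →
               st (I , m , n) ≡ st (J , m′ , n′) → (I , m , n) ≡ (J , m′ , n′)
st-injective {I} {m} {n} {J} I∈ J∈ e = go (cong labels e) J∈ (cong (λ (_ , t , _) → t) e)
  where
  go : ∀ {m′ n′} → (suc m , suc n) ≡ (suc m′ , suc n′) → J ∈ Gⁱⁿᵗ m′ n′ →
       rowT m n (mid I) ≡ rowT m′ n′ (mid J) → (I , m , n) ≡ (J , m′ , n′)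
  go refl J∈ e = cong (_, m , n) (rowT-mid-injective I∈ J∈ e)

-- Agreement of the two parent maps

u˘-left : ∀ {a b c} → (a , b) ∈ Gⁱⁿᵗ (suc m) n → (a , c) ∈ Gⁱⁿᵗ m n → ⟨ a ⟩ ≺ (suc m , n) →
          u˘ (st ((a , b) , suc m , n)) (st ((a , c) , m , n))
u˘-left {m} {n} {a} {b} {c} I J h =
  let row≡ , col≡ , row<col = left-step (Gⁱⁿᵗ⇒Consecutive I) (Gⁱⁿᵗ⇒Consecutive J) h
  in subst (λ t → u˘ (st ((a , b) , suc m , n)) (colT m n (mid (a , c)) , t , suc m , suc n)) row≡
       (s>t row<col col≡)

u˘-right : ∀ {a b c} → (a , b) ∈ Gⁱⁿᵗ m (suc n) → (c , b) ∈ Gⁱⁿᵗ m n → (m , suc n) ≺ ⟨ b ⟩ →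
           u˘ (st ((a , b) , m , suc n)) (st ((c , b) , m , n))
u˘-right {m} {n} {a} {b} {c} I J h =
  let col≡ , row≡ , col<row = right-step (Gⁱⁿᵗ⇒Consecutive I) (Gⁱⁿᵗ⇒Consecutive J) h
  in subst (λ s → u˘ (st ((a , b) , m , suc n)) (s , rowT m n (mid (c , b)) , suc m , suc n)) col≡
       (s<t col<row row≡)

-- The six cases come down to two. Either the intervals share the left end, which lies left of the
-- new slope, or they share the right end, which lies right of it.
V˘⇒u˘ : ∀ {k k′ v v′} → v′ ∈ G˘ k′ → v ∈ G˘ k → V˘ v′ v → u˘ (st v′) (st v)
V˘⇒u˘ (_ , I) (_ , J) (m≡0 {n}) = u˘-right I J (≺∞ 0 n)
V˘⇒u˘ (_ , I) (_ , J) (n≡0 {m}) = u˘-left I J (0≺ m 0)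
V˘⇒u˘ (_ , I@(a∈ , _ , a<b , _)) (_ , J) (b<m/n {a} {m = m} {n} b<f) =
  u˘-left I J (<⁺frac⇒ a m n (G-nonNeg a∈) (<⁺-trans a<b b<f))
V˘⇒u˘ (_ , I@(a∈ , _ , a<b , _)) (_ , J) (b≡m/n {a} {m = m} {n} b≡f _) =
  u˘-left I J (<⁺frac⇒ a m n (G-nonNeg a∈) (subst (a <⁺_) b≡f a<b))
V˘⇒u˘ (_ , I@(_ , b∈ , a<b , _)) (_ , J) (a≡m/n {b = b} {m = m} {n} a≡f _) =
  u˘-right I J (frac<⁺⇒ b m n (G-nonNeg b∈) (subst (_<⁺ b) a≡f a<b))
V˘⇒u˘ (_ , I@(_ , b∈ , a<b , _)) (_ , J) (a>m/n {b = b} {m = m} {n} f<a) =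
  u˘-right I J (frac<⁺⇒ b m n (G-nonNeg b∈) (<⁺-trans f<a a<b))

trivial-Gⁱⁿᵗ : (∀ {x} → G m n x → x ≡ [ 0ℚ ] ⊎ x ≡ ∞) → ([ 0ℚ ] , ∞) ∈ Gⁱⁿᵗ m n
trivial-Gⁱⁿᵗ {m} {n} ends = 0∈G , ∞∈G , [ 0ℚ ]<⊤⁺ , gap
  where
  gap : ∀ c → G m n c → ¬ ([ 0ℚ ] <⁺ c × c <⁺ ∞)
  gap c c∈ (0<c , c<∞) with ends c∈
  ... | inj₁ refl = <⁺-irrefl 0<c
  ... | inj₂ refl = <⁺-irrefl c<∞

trivial-Gⁱⁿᵗ-unique : ∀ {I} → (∀ {x} → G m n x → x ≡ [ 0ℚ ] ⊎ x ≡ ∞) → I ∈ Gⁱⁿᵗ m n → I ≡ ([ 0ℚ ] , ∞)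
trivial-Gⁱⁿᵗ-unique ends I∈@(a∈ , b∈ , a<b , _) with ends a∈ | ends b∈
... | inj₁ refl | inj₂ refl = refl
... | inj₁ refl | inj₁ refl = contradiction a<b <⁺-irrefl
... | inj₂ refl | _         = contradiction a<b ∞≮⁺

G₀-ends : ∀ {x} → G 0 n x → x ≡ [ 0ℚ ] ⊎ x ≡ ∞
G₀-ends (inj₁ e) = inj₁ e
G₀-ends (inj₂ (inj₁ e)) = inj₂ e

G⁰-ends : ∀ {x} → G m 0 x → x ≡ [ 0ℚ ] ⊎ x ≡ ∞
G⁰-ends (inj₁ e) = inj₁ e
G⁰-ends (inj₂ (inj₁ e)) = inj₂ e

module _ {a b : ℚ ⁺} {m n : ℕ} (I : (a , b) ∈ Gⁱⁿᵗ (suc m) (suc n)) where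

  private
    a∈ = proj₁ I
    b∈ = proj₁ (proj₂ I)
    a<b = proj₁ (proj₂ (proj₂ I))
    gap = proj₂ (proj₂ (proj₂ I))

    toG : ∀ {x : ℚ ⁺} → G (suc m) (suc n) x → x <⁺ frac m n → G m (suc n) x
    toG {x} x∈ x<f = G-restrictˡ x∈ (<⁺frac⇒ x m n (G-nonNeg x∈) x<f)

    toG′ : ∀ {x : ℚ ⁺} → G (suc m) (suc n) x → frac m n <⁺ x → G (suc m) n x
    toG′ {x} x∈ f<x = G-restrictʳ x∈ (frac<⁺⇒ x m n (G-nonNeg x∈) f<x)

    Step : Set
    Step = ∃[ J ] ∃[ m′ ] ∃[ n′ ] m′ + n′ ≡ m + suc n × J ∈ Gⁱⁿᵗ m′ n′ ×
           V˘ ((a , b) , suc m , suc n) (J , m′ , n′)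

    step-b<f : b <⁺ frac m n → Step
    step-b<f b<f = (a , b) , m , suc n , refl ,
      (toG a∈ (<⁺-trans a<b b<f) , toG b∈ b<f , a<b , λ c c∈ → gap c (G-mono (n≤1+n m) ≤-refl c∈)) ,
      b<m/n b<f

    step-b≡f : b ≡ frac m n → Step
    step-b≡f b≡f =
      let a∈′ = toG a∈ (subst (a <⁺_) b≡f a<b)
          c , J@(_ , c∈ , a<c , gap′) = next {m} {suc n} a∈′ (<⁺⇒<⁺∞ a<b)
      in (a , c) , m , suc n , refl , J ,
         b≡m/n b≡f ((c∈ , a<c) , λ d (d∈ , a<d) → ≮⁺⇒≥⁺ λ d<c → gap′ d d∈ (a<d , d<c))

    step-a≡f : frac m n <⁺ b → a ≡ frac m n → Step
    step-a≡f f<b a≡f =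
      let c , J@(c∈ , _ , c<b , gap′) = prev {suc m} {n} (toG′ b∈ f<b) (Gⁱⁿᵗ⇒0<b I)
      in (c , b) , suc m , n , sym (+-suc m n) , J ,
         a≡m/n a≡f ((c∈ , c<b) , λ d (d∈ , d<b) → ≮⁺⇒≥⁺ λ c<d → gap′ d d∈ (c<d , d<b))

    step-f<a : frac m n <⁺ b → frac m n <⁺ a → Step
    step-f<a f<b f<a = (a , b) , suc m , n , sym (+-suc m n) ,
      (toG′ a∈ f<a , toG′ b∈ f<b , a<b , λ c c∈ → gap c (G-mono ≤-refl (n≤1+n n) c∈)) ,
      a>m/n f<a

    step-f<b : frac m n <⁺ b → Tri (a <⁺ frac m n) (a ≡ frac m n) (frac m n <⁺ a) → Step
    -- `frac m n` belongs to the set itself, so it cannot fall inside the interval.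
    step-f<b f<b (tri< a<f _ _) = contradiction (a<f , f<b) (gap (frac m n) (frac∈G m n ≤-refl ≤-refl))
    step-f<b f<b (tri≈ _ a≡f _) = step-a≡f f<b a≡f
    step-f<b f<b (tri> _ _ f<a) = step-f<a f<b f<a

    step-cmp : Tri (b <⁺ frac m n) (b ≡ frac m n) (frac m n <⁺ b) → Step
    step-cmp (tri< b<f _ _) = step-b<f b<f
    step-cmp (tri≈ _ b≡f _) = step-b≡f b≡f
    step-cmp (tri> _ _ f<b) = step-f<b f<b (<⁺-cmp a (frac m n))

  V˘-step : Step
  V˘-step = step-cmp (<⁺-cmp b (frac m n))

V˘-total : ∀ {k v′} → v′ ∈ G˘ (suc k) → ∃[ v ] v ∈ G˘ k × V˘ v′ v
V˘-total {k} {I , zero , suc n} (e , I∈) with trivial-Gⁱⁿᵗ-unique G₀-ends I∈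
... | refl = _ , (suc-injective e , trivial-Gⁱⁿᵗ G₀-ends) , m≡0
V˘-total {k} {I , suc m , zero} (e , I∈) with trivial-Gⁱⁿᵗ-unique G⁰-ends I∈
... | refl = _ , (suc-injective e , trivial-Gⁱⁿᵗ G⁰-ends) , n≡0
V˘-total {k} {I , suc m , suc n} (e , I∈) =
  let J , m′ , n′ , e′ , J∈ , r = V˘-step I∈
  in (J , m′ , n′) , (trans e′ (suc-injective e) , J∈) , r

u˘-functional : ∀ {w x y} → u˘ w x → u˘ w y → x ≡ y
u˘-functional (s>t {t = t} {m} {n} _ e) (s>t _ e′) =
  cong (λ s → s , t , m , n) (+-cancelʳ-≡ n _ _ (trans (sym e) e′))
u˘-functional (s<t {s = s} {m = m} {n} _ e) (s<t _ e′) =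
  cong (λ t → s , t , m , n) (+-cancelʳ-≡ m _ _ (trans (sym e) e′))
u˘-functional (s>t lt _) (s<t gt _) = contradiction gt (<-asym lt)
u˘-functional (s<t lt _) (s>t gt _) = contradiction gt (<-asym lt)

-- The actual parent of `v′` is also sent to the parent of `st v′`; as `u˘` is single-valued and
-- `st` injective, that parent is `v`.
u˘⇒V˘ : ∀ {k v v′} → v′ ∈ G˘ (suc k) → v ∈ G˘ k → u˘ (st v′) (st v) → V˘ v′ v
u˘⇒V˘ {v′ = v′} v′∈ v∈ r =
  let v₀ , v₀∈ , r₀ = V˘-total v′∈
  in subst (V˘ v′) (st-injective (proj₂ v₀∈) (proj₂ v∈) (u˘-functional (V˘⇒u˘ v′∈ v₀∈ r₀) r)) r₀

-- Rational arithmetic and the order of Cauchy reals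

opaque

  ι : ℕ → ℚ
  ι n = ℤ.+ n ℚ./ 1

  ι-def : ∀ n → ι n ≡ ℤ.+ n ℚ./ 1
  ι-def n = refl

  /-cancel : ∀ n d → ι (suc d) ℚ.* (ℤ.+ n ℚ./ suc d) ≡ ι n
  /-cancel n d = ℚ.toℚᵘ-injective (begin
    ℚ.toℚᵘ (ι (suc d) ℚ.* (ℤ.+ n ℚ./ suc d))
      ≈⟨ ℚ.toℚᵘ-homo-* (ι (suc d)) (ℤ.+ n ℚ./ suc d) ⟩
    ℚ.toℚᵘ (ι (suc d)) ℚᵘ.* ℚ.toℚᵘ (ℤ.+ n ℚ./ suc d)
      ≈⟨ ℚᵘ.*-cong (ℚ.toℚᵘ-fromℚᵘ (ℚᵘ.mkℚᵘ (ℤ.+ suc d) 0)) (ℚ.toℚᵘ-fromℚᵘ (ℚᵘ.mkℚᵘ (ℤ.+ n) d)) ⟩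
    ℚᵘ.mkℚᵘ (ℤ.+ suc d) 0 ℚᵘ.* ℚᵘ.mkℚᵘ (ℤ.+ n) d
      ≈⟨ ℚᵘ.*≡* (trans (cong (ℤ._* ℤ.+ 1) (ℤ.*-comm (ℤ.+ suc d) (ℤ.+ n)))
           (trans (ℤ.*-identityʳ _) (cong (λ z → ℤ.+ n ℤ.* ℤ.+ suc z) (sym (+-identityʳ d))))) ⟩
    ℚᵘ.mkℚᵘ (ℤ.+ n) 0
      ≈⟨ ℚ.toℚᵘ-fromℚᵘ (ℚᵘ.mkℚᵘ (ℤ.+ n) 0) ⟨
    ℚ.toℚᵘ (ι n) ∎)
    where open ≈-Reasoning ℚᵘ.≃-setoid

  ι-+ : ∀ m n → ι (m + n) ≡ ι m ℚ.+ ι n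
  ι-+ m n = ℚ.toℚᵘ-injective (begin
    ℚ.toℚᵘ (ι (m + n))
      ≈⟨ ℚ.toℚᵘ-fromℚᵘ (ℚᵘ.mkℚᵘ (ℤ.+ (m + n)) 0) ⟩
    ℚᵘ.mkℚᵘ (ℤ.+ (m + n)) 0
      ≈⟨ ℚᵘ.*≡* (cong (ℤ._* ℤ.+ 1) (cong₂ ℤ._+_ (sym (ℤ.*-identityʳ (ℤ.+ m))) (sym (ℤ.*-identityʳ (ℤ.+ n))))) ⟩
    ℚᵘ.mkℚᵘ (ℤ.+ m) 0 ℚᵘ.+ ℚᵘ.mkℚᵘ (ℤ.+ n) 0
      ≈⟨ ℚᵘ.+-cong (ℚ.toℚᵘ-fromℚᵘ (ℚᵘ.mkℚᵘ (ℤ.+ m) 0)) (ℚ.toℚᵘ-fromℚᵘ (ℚᵘ.mkℚᵘ (ℤ.+ n) 0)) ⟨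
    ℚ.toℚᵘ (ι m) ℚᵘ.+ ℚ.toℚᵘ (ι n)
      ≈⟨ ℚ.toℚᵘ-homo-+ (ι m) (ι n) ⟨
    ℚ.toℚᵘ (ι m ℚ.+ ι n) ∎)
    where open ≈-Reasoning ℚᵘ.≃-setoid

  ι-* : ∀ m n → ι (m * n) ≡ ι m ℚ.* ι n
  ι-* m n = ℚ.toℚᵘ-injective (begin
    ℚ.toℚᵘ (ι (m * n))
      ≈⟨ ℚ.toℚᵘ-fromℚᵘ (ℚᵘ.mkℚᵘ (ℤ.+ (m * n)) 0) ⟩
    ℚᵘ.mkℚᵘ (ℤ.+ (m * n)) 0
      ≈⟨ ℚᵘ.*≡* (cong (ℤ._* ℤ.+ 1) (ℤ.pos-* m n)) ⟩
    ℚᵘ.mkℚᵘ (ℤ.+ m) 0 ℚᵘ.* ℚᵘ.mkℚᵘ (ℤ.+ n) 0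
      ≈⟨ ℚᵘ.*-cong (ℚ.toℚᵘ-fromℚᵘ (ℚᵘ.mkℚᵘ (ℤ.+ m) 0)) (ℚ.toℚᵘ-fromℚᵘ (ℚᵘ.mkℚᵘ (ℤ.+ n) 0)) ⟨
    ℚ.toℚᵘ (ι m) ℚᵘ.* ℚ.toℚᵘ (ι n)
      ≈⟨ ℚ.toℚᵘ-homo-* (ι m) (ι n) ⟨
    ℚ.toℚᵘ (ι m ℚ.* ι n) ∎)
    where open ≈-Reasoning ℚᵘ.≃-setoid

  ι0 : ι 0 ≡ 0ℚ
  ι0 = refl

  ι1 : ι 1 ≡ 1ℚ
  ι1 = refl

  0≤ι : ∀ n → 0ℚ ℚ.≤ ι n
  0≤ι n = ℚ.nonNegative⁻¹ (ι n) ⦃ ℚ.normalize-nonNeg n 1 ⦄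

  0<ι : ∀ n → 0ℚ ℚ.< ι (suc n)
  0<ι n = ℚ.positive⁻¹ (ι (suc n)) ⦃ ℚ.normalize-pos (suc n) 1 ⦄

  0<1/ : ∀ d → 0ℚ ℚ.< ℤ.+ 1 ℚ./ suc d
  0<1/ d = ℚ.positive⁻¹ (ℤ.+ 1 ℚ./ suc d) ⦃ ℚ.normalize-pos 1 (suc d) ⦄

ι-suc : ∀ n → ι (suc n) ≡ 1ℚ ℚ.+ ι n
ι-suc n = trans (ι-+ 1 n) (cong (ℚ._+ ι n) ι1)

opaque
  unfolding ⟨_⟩

  num-den : ∀ {x} → NonNeg [ x ] → ι (proj₂ ⟨ [ x ] ⟩) ℚ.* x ≡ ι (proj₁ ⟨ [ x ] ⟩)
  num-den {x@(mkℚ (ℤ.+ n) d _)} _ = trans (cong (ι (suc d) ℚ.*_) (sym (ℚ.↥p/↧p≡p x))) (/-cancel n d)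
  num-den {mkℚ (ℤ.-[1+ _ ]) _ _} [ record { nonNeg = () } ]

ℚ<-from : ∀ {a b x y} → a ℚ.< b → x ℚ.+ b ≡ a ℚ.+ y → x ℚ.< y
ℚ<-from {a} {b} {x} {y} a<b eq = ℚ.≰⇒> λ y≤x → ℚ.<-irrefl (trans (sym eq) (ℚ.+-comm x b))
  (ℚ.+-mono-<-≤ a<b y≤x)

*-pos : ∀ {x y} → 0ℚ ℚ.< x → 0ℚ ℚ.< y → 0ℚ ℚ.< x ℚ.* y
*-pos {x} {y} 0<x 0<y = ℚ.positive⁻¹ (x ℚ.* y) ⦃ ℚ.pos*pos⇒pos x ⦃ ℚ.positive 0<x ⦄ y ⦃ ℚ.positive 0<y ⦄ ⦄

*-nonNeg : ∀ {x y} → 0ℚ ℚ.≤ x → 0ℚ ℚ.≤ y → 0ℚ ℚ.≤ x ℚ.* y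
*-nonNeg {x} {y} 0≤x 0≤y = ℚ.nonNegative⁻¹ (x ℚ.* y)
  ⦃ ℚ.nonNeg*nonNeg⇒nonNeg x ⦃ ℚ.nonNegative 0≤x ⦄ y ⦃ ℚ.nonNegative 0≤y ⦄ ⦄

*-mono-ι : ∀ {x y} d → x ℚ.< y → ι (suc d) ℚ.* x ℚ.< ι (suc d) ℚ.* y
*-mono-ι d = ℚ.*-monoʳ-<-pos (ι (suc d)) ⦃ ℚ.positive (0<ι d) ⦄

*-cancel-ι : ∀ {x y} d → ι (suc d) ℚ.* x ℚ.< ι (suc d) ℚ.* y → x ℚ.< y
*-cancel-ι d = ℚ.*-cancelˡ-<-nonNeg (ι (suc d)) ⦃ ℚ.nonNegative (0≤ι (suc d)) ⦄

<ℝ-asym : ∀ {x y} → x <ℝ y → ¬ (y <ℝ x)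
<ℝ-asym {x} {y} (ε , 0<ε , M , x<y) (δ , 0<δ , N , y<x) =
  ℚ.<-asym (weaken 0<ε (x<y (M ⊔ N) (m≤m⊔n M N))) (weaken 0<δ (y<x (M ⊔ N) (m≤n⊔m M N)))
  where
  weaken : ∀ {a b ε} → 0ℚ ℚ.< ε → a ℚ.+ ε ℚ.< b → a ℚ.< b
  weaken {a} {b} {ε} 0<ε = ℚ.<-trans (subst (ℚ._< a ℚ.+ ε) (ℚ.+-identityʳ a) (ℚ.+-monoʳ-< a 0<ε))

<ℝ-irrefl : ∀ {x} → ¬ (x <ℝ x)
<ℝ-irrefl {x} x<x = <ℝ-asym {x} {x} x<x x<x

fromℚ-mono : ∀ {x y} → x ℚ.< y → fromℚ x <ℝ fromℚ y
fromℚ-mono {x} {y} x<y =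
  let z , x<z , z<y = ℚ.<-dense x<y
  in z ℚ.- x ,
     ℚ<-from x<z (solve₁ x z) ,
     0 , λ _ _ → subst (ℚ._< y) (solve₂ x z) z<y
  where
  open +-*-Solver using (_:+_; _:-_; _:=_; con) renaming (solve to solveℚ)
  solve₁ : ∀ x z → 0ℚ ℚ.+ z ≡ x ℚ.+ (z ℚ.- x)
  solve₁ = solveℚ 2 (λ x z → con 0ℚ :+ z := x :+ (z :- x)) refl
  solve₂ : ∀ x z → z ≡ x ℚ.+ (z ℚ.- x)
  solve₂ = solveℚ 2 (λ x z → z := x :+ (z :- x)) refl

halve : ∀ {ε} → 0ℚ ℚ.< ε → ∃[ δ ] 0ℚ ℚ.< δ × δ ℚ.+ δ ≡ ε
halve {ε} 0<ε = ½ ℚ.* ε , *-pos (ℚ.positive⁻¹ ½) 0<ε ,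
  trans (sym (ℚ.*-distribʳ-+ ε ½ ½)) (ℚ.*-identityˡ ε)

≤∣∣ : ∀ x → x ℚ.≤ ℚ.∣ x ∣
≤∣∣ x with ℚ.≤-total 0ℚ x
... | inj₁ 0≤x = ℚ.≤-reflexive (sym (ℚ.0≤p⇒∣p∣≡p 0≤x))
... | inj₂ x≤0 = ℚ.≤-trans x≤0 (ℚ.0≤∣p∣ x)

-- A comparison of rationals is enough: at one late index `K`, `seq y` is held against the point
-- that lies half of `ε` above `seq z`.
cotransitive : ∀ {x z} y → z <ℝ x → z <ℝ y ⊎ y <ℝ x
cotransitive {x} {z} y (ε , 0<ε , N , z<x) = result (ℚ.<-cmp (seq y K) (seq z K ℚ.+ four))
  where
  open +-*-Solver using (_:+_; _:-_; _:=_; con) renaming (solve to solveℚ)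
  -- Here `ε` is eight times `η`: `four` is half of `ε`, every sequence moves by less than `η` from
  -- `K` on, and a margin of `η + η` survives in either case.
  h₁ = halve 0<ε
  h₂ = halve (proj₁ (proj₂ h₁))
  h₃ = halve (proj₁ (proj₂ h₂))
  η four : ℚ
  η = proj₁ h₃
  four = (η ℚ.+ η) ℚ.+ (η ℚ.+ η)
  0<η : 0ℚ ℚ.< η
  0<η = proj₁ (proj₂ h₃)
  four+four : four ℚ.+ four ≡ ε
  four+four = trans (cong (λ d → (d ℚ.+ d) ℚ.+ (d ℚ.+ d)) (proj₂ (proj₂ h₃)))
    (trans (cong (λ d → d ℚ.+ d) (proj₂ (proj₂ h₂))) (proj₂ (proj₂ h₁)))

  K : ℕ
  K = N ⊔ (proj₁ (cauchy x η 0<η) ⊔ (proj₁ (cauchy y η 0<η) ⊔ proj₁ (cauchy z η 0<η)))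

  close : ∀ w → proj₁ (cauchy w η 0<η) ≤ K → ∀ i j → K ≤ i → K ≤ j → seq w i ℚ.< seq w j ℚ.+ η
  close w w≤K i j K≤i K≤j = ℚ<-from
    (ℚ.≤-<-trans (≤∣∣ _) (proj₂ (cauchy w η 0<η) i j (≤-trans w≤K K≤i) (≤-trans w≤K K≤j)))
    (eq (seq w i) (seq w j) η)
    where
    eq : ∀ a b η → a ℚ.+ η ≡ (a ℚ.- b) ℚ.+ (b ℚ.+ η)
    eq = solveℚ 3 (λ a b η → a :+ η := (a :- b) :+ (b :+ η)) refl

  N≤K : N ≤ K
  N≤K = m≤m⊔n N _
  x≤K : proj₁ (cauchy x η 0<η) ≤ K
  x≤K = ≤-trans (m≤m⊔n _ _) (m≤n⊔m N _)
  y≤K : proj₁ (cauchy y η 0<η) ≤ K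
  y≤K = ≤-trans (m≤m⊔n _ _) (≤-trans (m≤n⊔m (proj₁ (cauchy x η 0<η)) _) (m≤n⊔m N _))
  z≤K : proj₁ (cauchy z η 0<η) ≤ K
  z≤K = ≤-trans (m≤n⊔m (proj₁ (cauchy y η 0<η)) _)
    (≤-trans (m≤n⊔m (proj₁ (cauchy x η 0<η)) _) (m≤n⊔m N _))

  0<2η : 0ℚ ℚ.< η ℚ.+ η
  0<2η = ℚ.+-mono-< 0<η 0<η

  y<x : seq y K ℚ.≤ seq z K ℚ.+ four → y <ℝ x
  y<x h = η ℚ.+ η , 0<2η , K , λ i K≤i → ℚ<-from
    (ℚ.+-mono-< (ℚ.+-mono-<-≤ (close y y≤K i K K≤i ≤-refl) h)
      (ℚ.+-mono-< (close x x≤K K i ≤-refl K≤i)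
        (subst (λ e → seq z K ℚ.+ e ℚ.< seq x K) (sym four+four) (z<x K N≤K))))
    (eq (seq y i) (seq y K) (seq z K) (seq x K) (seq x i) η)
    where
    eq : ∀ yi yk zk xk xi η →
      (yi ℚ.+ (η ℚ.+ η)) ℚ.+ ((yk ℚ.+ η ℚ.+ (zk ℚ.+ ((η ℚ.+ η) ℚ.+ (η ℚ.+ η)))) ℚ.+ ((xi ℚ.+ η) ℚ.+ xk)) ≡
      ((yi ℚ.+ yk) ℚ.+ (xk ℚ.+ (zk ℚ.+ (((η ℚ.+ η) ℚ.+ (η ℚ.+ η)) ℚ.+ ((η ℚ.+ η) ℚ.+ (η ℚ.+ η)))))) ℚ.+ xi
    eq = solveℚ 6 (λ yi yk zk xk xi η →
      (yi :+ (η :+ η)) :+ ((yk :+ η :+ (zk :+ ((η :+ η) :+ (η :+ η)))) :+ ((xi :+ η) :+ xk)) :=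
      ((yi :+ yk) :+ (xk :+ (zk :+ (((η :+ η) :+ (η :+ η)) :+ ((η :+ η) :+ (η :+ η)))))) :+ xi) refl

  z<y : seq z K ℚ.+ four ℚ.≤ seq y K → z <ℝ y
  z<y h = η ℚ.+ η , 0<2η , K , λ i K≤i → ℚ<-from
    (ℚ.+-mono-< (ℚ.+-mono-<-≤ (close z z≤K i K K≤i ≤-refl) h) (close y y≤K K i ≤-refl K≤i))
    (eq (seq z i) (seq z K) (seq y K) (seq y i) η)
    where
    eq : ∀ zi zk yk yi η →
      (zi ℚ.+ (η ℚ.+ η)) ℚ.+ (((zk ℚ.+ η) ℚ.+ yk) ℚ.+ (yi ℚ.+ η)) ≡
      ((zi ℚ.+ (zk ℚ.+ ((η ℚ.+ η) ℚ.+ (η ℚ.+ η)))) ℚ.+ yk) ℚ.+ yi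
    eq = solveℚ 5 (λ zi zk yk yi η →
      (zi :+ (η :+ η)) :+ (((zk :+ η) :+ yk) :+ (yi :+ η)) :=
      ((zi :+ (zk :+ ((η :+ η) :+ (η :+ η)))) :+ yk) :+ yi) refl

  result : Tri (seq y K ℚ.< seq z K ℚ.+ four) (seq y K ≡ seq z K ℚ.+ four) (seq z K ℚ.+ four ℚ.< seq y K) →
           z <ℝ y ⊎ y <ℝ x
  result (tri< lt _ _) = inj₂ (y<x (ℚ.<⇒≤ lt))
  result (tri≈ _ eq _) = inj₂ (y<x (ℚ.≤-reflexive eq))
  result (tri> _ _ gt) = inj₁ (z<y (ℚ.<⇒≤ gt))

≤ℝ-trans : ∀ {x y z} → x ≤ℝ y → y ≤ℝ z → x ≤ℝ z
≤ℝ-trans {x} {y} {z} x≤y y≤z z<x = [ y≤z , x≤y ]′ (cotransitive {x} {z} y z<x)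

-- Values of `τ` at a real point

seq-· : ∀ n ξ k → seq (n · ξ) k ≡ ι n ℚ.* seq ξ k
seq-· zero    ξ k = sym (trans (cong (ℚ._* seq ξ k) ι0) (ℚ.*-zeroˡ (seq ξ k)))
seq-· (suc n) ξ k = trans (cong₂ ℚ._+_ (sym (ℚ.*-identityˡ (seq ξ k))) (seq-· n ξ k))
  (trans (sym (ℚ.*-distribʳ-+ (seq ξ k) 1ℚ (ι n))) (cong (ℚ._* seq ξ k) (sym (ι-suc n))))

seq-lin : ∀ ξ (P : Fin m × Fin n) k →
          seq (lin ξ P) k ≡ ι (suc (toℕ (proj₁ P))) ℚ.+ ι (suc (toℕ (proj₂ P))) ℚ.* seq ξ k
seq-lin ξ (i , j) k = cong₂ ℚ._+_ (sym (ι-def (suc (toℕ i)))) (seq-· (suc (toℕ j)) ξ k)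

infix 4 _<⁺ℝ_

_<⁺ℝ_ = Strict._<⁺_ _<ℝ_

↑ : ℚ ⁺ → ℝ ⁺
↑ = Maybe.map fromℚ

above : ∀ {a ξ} → NonNeg a → ↑ a <⁺ℝ [ ξ ] →
        ∃[ ε ] 0ℚ ℚ.< ε × ∃[ N ] ∀ k → N ≤ k → ι (proj₁ ⟨ a ⟩) ℚ.+ ε ℚ.< ι (proj₂ ⟨ a ⟩) ℚ.* seq ξ k
above {[ x ]} {ξ} 0≤a Strict.[ ε , 0<ε , N , h ] = go (den>0 x)
  where
  q = proj₂ ⟨ [ x ] ⟩
  go : 0 < q → ∃[ ε ] 0ℚ ℚ.< ε × ∃[ N ] ∀ k → N ≤ k → ι (proj₁ ⟨ [ x ] ⟩) ℚ.+ ε ℚ.< ι q ℚ.* seq ξ k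
  go q>0 with q in q≡
  ... | suc d = ι (suc d) ℚ.* ε , *-pos (0<ι d) 0<ε , N , λ k N≤k →
    subst (ℚ._< ι (suc d) ℚ.* seq ξ k)
      (trans (ℚ.*-distribˡ-+ (ι (suc d)) x ε)
        (cong (ℚ._+ ι (suc d) ℚ.* ε) (trans (cong (λ z → ι z ℚ.* x) (sym q≡)) (num-den 0≤a))))
      (*-mono-ι d (h k N≤k))

below : ∀ {b ξ} → NonNeg b → [ ξ ] <⁺ℝ ↑ b →
        ∃[ ε ] 0ℚ ℚ.< ε × ∃[ N ] ∀ k → N ≤ k → ι (proj₂ ⟨ b ⟩) ℚ.* seq ξ k ℚ.+ ε ℚ.< ι (proj₁ ⟨ b ⟩)
below {[ x ]} {ξ} 0≤b Strict.[ ε , 0<ε , N , h ] = go (den>0 x)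
  where
  q = proj₂ ⟨ [ x ] ⟩
  go : 0 < q → ∃[ ε ] 0ℚ ℚ.< ε × ∃[ N ] ∀ k → N ≤ k → ι q ℚ.* seq ξ k ℚ.+ ε ℚ.< ι (proj₁ ⟨ [ x ] ⟩)
  go q>0 with q in q≡
  ... | suc d = ι (suc d) ℚ.* ε , *-pos (0<ι d) 0<ε , N , λ k N≤k →
    subst₂ ℚ._<_ (ℚ.*-distribˡ-+ (ι (suc d)) (seq ξ k) ε)
      (trans (cong (λ z → ι z ℚ.* x) (sym q≡)) (num-den 0≤b))
      (*-mono-ι d (h k N≤k))
-- The weight of `∞` is `(1 , 0)`, so the claim reads ½ < 1, and any positive number below 1 would
-- serve.
below {∞} {ξ} _ Strict.[ _ ]<⊤⁺ = ½ , ℚ.positive⁻¹ ½ , 0 , λ k _ →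
  subst₂ (λ u v → ι v ℚ.* seq ξ k ℚ.+ ½ ℚ.< ι u) (sym (cong proj₁ ⟨∞⟩)) (sym (cong proj₂ ⟨∞⟩))
    (subst₂ ℚ._<_
      (sym (trans (cong (ℚ._+ ½) (trans (cong (ℚ._* seq ξ k) ι0) (ℚ.*-zeroˡ (seq ξ k)))) (ℚ.+-identityˡ ½)))
      (sym ι1) (ℚ.*<* (ℤ.+<+ (s≤s (s≤s z≤n)))))

-- D (L′ - L) = α (p′ - q′ x) + β (q x - p) for the difference L′ - L of two values
-- of the form s + t x, where D is the determinant of the two ends p / q and p′ / q′.
cramer : ∀ p q p′ q′ s t s′ t′ x α β D →
  p′ ℚ.* q ≡ p ℚ.* q′ ℚ.+ D →
  s′ ℚ.* q ℚ.+ t′ ℚ.* p ≡ s ℚ.* q ℚ.+ t ℚ.* p ℚ.+ α →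
  s′ ℚ.* q′ ℚ.+ t′ ℚ.* p′ ≡ s ℚ.* q′ ℚ.+ t ℚ.* p′ ℚ.+ β →
  D ℚ.* (s′ ℚ.+ t′ ℚ.* x) ≡
  D ℚ.* (s ℚ.+ t ℚ.* x) ℚ.+ (α ℚ.* (p′ ℚ.- q′ ℚ.* x) ℚ.+ β ℚ.* (q ℚ.* x ℚ.- p))
cramer p q p′ q′ s t s′ t′ x α β D eD eα eβ = begin
  D ℚ.* (s′ ℚ.+ t′ ℚ.* x)
    ≡⟨ cong (ℚ._* (s′ ℚ.+ t′ ℚ.* x)) (move eD) ⟩
  (p′ ℚ.* q ℚ.- p ℚ.* q′) ℚ.* (s′ ℚ.+ t′ ℚ.* x)
    ≡⟨ identity p q p′ q′ s t s′ t′ x ⟩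
  (p′ ℚ.* q ℚ.- p ℚ.* q′) ℚ.* (s ℚ.+ t ℚ.* x) ℚ.+
  (((s′ ℚ.* q ℚ.+ t′ ℚ.* p) ℚ.- (s ℚ.* q ℚ.+ t ℚ.* p)) ℚ.* (p′ ℚ.- q′ ℚ.* x) ℚ.+
   ((s′ ℚ.* q′ ℚ.+ t′ ℚ.* p′) ℚ.- (s ℚ.* q′ ℚ.+ t ℚ.* p′)) ℚ.* (q ℚ.* x ℚ.- p))
    ≡⟨ cong₂ ℚ._+_ (cong (ℚ._* (s ℚ.+ t ℚ.* x)) (move eD))
         (cong₂ ℚ._+_ (cong (ℚ._* (p′ ℚ.- q′ ℚ.* x)) (move eα)) (cong (ℚ._* (q ℚ.* x ℚ.- p)) (move eβ))) ⟨
  D ℚ.* (s ℚ.+ t ℚ.* x) ℚ.+ (α ℚ.* (p′ ℚ.- q′ ℚ.* x) ℚ.+ β ℚ.* (q ℚ.* x ℚ.- p)) ∎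
  where
  open ≡-Reasoning
  open +-*-Solver using (_:+_; _:-_; _:*_; _:=_) renaming (solve to solveℚ)
  move : ∀ {a b d} → a ≡ b ℚ.+ d → d ≡ a ℚ.- b
  move {_} {b} {d} refl = solveℚ 2 (λ b d → d := (b :+ d) :- b) refl b d
  identity : ∀ p q p′ q′ s t s′ t′ x →
    (p′ ℚ.* q ℚ.- p ℚ.* q′) ℚ.* (s′ ℚ.+ t′ ℚ.* x) ≡
    (p′ ℚ.* q ℚ.- p ℚ.* q′) ℚ.* (s ℚ.+ t ℚ.* x) ℚ.+
    (((s′ ℚ.* q ℚ.+ t′ ℚ.* p) ℚ.- (s ℚ.* q ℚ.+ t ℚ.* p)) ℚ.* (p′ ℚ.- q′ ℚ.* x) ℚ.+
     ((s′ ℚ.* q′ ℚ.+ t′ ℚ.* p′) ℚ.- (s ℚ.* q′ ℚ.+ t ℚ.* p′)) ℚ.* (q ℚ.* x ℚ.- p))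
  identity = solveℚ 9 (λ p q p′ q′ s t s′ t′ x →
    (p′ :* q :- p :* q′) :* (s′ :+ t′ :* x) :=
    (p′ :* q :- p :* q′) :* (s :+ t :* x) :+
    (((s′ :* q :+ t′ :* p) :- (s :* q :+ t :* p)) :* (p′ :- q′ :* x) :+
     ((s′ :* q′ :+ t′ :* p′) :- (s :* q′ :+ t :* p′)) :* (q :* x :- p))) refl

-- One coefficient is at least 1 and contributes more than `ε`; all the rest is nonnegative.
combination> : ∀ α β {A B ε} → α + β ≢ 0 → 0ℚ ℚ.< ε → ε ℚ.< A → ε ℚ.< B → ε ℚ.< ι α ℚ.* A ℚ.+ ι β ℚ.* B
combination> zero zero α+β≢0 _ _ _ = contradiction refl α+β≢0
combination> (suc α) β {A} {B} {ε} _ 0<ε ε<A ε<B = subst₂ ℚ._<_ (ℚ.+-identityʳ ε) (sym expand)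
  (ℚ.+-mono-<-≤ ε<A (ℚ.+-mono-≤ (*-nonNeg (0≤ι α) (0≤ ε<A)) (*-nonNeg (0≤ι β) (0≤ ε<B))))
  where
  0≤ : ∀ {x} → ε ℚ.< x → 0ℚ ℚ.≤ x
  0≤ ε<x = ℚ.<⇒≤ (ℚ.<-trans 0<ε ε<x)
  expand : ι (suc α) ℚ.* A ℚ.+ ι β ℚ.* B ≡ A ℚ.+ (ι α ℚ.* A ℚ.+ ι β ℚ.* B)
  expand = trans (cong (λ z → z ℚ.* A ℚ.+ ι β ℚ.* B) (ι-suc α))
    (trans (cong (ℚ._+ ι β ℚ.* B) (trans (ℚ.*-distribʳ-+ A 1ℚ (ι α)) (cong (ℚ._+ ι α ℚ.* A) (ℚ.*-identityˡ A))))
      (ℚ.+-assoc A _ _))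
combination> zero (suc β) {A} {B} {ε} _ 0<ε ε<A ε<B =
  subst (ε ℚ.<_) (ℚ.+-comm (ι (suc β) ℚ.* B) (ι 0 ℚ.* A)) (combination> (suc β) zero (λ ()) 0<ε ε<B ε<A)

commonBound : ∀ {ε δ} → 0ℚ ℚ.< ε → 0ℚ ℚ.< δ → ∃[ η ] 0ℚ ℚ.< η × η ℚ.≤ ε × η ℚ.≤ δ
commonBound {ε} {δ} 0<ε 0<δ with ℚ.≤-total ε δ
... | inj₁ ε≤δ = ε , 0<ε , ℚ.≤-refl , ε≤δ
... | inj₂ δ≤ε = δ , 0<δ , δ≤ε , ℚ.≤-refl

-- The order at the mediant gives weak inequalities at both ends, with surpluses `α` and `β` that
-- are not both zero. By `cramer` the difference of the two values, times the determinant, is a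
-- combination of two quantities bounded away from zero, so the bound is uniform in the index.
lin-mono-< : ∀ {I ξ} → I ∈ Gⁱⁿᵗ m n → ξ ∈⟨ I ⟩ → {P Q : Fin (suc m) × Fin (suc n)} →
             ℓ (mid I) P < ℓ (mid I) Q → lin ξ P <ℝ lin ξ Q
lin-mono-< {m} {n} {a , b} {ξ} I∈@(a∈ , b∈ , _) (a<ξ , ξ<b) {P} {Q} lt =
  result (above (G-nonNeg a∈) a<ξ) (below (G-nonNeg b∈) ξ<b) (m≤n⇒∃ (Consecutive.a<b C))
    (m≤n⇒∃ (proj₁ ends)) (m≤n⇒∃ (proj₂ ends))
  where
  C = Gⁱⁿᵗ⇒Consecutive I∈
  ends = mid-<⇒ends-≤ C {P} {Q} lt
  p q p′ q′ s t s′ t′ : ℕ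
  p = proj₁ ⟨ a ⟩
  q = proj₂ ⟨ a ⟩
  p′ = proj₁ ⟨ b ⟩
  q′ = proj₂ ⟨ b ⟩
  s = suc (toℕ (proj₁ P))
  t = suc (toℕ (proj₂ P))
  s′ = suc (toℕ (proj₁ Q))
  t′ = suc (toℕ (proj₂ Q))

  ι-bilinear : ∀ a b c d → ι (a * b + c * d) ≡ ι a ℚ.* ι b ℚ.+ ι c ℚ.* ι d
  ι-bilinear a b c d = trans (ι-+ (a * b) (c * d)) (cong₂ ℚ._+_ (ι-* a b) (ι-* c d))

  cast : ∀ w δ → ℓ w Q ≡ ℓ w P + δ →
    ι s′ ℚ.* ι (proj₂ w) ℚ.+ ι t′ ℚ.* ι (proj₁ w) ≡
    ι s ℚ.* ι (proj₂ w) ℚ.+ ι t ℚ.* ι (proj₁ w) ℚ.+ ι δ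
  cast w@(u , v) δ e = trans (sym (ι-bilinear s′ v t′ u)) (trans (cong ι shifted)
    (trans (ι-+ (s * v + t * u) δ) (cong (ℚ._+ ι δ) (ι-bilinear s v t u))))
    where
    regroup : ∀ i j u v → suc i * v + suc j * u ≡ (u + v) + (i * v + j * u)
    regroup = solve-∀
    shifted : s′ * v + t′ * u ≡ s * v + t * u + δ
    shifted = trans (regroup (toℕ (proj₁ Q)) (toℕ (proj₂ Q)) u v)
      (trans (cong (u + v +_) (trans (sym (ℓ-def w Q)) (trans e (cong (_+ δ) (ℓ-def w P)))))
        (trans (sym (+-assoc (u + v) _ δ))
          (cong (_+ δ) (sym (regroup (toℕ (proj₁ P)) (toℕ (proj₂ P)) u v)))))

  result : (∃[ ε ] 0ℚ ℚ.< ε × ∃[ N ] ∀ k → N ≤ k → ι p ℚ.+ ε ℚ.< ι q ℚ.* seq ξ k) →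
           (∃[ ε ] 0ℚ ℚ.< ε × ∃[ N ] ∀ k → N ≤ k → ι q′ ℚ.* seq ξ k ℚ.+ ε ℚ.< ι p′) →
           (∃[ d ] p′ * q ≡ suc (p * q′) + d) →
           (∃[ α ] ℓ ⟨ a ⟩ Q ≡ ℓ ⟨ a ⟩ P + α) → (∃[ β ] ℓ ⟨ b ⟩ Q ≡ ℓ ⟨ b ⟩ P + β) →
           lin ξ P <ℝ lin ξ Q
  result (ε₁ , 0<ε₁ , N₁ , h₁) (ε₂ , 0<ε₂ , N₂ , h₂) (d , det) (α , eα) (β , eβ)
    with commonBound 0<ε₁ 0<ε₂
  -- The determinant is `suc d`, and dividing by it turns the bound `ε` into `ε * r`.
  ... | ε , 0<ε , ε≤ε₁ , ε≤ε₂ = ε ℚ.* r , *-pos 0<ε (0<1/ d) , N₁ ⊔ N₂ , bound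
    where
    open +-*-Solver using (_:+_; _:-_; _:*_; _:=_) renaming (solve to solveℚ)
    r = ℤ.+ 1 ℚ./ suc d

    α+β≢0 : α + β ≢ 0
    α+β≢0 e = <-irrefl refl (subst (ℓ (mid (a , b)) P <_) mid≡ lt)
      where
      mid≡ : ℓ (mid (a , b)) Q ≡ ℓ (mid (a , b)) P
      mid≡ = trans (ℓ-⊕ ⟨ a ⟩ ⟨ b ⟩ Q) (trans (cong₂ _+_
        (trans eα (trans (cong (ℓ ⟨ a ⟩ P +_) (m+n≡0⇒m≡0 α e)) (+-identityʳ _)))
        (trans eβ (trans (cong (ℓ ⟨ b ⟩ P +_) (m+n≡0⇒n≡0 α e)) (+-identityʳ _))))
        (sym (ℓ-⊕ ⟨ a ⟩ ⟨ b ⟩ P)))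

    detℚ : ι p′ ℚ.* ι q ≡ ι p ℚ.* ι q′ ℚ.+ ι (suc d)
    detℚ = trans (sym (ι-* p′ q)) (trans (cong ι (trans det (sym (+-suc (p * q′) d))))
      (trans (ι-+ (p * q′) (suc d)) (cong (ℚ._+ ι (suc d)) (ι-* p q′))))

    bound : ∀ k → N₁ ⊔ N₂ ≤ k → seq (lin ξ P) k ℚ.+ ε ℚ.* r ℚ.< seq (lin ξ Q) k
    bound k N≤k = subst₂ (λ u v → u ℚ.+ ε ℚ.* r ℚ.< v) (sym (seq-lin ξ P k)) (sym (seq-lin ξ Q k))
      (*-cancel-ι d (subst₂ ℚ._<_ (sym scaled) (sym (cramer (ι p) (ι q) (ι p′) (ι q′) (ι s) (ι t) (ι s′) (ι t′)
          x (ι α) (ι β) (ι (suc d)) detℚ (cast ⟨ a ⟩ α eα) (cast ⟨ b ⟩ β eβ)))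
        (ℚ.+-monoʳ-< (ι (suc d) ℚ.* L) (combination> α β α+β≢0 0<ε ε<p′-q′x ε<qx-p))))
      where
      x = seq ξ k
      L = ι s ℚ.+ ι t ℚ.* x
      scaled : ι (suc d) ℚ.* (L ℚ.+ ε ℚ.* r) ≡ ι (suc d) ℚ.* L ℚ.+ ε
      scaled = trans (solveℚ 4 (λ D L ε r → D :* (L :+ ε :* r) := D :* L :+ ε :* (D :* r)) refl (ι (suc d)) L ε r)
        (cong (ι (suc d) ℚ.* L ℚ.+_) (trans (cong (ε ℚ.*_) (trans (/-cancel 1 d) ι1)) (ℚ.*-identityʳ ε)))
      ε<qx-p : ε ℚ.< ι q ℚ.* x ℚ.- ι p
      ε<qx-p = ℚ.≤-<-trans ε≤ε₁ (ℚ<-from (h₁ k (≤-trans (m≤m⊔n N₁ N₂) N≤k))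
        (solveℚ 3 (λ ε y p → ε :+ y := (p :+ ε) :+ (y :- p)) refl ε₁ (ι q ℚ.* x) (ι p)))
      ε<p′-q′x : ε ℚ.< ι p′ ℚ.- ι q′ ℚ.* x
      ε<p′-q′x = ℚ.≤-<-trans ε≤ε₂ (ℚ<-from (h₂ k (≤-trans (m≤n⊔m N₁ N₂) N≤k))
        (solveℚ 3 (λ ε y p → ε :+ p := (y :+ ε) :+ (p :- y)) refl ε₂ (ι q′ ℚ.* x) (ι p′)))

module _ {ξ : ℝ} (i : Fin m) (j : Fin n) where

  private
    P Q : Fin (suc m) × Fin (suc n)
    P = suc i , zero
    Q = zero , suc j

    c r : ℚ
    c = ℤ.+ suc (toℕ i) ℚ./ suc (toℕ j)
    r = ℤ.+ 1 ℚ./ suc (toℕ j)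

    open +-*-Solver using (_:+_; _:-_; _:*_; _:=_; con) renaming (solve to solveℚ)

    seq-P : ∀ k → seq (lin ξ P) k ≡ (1ℚ ℚ.+ ι (suc (toℕ i))) ℚ.+ seq ξ k
    seq-P k = trans (seq-lin ξ P k) (cong₂ ℚ._+_ (ι-suc (suc (toℕ i)))
      (trans (cong (ℚ._* seq ξ k) ι1) (ℚ.*-identityˡ (seq ξ k))))

    seq-Q : ∀ k → seq (lin ξ Q) k ≡ 1ℚ ℚ.+ (1ℚ ℚ.+ ι (suc (toℕ j))) ℚ.* seq ξ k
    seq-Q k = trans (seq-lin ξ Q k) (cong₂ (λ u v → u ℚ.+ v ℚ.* seq ξ k) ι1 (ι-suc (suc (toℕ j))))

    scaled : ∀ y ε → ι (suc (toℕ j)) ℚ.* (y ℚ.+ ε ℚ.* r) ≡ ι (suc (toℕ j)) ℚ.* y ℚ.+ ε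
    scaled y ε = trans
      (solveℚ 4 (λ D L ε r → D :* (L :+ ε :* r) := D :* L :+ ε :* (D :* r)) refl (ι (suc (toℕ j))) y ε r)
      (cong (ι (suc (toℕ j)) ℚ.* y ℚ.+_)
        (trans (cong (ε ℚ.*_) (trans (/-cancel 1 (toℕ j)) ι1)) (ℚ.*-identityʳ ε)))

    scaled-c : ι (suc (toℕ j)) ℚ.* c ≡ ι (suc (toℕ i))
    scaled-c = /-cancel (suc (toℕ i)) (toℕ j)

  -- After the common `1 + ξ` is cancelled, the two cells compare `i + 1` with `(j + 1) ξ`; thus
  -- each fraction of `G m n` is tested by one pair of cells.
  lin<⇒frac< : lin ξ P <ℝ lin ξ Q → fromℚ c <ℝ ξ
  lin<⇒frac< (ε , 0<ε , N , h) = ε ℚ.* r , *-pos 0<ε (0<1/ (toℕ j)) , N , λ k N≤k →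
    *-cancel-ι (toℕ j) (subst (ℚ._< ι (suc (toℕ j)) ℚ.* seq ξ k)
      (sym (trans (scaled c ε) (cong (ℚ._+ ε) scaled-c)))
      (ℚ<-from (subst₂ (λ u v → u ℚ.+ ε ℚ.< v) (seq-P k) (seq-Q k) (h k N≤k))
        (solveℚ 4 (λ a b x ε → (a :+ ε) :+ (con 1ℚ :+ (con 1ℚ :+ b) :* x) :=
                               (((con 1ℚ :+ a) :+ x) :+ ε) :+ b :* x) refl
          (ι (suc (toℕ i))) (ι (suc (toℕ j))) (seq ξ k) ε)))

  lin>⇒<frac : lin ξ Q <ℝ lin ξ P → ξ <ℝ fromℚ c
  lin>⇒<frac (ε , 0<ε , N , h) = ε ℚ.* r , *-pos 0<ε (0<1/ (toℕ j)) , N , λ k N≤k →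
    *-cancel-ι (toℕ j) (subst₂ ℚ._<_ (sym (scaled (seq ξ k) ε)) (sym scaled-c)
      (ℚ<-from (subst₂ (λ u v → u ℚ.+ ε ℚ.< v) (seq-Q k) (seq-P k) (h k N≤k))
        (solveℚ 4 (λ a b x ε → (b :* x :+ ε) :+ ((con 1ℚ :+ a) :+ x) :=
                               ((con 1ℚ :+ (con 1ℚ :+ b) :* x) :+ ε) :+ a) refl
          (ι (suc (toℕ i))) (ι (suc (toℕ j))) (seq ξ k) ε)))

-- Membership of ξ in the interval is only needed up to double negation, since
-- the comparisons of cells are stable.
module _ {I : Interval} {ξ : ℝ} (I∈ : I ∈ Gⁱⁿᵗ m n) (ξ∈ : ¬ ¬ (ξ ∈⟨ I ⟩)) where

  lin≤⇒ℓ≤ : ∀ {P Q : Fin (suc m) × Fin (suc n)} → lin ξ P ≤ℝ lin ξ Q → ℓ (mid I) P ≤ ℓ (mid I) Q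
  lin≤⇒ℓ≤ P≤Q = ≮⇒≥ λ Q<P → ξ∈ λ ξ∈I → P≤Q (lin-mono-< I∈ ξ∈I Q<P)

  ℓ≤⇒lin≤ : ∀ {P Q : Fin (suc m) × Fin (suc n)} → ℓ (mid I) P ≤ ℓ (mid I) Q → lin ξ P ≤ℝ lin ξ Q
  ℓ≤⇒lin≤ {P} {Q} P≤Q Q<P = ξ∈ λ ξ∈I → [ (λ lt → <ℝ-asym {lin ξ P} {lin ξ Q} (lin-mono-< I∈ ξ∈I lt) Q<P)
    , (λ e → <ℝ-irrefl {lin ξ P} (subst (λ R → lin ξ R <ℝ lin ξ P) (sym (Gⁱⁿᵗ-injective I∈ e)) Q<P)) ]′
    (m≤n⇒m<n∨m≡n P≤Q)

  τ≡τℕ : (ξ? : Comparable (suc m) (suc n) ξ) → ∀ P → τ ξ ξ? P ≡ τℕ (mid I) P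
  τ≡τℕ ξ? P = sym (trans (τℕ-def (mid I) P) (trans (sum²-def _)
    (sum-cong-≗ {suc m} λ s → sum-cong-≗ {suc n} λ t →
      trans (⟦≼⟧-def (ℓ (mid I) (s , t)) (ℓ (mid I) P))
        (⟦⟧-cong (ℓ (mid I) (s , t) ≤? ℓ (mid I) P) (ξ? (s , t) P) ℓ≤⇒lin≤ lin≤⇒ℓ≤))))

  comparable : Comparable (suc m) (suc n) ξ
  comparable P Q = map′ ℓ≤⇒lin≤ lin≤⇒ℓ≤ (ℓ (mid I) P ≤? ℓ (mid I) Q)

  terminal≡st : (ξ? : Comparable (suc m) (suc n) ξ) → terminal m n (τ ξ ξ?) ≡ st (I , m , n)
  terminal≡st ξ? = cong₂ (λ s t → s , t , suc m , suc n) (τ≡τℕ ξ? (colEnd m n)) (τ≡τℕ ξ? (rowEnd m n))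

ST˘-st : ∀ {I} → I ∈ Gⁱⁿᵗ m n → ST˘ (I , m , n) (st (I , m , n))
ST˘-st I∈ ξ ξ∈ =
  let ξ? = comparable I∈ (λ ¬ξ∈ → ¬ξ∈ ξ∈)
  in ξ? , sym (terminal≡st I∈ (λ ¬ξ∈ → ¬ξ∈ ξ∈) ξ?)

-- Young terminal pairs as terminal pairs of intervals

rational-inside : ∀ {a b} → NonNeg a → a <⁺ b → ∃[ r ] 0ℚ ℚ.< r × fromℚ r ∈⟨ a , b ⟩
rational-inside {[ x ]} {[ y ]} [ 0≤x ] [ x<y ] =
  let r , x<r , r<y = ℚ.<-dense x<y
  in r , ℚ.≤-<-trans (ℚ.nonNegative⁻¹ x ⦃ 0≤x ⦄) x<r ,
     (Strict.[ fromℚ-mono x<r ] , Strict.[ fromℚ-mono r<y ])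
rational-inside {[ x ]} {∞} [ 0≤x ] _ =
  x ℚ.+ 1ℚ , ℚ.≤-<-trans (ℚ.nonNegative⁻¹ x ⦃ 0≤x ⦄) x<x+1 ,
  (Strict.[ fromℚ-mono x<x+1 ] , Strict.[ _ ]<⊤⁺)
  where
  x<x+1 : x ℚ.< x ℚ.+ 1ℚ
  x<x+1 = subst (ℚ._< x ℚ.+ 1ℚ) (ℚ.+-identityʳ x) (ℚ.+-monoʳ-< x (ℚ.positive⁻¹ 1ℚ))

st∈TY : ∀ {I} → I ∈ Gⁱⁿᵗ m n → TY (suc m) (suc n) (st (I , m , n))
st∈TY {I = I} I∈@(a∈ , _ , a<b , _) =
  let r , 0<r , r∈ = rational-inside (G-nonNeg a∈) a<b
      r∈′ : ¬ ¬ (fromℚ r ∈⟨ I ⟩)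
      r∈′ = λ ¬r∈ → ¬r∈ r∈
      r? = comparable I∈ r∈′
  in τ (fromℚ r) r? ,
     (fromℚ r , fromℚ-mono 0<r , r? , (λ _ → refl) ,
      λ {P} {Q} e → Gⁱⁿᵗ-injective I∈ (τℕ-cancel-≡ (mid I)
        (trans (sym (τ≡τℕ I∈ r∈′ r? P)) (trans e (τ≡τℕ I∈ r∈′ r? Q))))) ,
     sym (terminal≡st I∈ r∈′ r?)

module _ {m n : ℕ} {ξ : ℝ} (0<ξ : fromℚ 0ℚ <ℝ ξ) (ξ? : Comparable (suc m) (suc n) ξ)
         (τ-injective : Injective _≡_ _≡_ (τ ξ ξ?)) where

  private
    -- A decision of `≤ℝ` only refutes strict inequalities, so the side on which a fraction lies is
    -- known only up to double negation.
    Low High : Pred (ℚ ⁺) 0ℓ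
    Low c = ¬ ¬ (↑ c <⁺ℝ [ ξ ])
    High c = ¬ ¬ ([ ξ ] <⁺ℝ ↑ c)

    -- By transitivity both cells have the same cells below them, hence equal values of `τ`. An
    -- injective `τ` therefore prevents `ξ` from coinciding with a fraction of `G m n`.
    tie : ∀ {P Q} → lin ξ P ≤ℝ lin ξ Q → lin ξ Q ≤ℝ lin ξ P → P ≡ Q
    tie {P} {Q} P≤Q Q≤P = τ-injective {P} {Q} (sum-cong-≗ {suc m} λ s → sum-cong-≗ {suc n} λ t →
      ⟦⟧-cong (ξ? (s , t) P) (ξ? (s , t) Q)
        (λ h → ≤ℝ-trans {lin ξ (s , t)} {lin ξ P} {lin ξ Q} h P≤Q)
        (λ h → ≤ℝ-trans {lin ξ (s , t)} {lin ξ Q} {lin ξ P} h Q≤P))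

    sideFrac : (i : Fin m) (j : Fin n) → Dec (lin ξ (suc i , zero {n}) ≤ℝ lin ξ (zero {m} , suc j)) →
               Low (frac (toℕ i) (toℕ j)) ⊎ High (frac (toℕ i) (toℕ j))
    sideFrac i j (yes P≤Q) = inj₁ λ ¬low → case
      tie {suc i , zero} {zero , suc j} P≤Q (λ P<Q → ¬low Strict.[ lin<⇒frac< {ξ = ξ} i j P<Q ]) of λ ()
    sideFrac i j (no P≰Q) = inj₂ λ ¬high → P≰Q λ Q<P → ¬high Strict.[ lin>⇒<frac {ξ = ξ} i j Q<P ]

    side : ∀ {c} → G m n c → Low c ⊎ High c
    side (inj₁ refl) = inj₁ λ ¬low → ¬low Strict.[ 0<ξ ]
    side (inj₂ (inj₁ refl)) = inj₂ λ ¬high → ¬high Strict.[ ξ ]<⊤⁺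
    side (inj₂ (inj₂ (i , j , refl))) = sideFrac i j (ξ? (suc i , zero) (zero , suc j))

  terminal-realised : ∃[ I ] I ∈ Gⁱⁿᵗ m n × terminal m n (τ ξ ξ?) ≡ st (I , m , n)
  terminal-realised =
    let a , b , I∈ , low , high , _ = Gap-between (points m n) (points⊆G m n) (G⊆points m n)
          {Low} {High} side 0∈G ∞∈G [ 0ℚ ]<⊤⁺
          (λ ¬low → ¬low Strict.[ 0<ξ ]) (λ ¬high → ¬high Strict.[ ξ ]<⊤⁺)
    in (a , b) , I∈ , terminal≡st I∈ (λ ¬ξ∈ → low λ a<ξ → high λ ξ<b → ¬ξ∈ (a<ξ , ξ<b)) ξ?

TY⇒st : ∀ {w} → TY (suc m) (suc n) w → ∃[ I ] I ∈ Gⁱⁿᵗ m n × w ≡ st (I , m , n)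
TY⇒st {m} {n} (θ , (ξ , 0<ξ , ξ? , θ≡τ , θ-injective) , refl) =
  let I , I∈ , e = terminal-realised 0<ξ ξ?
        (λ {P} {Q} e → θ-injective (trans (θ≡τ P) (trans e (sym (θ≡τ Q)))))
  in I , I∈ , trans (cong₂ (λ s t → s , t , suc m , suc n) (θ≡τ (colEnd m n)) (θ≡τ (rowEnd m n))) e

-- The bijections and the tree isomorphism

st∈TY˘ : ∀ {v} → v ∈ G˘ k → st v ∈ TY˘ (2 + k)
st∈TY˘ {v = _ , m , n} (refl , I∈) = suc m , suc n , cong suc (+-suc m n) , st∈TY I∈

st∈T˘ : ∀ {v} → v ∈ G˘ k → st v ∈ T˘ (2 + k)
st∈T˘ {v = _ , m , n} (refl , I∈) = suc m , suc n , cong suc (+-suc m n) , st∈T I∈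

level : ∀ {m n k} → suc m + suc n ≡ 2 + k → m + n ≡ k
level {m} {n} e = suc-injective (trans (sym (+-suc m n)) (suc-injective e))

TY˘⇒st : ∀ {w} → w ∈ TY˘ (2 + k) → ∃[ v ] v ∈ G˘ k × w ≡ st v
TY˘⇒st (suc m , suc n , e , w∈) = let I , I∈ , eq = TY⇒st w∈ in (I , m , n) , (level e , I∈) , eq

T˘⇒st : ∀ {w} → w ∈ T˘ (2 + k) → ∃[ v ] v ∈ G˘ k × w ≡ st v
T˘⇒st (suc m , suc n , e , w∈) = let I , I∈ , eq = T⇒st w∈ in (I , m , n) , (level e , I∈) , eq

-- Both sets are the image of `G˘ k` under `st`.
TY˘≐T˘ : TY˘ (2 + k) ≐ T˘ (2 + k)
TY˘≐T˘ {k} = (λ w∈ → let v , v∈ , e = TY˘⇒st w∈ in subst (T˘ (2 + k)) (sym e) (st∈T˘ v∈)) ,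
             (λ w∈ → let v , v∈ , e = T˘⇒st w∈ in subst (TY˘ (2 + k)) (sym e) (st∈TY˘ v∈))

st-bijection : ∀ k → Bijection (Subset (G˘ k)) (Subset (TY˘ (2 + k)))
st-bijection k = record
  { to = λ (v , v∈) → st v , st∈TY˘ v∈
  ; cong = cong st
  ; bijective =
      (λ { {_ , _ , I∈} {_ , _ , J∈} e → st-injective I∈ J∈ e }) ,
      (λ (w , w∈) → let v , v∈ , e = TY˘⇒st w∈ in (v , v∈) , λ z≈v → trans (cong st z≈v) (sym e))
  }

st-root : st rootG ≡ rootT
st-root = cong₂ (λ s t → s , t , 1 , 1) corner≡1 corner≡1
  where
  corner≡1 : τℕ {1} {1} (mid (proj₁ rootG)) (zero , zero) ≡ 1
  corner≡1 = τℕ-corner (mid (proj₁ rootG)) (Gⁱⁿᵗ-injective (proj₂ rootG∈G˘))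

treeIso : ∀ N → 𝕋-G𝕍 N ≅ 𝕋-T𝕦 N
treeIso N = record
  { bijection = record
    { to = λ (k , k≤N , v , v∈) → k , k≤N , st v , st∈T˘ v∈
    ; cong = cong (λ (k , v) → k , st v)
    ; bijective =
        (λ { {k , _ , _ , _ , I∈} {_ , _ , _ , _ , J∈} e →
             cong₂ _,_ (cong proj₁ e) (st-injective I∈ J∈ (cong proj₂ e)) }) ,
        (λ (k , k≤N , w , w∈) → let v , v∈ , e = T˘⇒st w∈ in
          (k , k≤N , v , v∈) , λ z≈v → trans (cong (λ (k , v) → k , st v) z≈v) (cong (k ,_) (sym e)))
    }
  ; to-root = cong (0 ,_) st-root
  ; to-Adj = λ (_ , _ , _ , v∈) (_ , _ , _ , v′∈) → mk⇔
      (λ { (fwd (refl , r)) → fwd (refl , V˘⇒u˘ v′∈ v∈ r)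
         ; (bwd (refl , r)) → bwd (refl , V˘⇒u˘ v∈ v′∈ r) })
      (λ { (fwd (refl , r)) → fwd (refl , u˘⇒V˘ v′∈ v∈ r)
         ; (bwd (refl , r)) → bwd (refl , u˘⇒V˘ v∈ v′∈ r) })
  }

corollary1 : ∀ (N : ℕ) →
    Σ[ TY≐T ∈ (∀ k → k ≤ N → TY˘ (2 + k) ≐ T˘ (2 + k)) ]
    Σ[ ST ∈ (∀ k → k ≤ N → Bijection (Subset (G˘ k)) (Subset (TY˘ (2 + k)))) ]
    (∀ k (k≤N : k ≤ N) v → ST˘ (proj₁ v) (proj₁ (Bijection.to (ST k k≤N) v))) ×
    (Σ[ φ ∈ 𝕋-G𝕍 N ≅ 𝕋-T𝕦 N ]
    (∀ k (k≤N : k ≤ N) v →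
    let (w , w∈TY) = Bijection.to (ST k k≤N) v in
    RootedGraph._≈_ (𝕋-T𝕦 N)
    (_≅_.to φ (k , k≤N , v))
    (k , k≤N , w , proj₁ (TY≐T k k≤N) w∈TY)))
corollary1 N =
  (λ _ _ → TY˘≐T˘) ,
  (λ k _ → st-bijection k) ,
  (λ _ _ (_ , _ , I∈) → ST˘-st I∈) ,
  treeIso N ,
  -- Both bijections act by `st` and differ only in their membership proofs.
  (λ _ _ _ → refl)
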